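{- Consider all tuples of positive integers $(a_1,\ldots,a_K,b_1,\ldots,b_{K+1})$ (with $K\ge 1$ arbitrary) such that $\sum_i a_i=\sum_j b_j$, $a_i\neq b_j$ for all $i,j$, $\gcd(a_1,\ldots,a_K,b_1,\ldots,b_{K+1})=1$, and $$\frac{(a_1n)!\cdots(a_Kn)!}{(b_1n)!\cdots(b_{K+1}n)!}\in\mathbb{N}\quad\text{for all positive integers } n.$$ Then all but finitely many such tuples are, up to permuting the $a_i$ among themselves and the $b_j$ among themselves, of one of the forms $$(a+b;\ a,b),\qquad (2a,2b;\ a,b,a+b),\qquad (2a,b;\ a,2b,a-b)\ \ (a>b),$$ (numerator entries before the semicolon, denominator entries after), for coprime positive integers $a,b$; i.e. corresponding to the factorial ratios $\frac{((a+b)n)!}{(an)!(bn)!}$, $\frac{(2an)!(2bn)!}{(an)!(bn)!((a+b)n)!}$, $\frac{(2an)!(bn)!}{(an)!(2bn)!((a-b)n)!}$. -}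

module Defs where

open import Data.Nat using (ℕ; zero; suc; _+_; _*_; _∸_; _<_; _≤_; _!)
open import Data.Nat.GCD using (gcd)
open import Data.Nat.Divisibility using (_∣_)
open import Data.Nat.Coprimality using (Coprime)
open import Data.Nat.ListAction using (sum; product)
open import Data.List using (List; []; _∷_; [_]; length; map; foldr; _++_)
open import Data.List.Relation.Unary.All using (All)
open import Data.List.Relation.Binary.Permutation.Propositional using (_↭_)
open import Data.Product using (_×_; ∃; ∃-syntax)
open import Data.Sum using (_⊎_)
open import Relation.Binary.PropositionalEquality using (_≡_; _≢_)

gcdList : List ℕ → ℕ
gcdList = foldr gcd 0

factProd : List ℕ → ℕ → ℕ
factProd xs n = product (map (λ x → (x * n) !) xs)

Admissible : List ℕ → List ℕ → Set
Admissible as bs =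
  (1 ≤ length as) ×
  (length bs ≡ suc (length as)) ×
  All (λ x → 0 < x) as ×
  All (λ y → 0 < y) bs ×
  (sum as ≡ sum bs) ×
  All (λ x → All (λ y → x ≢ y) bs) as ×
  (gcdList (as ++ bs) ≡ 1) ×
  (∀ (n : ℕ) → 1 ≤ n → factProd bs n ∣ factProd as n)

InFamily : List ℕ → List ℕ → Set
InFamily as bs = ∃[ a ] ∃[ b ] (0 < a × 0 < b × Coprime a b ×
  ( (as ↭ [ a + b ] × bs ↭ (a ∷ b ∷ []))
  ⊎ (as ↭ (2 * a ∷ 2 * b ∷ []) × bs ↭ (a ∷ b ∷ a + b ∷ []))
  ⊎ (b < a × as ↭ (2 * a ∷ b ∷ []) × bs ↭ (a ∷ 2 * b ∷ a ∸ b ∷ []))))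

{-# OPTIONS --safe #-}
module Submission where

-- Put f(x) = Σ ⌊a x⌋ - Σ ⌊b x⌋. Integrality at n slightly above x p, p a large prime, gives Landau's f ≥ 0, and
-- f(x) + f(-x) = 1 away from the jumps, so f takes only the values 0 and 1. Hence 1/2 - f = Σ ±({c x} - 1/2) has constant
-- modulus, and computing its mean square gives Q = Σ ± gcd(c,c′)²/(c c′) = 3, summed over all pairs of entries.
-- For a prime p, the entries with a given p-adic valuation form layers whose mutual inner products decay like p^-|i-j|.
-- Such Toeplitz forms are bounded below, and induction over primes yields: Q ≥ 1 for every nonempty list, with Q ≥ 5/4
-- unless the list is ±(c) or ±(c; 2c); and Q > 3 for more than 84 entries.
-- Entries whose ratios have large height are nearly orthogonal, so the tuple falls into at most three clusters of
-- commensurable entries. Three clusters must all be minimal, and Σ a = Σ b then leaves exactly the three families. One cluster is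
-- bounded because the gcd is 1. Two clusters with large moduli would be balanced separately and independent of each
-- other, so that f would take a value ≥ 2.

open import Defs
open import Data.Bool.Base using (Bool; true; false; not)
import Data.Bool.Properties as Boolₚ
open import Data.Empty using (⊥)
open import Data.Integer.Base as ℤ using (ℤ)
import Data.Integer.Properties as ℤₚ
open import Data.List.Base using (List; []; _∷_; _++_; length; map; upTo; cartesianProduct; cartesianProductWith)
open import Data.List.Membership.Propositional using (_∈_; find)
open import Data.List.Membership.Propositional.Properties using (∈-map⁺; ∈-++⁺ˡ; ∈-++⁺ʳ; ∈-++⁻; ∈-upTo⁺; ∈-cartesianProductWith⁺; ∈-cartesianProduct⁺)
import Data.List.Properties as Listₚ
open import Data.List.Relation.Binary.Permutation.Propositional as Perm using (_↭_; ↭-refl; ↭-sym; ↭-trans; prep; swap)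
import Data.List.Relation.Binary.Permutation.Propositional.Properties as Permₚ
open import Data.List.Relation.Unary.All as All using (All; []; _∷_)
import Data.List.Relation.Unary.All.Properties as Allₚ
open import Data.List.Relation.Unary.Any as Any using (here; there)
open import Data.Maybe.Base using (Maybe; just; nothing)
open import Data.Nat.Base as ℕ using (ℕ; zero; suc; _+_; _*_; _∸_; _<_; _≤_; z≤n; s≤s)
open import Data.Nat.Coprimality using (Coprime; coprime-divisor; coprime-Bézout)
open import Data.Nat.Divisibility as Div using (_∣_; divides; _∣?_)
import Data.Nat.DivMod as DM
open import Data.Nat.GCD as GCD using (gcd)
open import Data.Nat.Induction using (<-wellFounded)
open import Data.Nat.ListAction using (sum; product)
open import Data.Nat.ListAction.Properties using (∈⇒∣product)
open import Data.Nat.Primality as Primality using (Prime)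
open import Data.Nat.Primality.Factorisation using (factorise; PrimeFactorisation; factorisationHasAllPrimeFactors)
open import Data.Nat.Properties using (*-assoc; *-cancelʳ-<; *-cancelʳ-≤; *-cancelˡ-≡; *-cancelˡ-≤; *-comm; *-distribʳ-+; *-distribˡ-+; *-identityʳ;
  *-identityˡ; *-mono-≤; *-monoʳ-<; *-monoʳ-≤; *-monoˡ-<; *-monoˡ-≤; *-suc; *-zeroʳ; +-assoc; +-cancelʳ-≡;
  +-cancelˡ-<; +-comm; +-identityʳ; +-mono-<; +-mono-≤-<; +-monoʳ-<; +-monoʳ-≤; +-monoˡ-<; +-monoˡ-≤; +-suc;
  1≤n!; <-≤-trans; <⇒≢; <⇒≤; >⇒≢; ^-distribˡ-+-*; m+[n∸m]≡n; m+n∸m≡n; m<m+n; m<n⇒m<1+n; m<n⇒n≢0; m^n≢0; m∸n+n≡m;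
  m∸n≤m; m≤m*n; m≤m+n; m≤n*m; m≤n+m; m≤n⇒m<n∨m≡n; m≤n⇒m≤1+n; m≤n⇒m⊓n≡m; m≥n⇒m⊓n≡n; m⊓n≤m; m⊓n≤n; n<1+n; n∸n≡0;
  n≢0⇒n>0; suc-injective; ∸-monoʳ-<; ∸-monoˡ-≤; ≤-<-trans; module ≤-Reasoning; ≤-antisym; ≤-refl; ≤-reflexive;
  ≤-total; ≤-trans; ≰⇒>; _≤?_)
open import Data.Nat.Tactic.RingSolver using () renaming (solve-∀ to solve-ℕ)
open import Data.Product using (_×_; _,_; proj₁; proj₂; ∃-syntax; Σ)
open import Data.Rational.Base as ℚ using (ℚ; 0ℚ; 1ℚ; _/_; *≤*) renaming (_+_ to _⊕_; _*_ to _⊛_; _-_ to _⊖_; -_ to ⊝_; _≤_ to _≼_)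
open import Data.Rational.Literals using (fromℤ)
import Data.Rational.Properties as ℚₚ
open import Data.Sum using (_⊎_; inj₁; inj₂; [_,_]′)
open import Induction.WellFounded using (Acc; acc)
open import Relation.Binary.PropositionalEquality
open import Relation.Nullary using (yes; no; ¬_)
open import Relation.Nullary.Decidable using (from-no; from-yes)
open import Relation.Nullary.Negation using (contradiction)
open import Tactic.RingSolver using (solve-∀)
open import Tactic.RingSolver.Core.AlmostCommutativeRing using (AlmostCommutativeRing; fromCommutativeRing)

-- Rational arithmetic

-- Three is twelve times the mean square 1/4 of a function with values ±1/2. Each cluster
-- contributes at least 1, so three clusters leave nothing to spare, and the gap from 1 to 5/4
-- decides: it must exceed the cross terms between clusters. Their number is under control only if
-- the length of the tuple is bounded beforehand, and that is the main obstacle. Layering at p loses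
-- a factor (p - 1)/(p + 1), and the product of these factors over all primes is 0, so layering at
-- every prime in turn gives no uniform bound. Only 2, 3, 5 and 7 are treated in this way. A larger
-- prime that divides some but not all entries produces at least two nonempty layers, and an
-- additive constant in the induction hypothesis, gained once per nonempty layer, pays for the loss.
-- No integral occurs: mean squares are finite sums over the midpoints (2k+1)/(2L), where no
-- sawtooth jumps, and the discretisation error is a multiple of (Σ a - Σ b)², which vanishes.

ring : AlmostCommutativeRing _ _
ring = fromCommutativeRing ℚₚ.+-*-commutativeRing isZero?
  where
  isZero? : ∀ x → Maybe (0ℚ ≡ x)
  isZero? x with 0ℚ ℚₚ.≟ x
  ... | yes 0≡x = just 0≡x
  ... | no _ = nothing

fromℤ≡/1 : ∀ i → i / 1 ≡ fromℤ i
fromℤ≡/1 i = ℚₚ.↥p/↧p≡p (fromℤ i)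

fromℤ-+ : ∀ i j → fromℤ (i ℤ.+ j) ≡ fromℤ i ⊕ fromℤ j
fromℤ-+ i j = sym (trans (cong (_/ 1) (cong₂ ℤ._+_ (ℤₚ.*-identityʳ i) (ℤₚ.*-identityʳ j))) (fromℤ≡/1 (i ℤ.+ j)))

fromℤ-* : ∀ i j → fromℤ (i ℤ.* j) ≡ fromℤ i ⊛ fromℤ j
fromℤ-* i j = sym (fromℤ≡/1 (i ℤ.* j))

fromℤ-neg : ∀ i → fromℤ (ℤ.- i) ≡ ⊝ fromℤ i
fromℤ-neg (ℤ.+ zero) = refl
fromℤ-neg (ℤ.+ suc n) = refl
fromℤ-neg ℤ.-[1+ n ] = refl

fromℤ-mono-≤ : ∀ {i j} → i ℤ.≤ j → fromℤ i ≼ fromℤ j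
fromℤ-mono-≤ i≤j = *≤* (ℤₚ.*-monoʳ-≤-nonNeg (ℤ.+ 1) i≤j)

fromℤ-cancel-≤ : ∀ {i j} → fromℤ i ≼ fromℤ j → i ℤ.≤ j
fromℤ-cancel-≤ (*≤* h) = subst₂ ℤ._≤_ (ℤₚ.*-identityʳ _) (ℤₚ.*-identityʳ _) h

fromℤ-injective : ∀ {i j} → fromℤ i ≡ fromℤ j → i ≡ j
fromℤ-injective refl = refl

#_ : ℕ → ℚ
# n = fromℤ (ℤ.+ n)

infix 9 #_

#≥0 : ∀ n → 0ℚ ≼ # n
#≥0 n = fromℤ-mono-≤ (ℤ.+≤+ z≤n)

opaque
  -- Opaque, so that values such as `ι (84 * 84)` are handled by the laws below and never computed;
  -- `ι≡#` gives the numeral back where constants are compared.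
  ι : ℕ → ℚ
  ι n = # n

  ι≡# : ∀ n → ι n ≡ # n
  ι≡# n = refl

  ι0 : ι 0 ≡ 0ℚ
  ι0 = refl

  ι1 : ι 1 ≡ 1ℚ
  ι1 = refl

  ι-+ : ∀ m n → ι (m + n) ≡ ι m ⊕ ι n
  ι-+ m n = fromℤ-+ (ℤ.+ m) (ℤ.+ n)

  ι-* : ∀ m n → ι (m * n) ≡ ι m ⊛ ι n
  ι-* m n = trans (cong fromℤ (ℤₚ.pos-* m n)) (fromℤ-* (ℤ.+ m) (ℤ.+ n))

  ι-suc : ∀ n → ι (suc n) ≡ 1ℚ ⊕ ι n
  ι-suc n = ι-+ 1 n

  ι-mono-≤ : ∀ {m n} → m ≤ n → ι m ≼ ι n
  ι-mono-≤ m≤n = fromℤ-mono-≤ (ℤ.+≤+ m≤n)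

  ι-cancel-≤ : ∀ {m n} → ι m ≼ ι n → m ≤ n
  ι-cancel-≤ h = ℤₚ.drop‿+≤+ (fromℤ-cancel-≤ h)

  ι-nonneg : ∀ n → 0ℚ ≼ ι n
  ι-nonneg n = ι-mono-≤ z≤n

  -- The value 0 at 0 keeps `inv` multiplicative without any positivity hypothesis.
  inv : ℕ → ℚ
  inv zero = 0ℚ
  inv (suc n) = ℚ.1/ ι (suc n)

  inv0 : inv 0 ≡ 0ℚ
  inv0 = refl

  ι-inv : ∀ {n} → 0 < n → ι n ⊛ inv n ≡ 1ℚ
  ι-inv {suc n} _ = ℚₚ.*-inverseʳ (ι (suc n))

-- Inequalities are proved by exhibiting the difference as a visibly nonnegative expression.
≤-by : ∀ {x y} d → 0ℚ ≼ d → y ≡ x ⊕ d → x ≼ y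
≤-by {x} d 0≤d refl = subst (_≼ x ⊕ d) (ℚₚ.+-identityʳ x) (ℚₚ.+-monoʳ-≤ x 0≤d)

≤-by-at : ∀ {x x′ y} d → x ≡ x′ → 0ℚ ≼ d → y ≡ x′ ⊕ d → x ≼ y
≤-by-at d refl = ≤-by d

diff≥0 : ∀ {x y} → x ≼ y → 0ℚ ≼ y ⊖ x
diff≥0 {x} {y} x≤y = subst (_≼ y ⊖ x) (ℚₚ.+-inverseʳ x) (ℚₚ.+-monoˡ-≤ (⊝ x) x≤y)

0≤+ : ∀ {x y} → 0ℚ ≼ x → 0ℚ ≼ y → 0ℚ ≼ x ⊕ y
0≤+ = ℚₚ.+-mono-≤

0≤* : ∀ {x y} → 0ℚ ≼ x → 0ℚ ≼ y → 0ℚ ≼ x ⊛ y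
0≤* {x} {y} 0≤x 0≤y = subst (_≼ x ⊛ y) (ℚₚ.*-zeroʳ x) (ℚₚ.*-monoˡ-≤-nonNeg x {{ℚ.nonNegative 0≤x}} 0≤y)

0≤sq : ∀ x → 0ℚ ≼ x ⊛ x
0≤sq x with ℚₚ.≤-total 0ℚ x
... | inj₁ 0≤x = 0≤* 0≤x 0≤x
... | inj₂ x≤0 = subst (0ℚ ≼_) (lem x) (0≤* (neg x≤0) (neg x≤0))
  where
  lem : ∀ x → ⊝ x ⊛ ⊝ x ≡ x ⊛ x
  lem = solve-∀ ring
  neg : x ≼ 0ℚ → 0ℚ ≼ ⊝ x
  neg = ℚₚ.neg-antimono-≤

*-mono-≤ˡ : ∀ {x y} z → 0ℚ ≼ z → x ≼ y → z ⊛ x ≼ z ⊛ y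
*-mono-≤ˡ z 0≤z = ℚₚ.*-monoˡ-≤-nonNeg z {{ℚ.nonNegative 0≤z}}

opaque
  unfolding ι

  cancel-*-≤ : ∀ {x y} n → 0 < n → ι n ⊛ x ≼ ι n ⊛ y → x ≼ y
  cancel-*-≤ (suc n) _ = ℚₚ.*-cancelˡ-≤-pos (ι (suc n))

cancel-*-≡ : ∀ {x y} n → 0 < n → ι n ⊛ x ≡ ι n ⊛ y → x ≡ y
cancel-*-≡ {x} {y} n 0<n e = begin
  x ≡⟨ lem (ι n) (inv n) x (ι-inv 0<n) ⟩
  inv n ⊛ (ι n ⊛ x) ≡⟨ cong (inv n ⊛_) e ⟩
  inv n ⊛ (ι n ⊛ y) ≡⟨ lem (ι n) (inv n) y (ι-inv 0<n) ⟨
  y ∎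
  where
  open ≡-Reasoning
  assoc : ∀ a b x → (a ⊛ b) ⊛ x ≡ b ⊛ (a ⊛ x)
  assoc = solve-∀ ring
  lem : ∀ a b x → a ⊛ b ≡ 1ℚ → x ≡ b ⊛ (a ⊛ x)
  lem a b x e = trans (sym (trans (cong (_⊛ x) e) (ℚₚ.*-identityˡ x))) (assoc a b x)

inv-nonneg : ∀ n → 0ℚ ≼ inv n
inv-nonneg zero = ℚₚ.≤-reflexive (sym inv0)
inv-nonneg (suc n) = cancel-*-≤ (suc n) (s≤s z≤n) (subst₂ _≼_ (sym (ℚₚ.*-zeroʳ (ι (suc n)))) (trans ι1 (sym (ι-inv {suc n} (s≤s z≤n)))) (ι-nonneg 1))

inv-* : ∀ m n → inv (m * n) ≡ inv m ⊛ inv n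
inv-* zero n = trans inv0 (sym (trans (cong (_⊛ inv n) inv0) (ℚₚ.*-zeroˡ (inv n))))
inv-* (suc m) zero = trans (cong inv (*-zeroʳ m)) (trans inv0 (sym (trans (cong (inv (suc m) ⊛_) inv0) (ℚₚ.*-zeroʳ (inv (suc m))))))
inv-* (suc m) (suc n) = cancel-*-≡ (suc m * suc n) (s≤s z≤n) (begin
  ι (suc m * suc n) ⊛ inv (suc m * suc n) ≡⟨ ι-inv {suc m * suc n} (s≤s z≤n) ⟩
  1ℚ ⊛ 1ℚ ≡⟨ cong₂ _⊛_ (ι-inv {suc m} (s≤s z≤n)) (ι-inv {suc n} (s≤s z≤n)) ⟨
  (ι (suc m) ⊛ inv (suc m)) ⊛ (ι (suc n) ⊛ inv (suc n)) ≡⟨ lem (ι (suc m)) (inv (suc m)) (ι (suc n)) (inv (suc n)) ⟩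
  (ι (suc m) ⊛ ι (suc n)) ⊛ (inv (suc m) ⊛ inv (suc n)) ≡⟨ cong (_⊛ (inv (suc m) ⊛ inv (suc n))) (ι-* (suc m) (suc n)) ⟨
  ι (suc m * suc n) ⊛ (inv (suc m) ⊛ inv (suc n)) ∎)
  where
  open ≡-Reasoning
  lem : ∀ a b c d → (a ⊛ b) ⊛ (c ⊛ d) ≡ (a ⊛ c) ⊛ (b ⊛ d)
  lem = solve-∀ ring

-- Formal combinations and the gcd form

lin : List (ℚ × ℕ) → (ℕ → ℚ) → ℚ
lin [] φ = 0ℚ
lin ((w , c) ∷ xs) φ = w ⊛ φ c ⊕ lin xs φ

lin-cong-All : ∀ {φ χ} {xs} → All (λ x → φ (proj₂ x) ≡ χ (proj₂ x)) xs → lin xs φ ≡ lin xs χ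
lin-cong-All [] = refl
lin-cong-All {xs = (w , c) ∷ xs} (e ∷ es) = cong₂ (λ a b → w ⊛ a ⊕ b) e (lin-cong-All es)

lin-cong : ∀ xs {φ χ} → (∀ c → φ c ≡ χ c) → lin xs φ ≡ lin xs χ
lin-cong xs e = lin-cong-All (All.universal (λ x → e (proj₂ x)) xs)

lin-0 : ∀ xs → lin xs (λ _ → 0ℚ) ≡ 0ℚ
lin-0 [] = refl
lin-0 ((w , c) ∷ xs) = trans (cong (w ⊛ 0ℚ ⊕_) (lin-0 xs)) (lem w)
  where
  lem : ∀ w → w ⊛ 0ℚ ⊕ 0ℚ ≡ 0ℚ
  lem = solve-∀ ring

lin-⊕ : ∀ xs φ χ → lin xs (λ c → φ c ⊕ χ c) ≡ lin xs φ ⊕ lin xs χ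
lin-⊕ [] φ χ = refl
lin-⊕ ((w , c) ∷ xs) φ χ = trans (cong (w ⊛ (φ c ⊕ χ c) ⊕_) (lin-⊕ xs φ χ)) (lem w (φ c) (χ c) (lin xs φ) (lin xs χ))
  where
  lem : ∀ w a b c d → w ⊛ (a ⊕ b) ⊕ (c ⊕ d) ≡ (w ⊛ a ⊕ c) ⊕ (w ⊛ b ⊕ d)
  lem = solve-∀ ring

lin-⊛ : ∀ xs k φ → lin xs (λ c → k ⊛ φ c) ≡ k ⊛ lin xs φ
lin-⊛ [] k φ = sym (ℚₚ.*-zeroʳ k)
lin-⊛ ((w , c) ∷ xs) k φ = trans (cong (w ⊛ (k ⊛ φ c) ⊕_) (lin-⊛ xs k φ)) (lem k w (φ c) (lin xs φ))
  where
  lem : ∀ k w a b → w ⊛ (k ⊛ a) ⊕ k ⊛ b ≡ k ⊛ (w ⊛ a ⊕ b)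
  lem = solve-∀ ring

lin-⊕⊛ : ∀ xs a b φ χ → lin xs (λ c → a ⊛ φ c ⊕ b ⊛ χ c) ≡ a ⊛ lin xs φ ⊕ b ⊛ lin xs χ
lin-⊕⊛ xs a b φ χ = trans (lin-⊕ xs (λ c → a ⊛ φ c) (λ c → b ⊛ χ c)) (cong₂ _⊕_ (lin-⊛ xs a φ) (lin-⊛ xs b χ))

lin-++ : ∀ xs ys φ → lin (xs ++ ys) φ ≡ lin xs φ ⊕ lin ys φ
lin-++ [] ys φ = sym (ℚₚ.+-identityˡ (lin ys φ))
lin-++ ((w , c) ∷ xs) ys φ = trans (cong (w ⊛ φ c ⊕_) (lin-++ xs ys φ)) (sym (ℚₚ.+-assoc (w ⊛ φ c) (lin xs φ) (lin ys φ)))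

lin-swap : ∀ xs ys (φ : ℕ → ℕ → ℚ) → lin xs (λ c → lin ys (φ c)) ≡ lin ys (λ d → lin xs (λ c → φ c d))
lin-swap [] ys φ = sym (lin-0 ys)
lin-swap ((w , c) ∷ xs) ys φ = begin
  w ⊛ lin ys (φ c) ⊕ lin xs (λ c → lin ys (φ c)) ≡⟨ cong₂ _⊕_ (sym (lin-⊛ ys w (φ c))) (lin-swap xs ys φ) ⟩
  lin ys (λ d → w ⊛ φ c d) ⊕ lin ys (λ d → lin xs (λ c → φ c d)) ≡⟨ lin-⊕ ys (λ d → w ⊛ φ c d) (λ d → lin xs (λ c → φ c d)) ⟨
  lin ys (λ d → w ⊛ φ c d ⊕ lin xs (λ c → φ c d)) ∎
  where open ≡-Reasoning

scale : ℚ → List (ℚ × ℕ) → List (ℚ × ℕ)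
scale k = map (λ { (w , c) → (k ⊛ w , c) })

lin-scale : ∀ k xs φ → lin (scale k xs) φ ≡ k ⊛ lin xs φ
lin-scale k [] φ = sym (ℚₚ.*-zeroʳ k)
lin-scale k ((w , c) ∷ xs) φ = trans (cong (k ⊛ w ⊛ φ c ⊕_) (lin-scale k xs φ)) (lem k w (φ c) (lin xs φ))
  where
  lem : ∀ k w a b → k ⊛ w ⊛ a ⊕ k ⊛ b ≡ k ⊛ (w ⊛ a ⊕ b)
  lem = solve-∀ ring

lin-* : ∀ xs ys φ χ → lin xs φ ⊛ lin ys χ ≡ lin xs (λ c → lin ys (λ d → φ c ⊛ χ d))
lin-* xs ys φ χ = begin
  lin xs φ ⊛ lin ys χ ≡⟨ ℚₚ.*-comm (lin xs φ) (lin ys χ) ⟩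
  lin ys χ ⊛ lin xs φ ≡⟨ lin-⊛ xs (lin ys χ) φ ⟨
  lin xs (λ c → lin ys χ ⊛ φ c) ≡⟨ lin-cong xs (λ c → trans (ℚₚ.*-comm (lin ys χ) (φ c)) (sym (lin-⊛ ys (φ c) χ))) ⟩
  lin xs (λ c → lin ys (λ d → φ c ⊛ χ d)) ∎
  where open ≡-Reasoning

-- Twelve times the inner product of the sawtooths {c x} - 1/2 and {d x} - 1/2: their Fourier series
-- share only the frequencies divisible by the lcm of c and d, which gives c d / lcm² = gcd² / (c
-- d). Only the ratio of c and d matters.
K : ℕ → ℕ → ℚ
K c d = (ι (gcd c d) ⊛ ι (gcd c d)) ⊛ (inv c ⊛ inv d)

K-sym : ∀ c d → K c d ≡ K d c
K-sym c d = cong₂ _⊛_ (cong (λ g → ι g ⊛ ι g) (GCD.gcd-comm c d)) (ℚₚ.*-comm (inv c) (inv d))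

K-* : ∀ {m} c d → 0 < m → K (m * c) (m * d) ≡ K c d
K-* {m} c d 0<m = begin
  (ι (gcd (m * c) (m * d)) ⊛ ι (gcd (m * c) (m * d))) ⊛ (inv (m * c) ⊛ inv (m * d))
    ≡⟨ cong₂ _⊛_ (cong₂ _⊛_ e e) (cong₂ _⊛_ (inv-* m c) (inv-* m d)) ⟩
  (ι m ⊛ ι (gcd c d)) ⊛ (ι m ⊛ ι (gcd c d)) ⊛ ((inv m ⊛ inv c) ⊛ (inv m ⊛ inv d))
    ≡⟨ lem (ι m) (inv m) (ι (gcd c d)) (inv c) (inv d) ⟩
  (ι m ⊛ inv m) ⊛ (ι m ⊛ inv m) ⊛ K c d
    ≡⟨ cong (λ u → u ⊛ u ⊛ K c d) (ι-inv 0<m) ⟩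
  1ℚ ⊛ 1ℚ ⊛ K c d ≡⟨ ℚₚ.*-identityˡ (K c d) ⟩
  K c d ∎
  where
  open ≡-Reasoning
  e : ι (gcd (m * c) (m * d)) ≡ ι m ⊛ ι (gcd c d)
  e = trans (cong ι (sym (GCD.c*gcd[m,n]≡gcd[cm,cn] m c d))) (ι-* m (gcd c d))
  lem : ∀ m m′ g c d → (m ⊛ g) ⊛ (m ⊛ g) ⊛ ((m′ ⊛ c) ⊛ (m′ ⊛ d)) ≡ (m ⊛ m′) ⊛ (m ⊛ m′) ⊛ ((g ⊛ g) ⊛ (c ⊛ d))
  lem = solve-∀ ring

gcd-free : ∀ {p c} z → Prime p → ¬ p ∣ c → gcd c (p * z) ≡ gcd c z
gcd-free {p} {c} z pp p∤c = Div.∣-antisym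
  (GCD.gcd-greatest (GCD.gcd[m,n]∣m c (p * z)) (coprime-divisor coprime (GCD.gcd[m,n]∣n c (p * z))))
  (GCD.gcd-greatest (GCD.gcd[m,n]∣m c z) (Div.∣-trans (GCD.gcd[m,n]∣n c z) (Div.n∣m*n p)))
  where
  coprime : Coprime (gcd c (p * z)) p
  coprime {d} (d∣g , d∣p) with Primality.prime⇒irreducible pp d∣p
  ... | inj₁ d≡1 = d≡1
  ... | inj₂ refl = contradiction (Div.∣-trans d∣g (GCD.gcd[m,n]∣m c (p * z))) p∤c

-- The source of the decay between layers: an entry prime to p sees p z as z weakened by 1/p. As z
-- may again be divisible by p, iteration produces all powers of 1/p.
K-free : ∀ {p c} z → Prime p → ¬ p ∣ c → K c (p * z) ≡ inv p ⊛ K c z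
K-free {p} {c} z pp p∤c = trans
  (cong₂ _⊛_ (cong (λ g → ι g ⊛ ι g) (gcd-free z pp p∤c)) (cong (inv c ⊛_) (inv-* p z)))
  (lem (ι (gcd c z)) (inv c) (inv p) (inv z))
  where
  lem : ∀ g c p z → (g ⊛ g) ⊛ (c ⊛ (p ⊛ z)) ≡ p ⊛ ((g ⊛ g) ⊛ (c ⊛ z))
  lem = solve-∀ ring

K-self : ∀ {c} → 0 < c → K c c ≡ 1ℚ
K-self {c} 0<c = begin
  (ι (gcd c c) ⊛ ι (gcd c c)) ⊛ (inv c ⊛ inv c) ≡⟨ cong (λ g → (ι g ⊛ ι g) ⊛ (inv c ⊛ inv c)) (gcd-self c) ⟩
  (ι c ⊛ ι c) ⊛ (inv c ⊛ inv c) ≡⟨ lem (ι c) (inv c) ⟩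
  (ι c ⊛ inv c) ⊛ (ι c ⊛ inv c) ≡⟨ cong (λ u → u ⊛ u) (ι-inv 0<c) ⟩
  1ℚ ∎
  where
  open ≡-Reasoning
  gcd-self : ∀ c → gcd c c ≡ c
  gcd-self c = Div.∣-antisym (GCD.gcd[m,n]∣m c c) (GCD.gcd-greatest Div.∣-refl Div.∣-refl)
  lem : ∀ a b → (a ⊛ a) ⊛ (b ⊛ b) ≡ (a ⊛ b) ⊛ (a ⊛ b)
  lem = solve-∀ ring

K-nonneg : ∀ c d → 0ℚ ≼ K c d
K-nonneg c d = 0≤* (0≤sq (ι (gcd c d))) (0≤* (inv-nonneg c) (inv-nonneg d))

-- B xs ys is twelve times the integral over [0,1] of the product of the sawtooth sums Σ w ({c x} - 1/2) of xs and ys.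
B : List (ℚ × ℕ) → List (ℚ × ℕ) → ℚ
B xs ys = lin xs (λ c → lin ys (K c))

B-sym : ∀ xs ys → B xs ys ≡ B ys xs
B-sym xs ys = trans (lin-swap xs ys K) (lin-cong ys (λ d → lin-cong xs (λ c → K-sym c d)))

B-++ʳ : ∀ xs ys zs → B xs (ys ++ zs) ≡ B xs ys ⊕ B xs zs
B-++ʳ xs ys zs = trans (lin-cong xs (λ c → lin-++ ys zs (K c))) (lin-⊕ xs _ _)

B-scaleʳ : ∀ k xs ys → B xs (scale k ys) ≡ k ⊛ B xs ys
B-scaleʳ k xs ys = trans (lin-cong xs (λ c → lin-scale k ys (K c))) (lin-⊛ xs k _)

B-++-scale : ∀ s t xs ys → let zs = scale s xs ++ scale t ys in
  B zs zs ≡ s ⊛ s ⊛ B xs xs ⊕ (s ⊛ t ⊕ s ⊛ t) ⊛ B xs ys ⊕ t ⊛ t ⊛ B ys ys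
B-++-scale s t xs ys = begin
  B zs zs ≡⟨ expand zs ⟩
  s ⊛ B zs xs ⊕ t ⊛ B zs ys
    ≡⟨ cong₂ (λ a b → s ⊛ a ⊕ t ⊛ b) (trans (B-sym zs xs) (expand xs)) (trans (B-sym zs ys) (expand ys)) ⟩
  s ⊛ (s ⊛ B xs xs ⊕ t ⊛ B xs ys) ⊕ t ⊛ (s ⊛ B ys xs ⊕ t ⊛ B ys ys)
    ≡⟨ cong (λ b → s ⊛ (s ⊛ B xs xs ⊕ t ⊛ B xs ys) ⊕ t ⊛ (s ⊛ b ⊕ t ⊛ B ys ys)) (B-sym ys xs) ⟩
  s ⊛ (s ⊛ B xs xs ⊕ t ⊛ B xs ys) ⊕ t ⊛ (s ⊛ B xs ys ⊕ t ⊛ B ys ys)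
    ≡⟨ lem s t (B xs xs) (B xs ys) (B ys ys) ⟩
  s ⊛ s ⊛ B xs xs ⊕ (s ⊛ t ⊕ s ⊛ t) ⊛ B xs ys ⊕ t ⊛ t ⊛ B ys ys ∎
  where
  open ≡-Reasoning
  zs = scale s xs ++ scale t ys
  expand : ∀ us → B us zs ≡ s ⊛ B us xs ⊕ t ⊛ B us ys
  expand us = trans (B-++ʳ us (scale s xs) (scale t ys)) (cong₂ _⊕_ (B-scaleʳ s us xs) (B-scaleʳ t us ys))
  lem : ∀ s t x b y → s ⊛ (s ⊛ x ⊕ t ⊛ b) ⊕ t ⊛ (s ⊛ b ⊕ t ⊛ y) ≡ s ⊛ s ⊛ x ⊕ (s ⊛ t ⊕ s ⊛ t) ⊛ b ⊕ t ⊛ t ⊛ y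
  lem = solve-∀ ring

-- Division and remainder made total by k div 0 = 0 and k mod 0 = k, so that divisors can range over a list.
_div_ : ℕ → ℕ → ℕ
k div zero = 0
k div suc m = k DM./ suc m

_mod_ : ℕ → ℕ → ℕ
k mod zero = k
k mod suc m = k DM.% suc m

infixl 7 _div_ _mod_

mod-+ : ∀ k m → (k + m) mod m ≡ k mod m
mod-+ k zero = +-identityʳ k
mod-+ k (suc m) = DM.[m+n]%n≡m%n k (suc m)

mod-+* : ∀ k m j → (k + m * j) mod m ≡ k mod m
mod-+* k m zero = cong (_mod m) (trans (cong (k +_) (*-zeroʳ m)) (+-identityʳ k))
mod-+* k m (suc j) = trans (cong (_mod m) (lem k m j)) (trans (mod-+ (k + m * j) m) (mod-+* k m j))
  where
  lem : ∀ k m j → k + m * suc j ≡ k + m * j + m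
  lem = solve-ℕ

mod-< : ∀ {k m} → k < m → k mod m ≡ k
mod-< {m = suc m} k<m = DM.m<n⇒m%n≡m k<m

mod<n : ∀ k {m} → 0 < m → k mod m < m
mod<n k {suc m} _ = DM.m%n<n k (suc m)

mod-div : ∀ k {m} → 0 < m → k ≡ k mod m + m * (k div m)
mod-div k {suc m} _ = trans (DM.m≡m%n+[m/n]*n k (suc m)) (cong (k DM.% suc m +_) (*-comm (k DM./ suc m) (suc m)))

div-*ˡ : ∀ {c} k m → 0 < c → (c * k) div (c * m) ≡ k div m
div-*ˡ {c} k zero _ = cong ((c * k) div_) (*-zeroʳ c)
div-*ˡ {suc c} k (suc m) _ = DM.m*n/m*o≡n/o (suc c) k (suc m)

-- Mean squares of sawtooth sums

∑ : ℕ → (ℕ → ℚ) → ℚ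
∑ zero f = 0ℚ
∑ (suc n) f = ∑ n f ⊕ f n

∑-cong : ∀ n {f g} → (∀ k → k < n → f k ≡ g k) → ∑ n f ≡ ∑ n g
∑-cong zero e = refl
∑-cong (suc n) e = cong₂ _⊕_ (∑-cong n (λ k k<n → e k (m<n⇒m<1+n k<n))) (e n ≤-refl)

∑-⊕ : ∀ n f g → ∑ n (λ k → f k ⊕ g k) ≡ ∑ n f ⊕ ∑ n g
∑-⊕ zero f g = refl
∑-⊕ (suc n) f g = trans (cong (_⊕ (f n ⊕ g n)) (∑-⊕ n f g)) (lem (∑ n f) (∑ n g) (f n) (g n))
  where
  lem : ∀ a b c d → (a ⊕ b) ⊕ (c ⊕ d) ≡ (a ⊕ c) ⊕ (b ⊕ d)
  lem = solve-∀ ring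

∑-⊛ : ∀ n k f → ∑ n (λ i → k ⊛ f i) ≡ k ⊛ ∑ n f
∑-⊛ zero k f = sym (ℚₚ.*-zeroʳ k)
∑-⊛ (suc n) k f = trans (cong (_⊕ k ⊛ f n) (∑-⊛ n k f)) (sym (ℚₚ.*-distribˡ-+ k (∑ n f) (f n)))

∑-0 : ∀ n → ∑ n (λ _ → 0ℚ) ≡ 0ℚ
∑-0 zero = refl
∑-0 (suc n) = trans (cong (_⊕ 0ℚ) (∑-0 n)) refl

∑-const : ∀ n x → ∑ n (λ _ → x) ≡ ι n ⊛ x
∑-const zero x = sym (trans (cong (_⊛ x) ι0) (ℚₚ.*-zeroˡ x))
∑-const (suc n) x = trans (cong (_⊕ x) (∑-const n x)) (trans (lem (ι n) x) (cong (_⊛ x) (sym (ι-suc n))))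
  where
  lem : ∀ n x → n ⊛ x ⊕ x ≡ (1ℚ ⊕ n) ⊛ x
  lem = solve-∀ ring

∑-swap : ∀ m n (f : ℕ → ℕ → ℚ) → ∑ m (λ i → ∑ n (f i)) ≡ ∑ n (λ j → ∑ m (λ i → f i j))
∑-swap zero n f = sym (∑-0 n)
∑-swap (suc m) n f = trans (cong (_⊕ ∑ n (f m)) (∑-swap m n f)) (sym (∑-⊕ n (λ j → ∑ m (λ i → f i j)) (f m)))

∑-+ : ∀ m n f → ∑ (m + n) f ≡ ∑ m f ⊕ ∑ n (λ k → f (m + k))
∑-+ m zero f = trans (cong (λ k → ∑ k f) (+-identityʳ m)) (sym (ℚₚ.+-identityʳ (∑ m f)))
∑-+ m (suc n) f = trans (cong (λ k → ∑ k f) (+-suc m n))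
  (trans (cong (_⊕ f (m + n)) (∑-+ m n f)) (ℚₚ.+-assoc (∑ m f) _ _))

∑-block : ∀ m n f → ∑ (m * n) f ≡ ∑ n (λ q → ∑ m (λ r → f (r + m * q)))
∑-block m zero f = cong (λ k → ∑ k f) (*-zeroʳ m)
∑-block m (suc n) f = begin
  ∑ (m * suc n) f ≡⟨ cong (λ k → ∑ k f) (trans (*-suc m n) (+-comm m (m * n))) ⟩
  ∑ (m * n + m) f ≡⟨ ∑-+ (m * n) m f ⟩
  ∑ (m * n) f ⊕ ∑ m (λ r → f (m * n + r))
    ≡⟨ cong₂ _⊕_ (∑-block m n f) (∑-cong m (λ r _ → cong f (+-comm (m * n) r))) ⟩
  ∑ n (λ q → ∑ m (λ r → f (r + m * q))) ⊕ ∑ m (λ r → f (r + m * n)) ∎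
  where open ≡-Reasoning

∑-shift : ∀ n f → f n ≡ f 0 → ∑ n (λ k → f (suc k)) ≡ ∑ n f
∑-shift n f e = cancel (begin
  ∑ n (λ k → f (suc k)) ⊕ f 0 ≡⟨ lem n ⟩
  ∑ n f ⊕ f n ≡⟨ cong (∑ n f ⊕_) e ⟩
  ∑ n f ⊕ f 0 ∎)
  where
  open ≡-Reasoning
  lem : ∀ n → ∑ n (λ k → f (suc k)) ⊕ f 0 ≡ ∑ n f ⊕ f n
  lem zero = refl
  lem (suc n) = trans (exchange (∑ n (λ k → f (suc k))) (f (suc n)) (f 0)) (cong (_⊕ f (suc n)) (lem n))
    where
    exchange : ∀ a b c → a ⊕ b ⊕ c ≡ a ⊕ c ⊕ b
    exchange = solve-∀ ring
  cancel : ∀ {a b c} → a ⊕ c ≡ b ⊕ c → a ≡ b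
  cancel {a} {b} {c} e = trans (sub a c) (trans (cong (_⊖ c) e) (sym (sub b c)))
    where
    sub : ∀ a c → a ≡ a ⊕ c ⊖ c
    sub = solve-∀ ring

∑-shift* : ∀ n f → (∀ k → f (k + n) ≡ f k) → ∀ s → ∑ n (λ k → f (k + s)) ≡ ∑ n f
∑-shift* n f per zero = ∑-cong n (λ k _ → cong f (+-identityʳ k))
∑-shift* n f per (suc s) = begin
  ∑ n (λ k → f (k + suc s)) ≡⟨ ∑-cong n (λ k _ → cong f (+-suc k s)) ⟩
  ∑ n (λ k → f (suc k + s)) ≡⟨ ∑-shift n (λ k → f (k + s)) (trans (cong f (+-comm n s)) (per s)) ⟩
  ∑ n (λ k → f (k + s)) ≡⟨ ∑-shift* n f per s ⟩
  ∑ n f ∎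
  where open ≡-Reasoning

∑-lin : ∀ n xs (φ : ℕ → ℕ → ℚ) → ∑ n (λ k → lin xs (φ k)) ≡ lin xs (λ c → ∑ n (λ k → φ k c))
∑-lin n [] φ = ∑-0 n
∑-lin n ((w , c) ∷ xs) φ = trans (∑-⊕ n (λ k → w ⊛ φ k c) (λ k → lin xs (φ k)))
  (cong₂ _⊕_ (∑-⊛ n w (λ k → φ k c)) (∑-lin n xs φ))

∑-nonneg : ∀ n {f} → (∀ k → 0ℚ ≼ f k) → 0ℚ ≼ ∑ n f
∑-nonneg zero h = ℚₚ.≤-refl
∑-nonneg (suc n) h = 0≤+ (∑-nonneg n h) (h n)

-- ψ M k = 2M ({x} - 1/2) at the midpoint x = (2k+1)/(2M).
ψ : ℕ → ℕ → ℚ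
ψ M k = ι (suc (2 * (k mod M))) ⊖ ι M

ψ-periodic : ∀ M k → ψ M (k + M) ≡ ψ M k
ψ-periodic M k = cong (λ r → ι (suc (2 * r)) ⊖ ι M) (mod-+ k M)

ψ-+* : ∀ M k j → ψ M (k + M * j) ≡ ψ M k
ψ-+* M k j = cong (λ r → ι (suc (2 * r)) ⊖ ι M) (mod-+* k M j)

ι-odd : ∀ k → ι (suc (2 * k)) ≡ 1ℚ ⊕ (ι k ⊕ ι k)
ι-odd k = trans (ι-suc (2 * k)) (cong (1ℚ ⊕_) (trans (cong ι (cong (k +_) (+-identityʳ k))) (ι-+ k k)))

∑-arith : ∀ n a d → ∑ n (λ j → a ⊕ (ι j ⊕ ι j) ⊛ d) ≡ ι n ⊛ (a ⊖ d) ⊕ (ι n ⊛ ι n) ⊛ d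
∑-arith zero a d rewrite ι0 = lem a d
  where
  lem : ∀ a d → 0ℚ ≡ 0ℚ ⊛ (a ⊖ d) ⊕ (0ℚ ⊛ 0ℚ) ⊛ d
  lem = solve-∀ ring
∑-arith (suc n) a d rewrite ∑-arith n a d | ι-suc n = lem (ι n) a d
  where
  lem : ∀ n a d → n ⊛ (a ⊖ d) ⊕ (n ⊛ n) ⊛ d ⊕ (a ⊕ (n ⊕ n) ⊛ d) ≡ (1ℚ ⊕ n) ⊛ (a ⊖ d) ⊕ ((1ℚ ⊕ n) ⊛ (1ℚ ⊕ n)) ⊛ d
  lem = solve-∀ ring

-- The distribution relation of the first Bernoulli polynomial, averaged over the n residues modulo
-- G n that lie above t. By periodicity the quotient of t by G can be shifted away; what remains is
-- an arithmetic progression inside one period.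
ψ-distribution : ∀ G n t → 0 < G → ∑ n (λ j → ψ (G * n) (t + G * j)) ≡ ι n ⊛ ψ G t
ψ-distribution G n t 0<G = begin
  ∑ n (λ j → ψ (G * n) (t + G * j))
    ≡⟨ ∑-cong n (λ j _ → cong (ψ (G * n)) (trans (cong (_+ G * j) (mod-div t 0<G)) (lem₁ r G q j))) ⟩
  ∑ n (λ j → ψ (G * n) (r + G * (j + q)))
    ≡⟨ ∑-shift* n (λ j → ψ (G * n) (r + G * j)) (λ j → trans (cong (ψ (G * n)) (lem₂ r G j n)) (ψ-periodic (G * n) (r + G * j))) q ⟩
  ∑ n (λ j → ψ (G * n) (r + G * j)) ≡⟨ ∑-cong n small ⟩
  ∑ n (λ j → (1ℚ ⊕ (ι r ⊕ ι r) ⊖ ι G ⊛ ι n) ⊕ (ι j ⊕ ι j) ⊛ ι G)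
    ≡⟨ ∑-arith n (1ℚ ⊕ (ι r ⊕ ι r) ⊖ ι G ⊛ ι n) (ι G) ⟩
  ι n ⊛ ((1ℚ ⊕ (ι r ⊕ ι r) ⊖ ι G ⊛ ι n) ⊖ ι G) ⊕ (ι n ⊛ ι n) ⊛ ι G
    ≡⟨ lem₃ (ι n) (ι r) (ι G) ⟩
  ι n ⊛ ((1ℚ ⊕ (ι r ⊕ ι r)) ⊖ ι G) ≡⟨ cong (λ a → ι n ⊛ (a ⊖ ι G)) (sym (ι-odd r)) ⟩
  ι n ⊛ ψ G t ∎
  where
  open ≡-Reasoning
  r = t mod G
  q = t div G
  lem₁ : ∀ r G q j → r + G * q + G * j ≡ r + G * (j + q)
  lem₁ = solve-ℕ
  lem₂ : ∀ r G j n → r + G * (j + n) ≡ (r + G * j) + G * n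
  lem₂ = solve-ℕ
  lem₃ : ∀ n r G → n ⊛ ((1ℚ ⊕ (r ⊕ r) ⊖ G ⊛ n) ⊖ G) ⊕ (n ⊛ n) ⊛ G ≡ n ⊛ ((1ℚ ⊕ (r ⊕ r)) ⊖ G)
  lem₃ = solve-∀ ring
  lem₄ : ∀ r G j n → (1ℚ ⊕ ((r ⊕ G ⊛ j) ⊕ (r ⊕ G ⊛ j))) ⊖ G ⊛ n ≡ (1ℚ ⊕ (r ⊕ r) ⊖ G ⊛ n) ⊕ (j ⊕ j) ⊛ G
  lem₄ = solve-∀ ring
  bound : ∀ {j} → j < n → r + G * j < G * n
  bound {j} j<n = <-≤-trans (+-monoˡ-< (G * j) (mod<n t 0<G))
    (≤-trans (≤-reflexive (sym (*-suc G j))) (*-monoʳ-≤ G j<n))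
  small : ∀ j → j < n → ψ (G * n) (r + G * j) ≡ (1ℚ ⊕ (ι r ⊕ ι r) ⊖ ι G ⊛ ι n) ⊕ (ι j ⊕ ι j) ⊛ ι G
  small j j<n = begin
    ι (suc (2 * ((r + G * j) mod (G * n)))) ⊖ ι (G * n)
      ≡⟨ cong₂ _⊖_ (trans (cong (λ k → ι (suc (2 * k))) (mod-< (bound j<n))) (ι-odd (r + G * j))) (ι-* G n) ⟩
    1ℚ ⊕ (ι (r + G * j) ⊕ ι (r + G * j)) ⊖ ι G ⊛ ι n
      ≡⟨ cong (λ a → 1ℚ ⊕ (a ⊕ a) ⊖ ι G ⊛ ι n) (trans (ι-+ r (G * j)) (cong (ι r ⊕_) (ι-* G j))) ⟩
    1ℚ ⊕ ((ι r ⊕ ι G ⊛ ι j) ⊕ (ι r ⊕ ι G ⊛ ι j)) ⊖ ι G ⊛ ι n ≡⟨ lem₄ (ι r) (ι G) (ι j) (ι n) ⟩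
    (1ℚ ⊕ (ι r ⊕ ι r) ⊖ ι G ⊛ ι n) ⊕ (ι j ⊕ ι j) ⊛ ι G ∎

-- The centre x is kept independent of n because it has to stay fixed during the induction; `∑-ψ²`
-- sets it to `ι G`.
∑-sq : ∀ n x → # 3 ⊛ ∑ n (λ t → (1ℚ ⊕ (ι t ⊕ ι t) ⊖ x) ⊛ (1ℚ ⊕ (ι t ⊕ ι t) ⊖ x))
  ≡ ι n ⊛ (# 4 ⊛ (ι n ⊛ ι n) ⊖ 1ℚ ⊖ # 6 ⊛ (x ⊛ ι n) ⊕ # 3 ⊛ (x ⊛ x))
∑-sq zero x rewrite ι0 = lem x
  where
  lem : ∀ x → # 3 ⊛ 0ℚ ≡ 0ℚ ⊛ (# 4 ⊛ (0ℚ ⊛ 0ℚ) ⊖ 1ℚ ⊖ # 6 ⊛ (x ⊛ 0ℚ) ⊕ # 3 ⊛ (x ⊛ x))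
  lem = solve-∀ ring
∑-sq (suc n) x rewrite ι-suc n = trans (ℚₚ.*-distribˡ-+ (# 3) (∑ n f) (f n)) (trans (cong (_⊕ # 3 ⊛ f n) (∑-sq n x)) (lem (ι n) x))
  where
  f : ℕ → ℚ
  f t = (1ℚ ⊕ (ι t ⊕ ι t) ⊖ x) ⊛ (1ℚ ⊕ (ι t ⊕ ι t) ⊖ x)
  lem : ∀ n x → n ⊛ (# 4 ⊛ (n ⊛ n) ⊖ 1ℚ ⊖ # 6 ⊛ (x ⊛ n) ⊕ # 3 ⊛ (x ⊛ x)) ⊕ # 3 ⊛ ((1ℚ ⊕ (n ⊕ n) ⊖ x) ⊛ (1ℚ ⊕ (n ⊕ n) ⊖ x))
    ≡ (1ℚ ⊕ n) ⊛ (# 4 ⊛ ((1ℚ ⊕ n) ⊛ (1ℚ ⊕ n)) ⊖ 1ℚ ⊖ # 6 ⊛ (x ⊛ (1ℚ ⊕ n)) ⊕ # 3 ⊛ (x ⊛ x))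
  lem = solve-∀ ring

∑-ψ² : ∀ G → 0 < G → # 3 ⊛ ∑ G (λ t → ψ G t ⊛ ψ G t) ≡ ι G ⊛ (ι G ⊛ ι G ⊖ 1ℚ)
∑-ψ² G 0<G = trans (cong (# 3 ⊛_) (∑-cong G (λ t t<G → cong (λ a → (a ⊖ ι G) ⊛ (a ⊖ ι G)) (e t<G))))
  (trans (∑-sq G (ι G)) (lem (ι G)))
  where
  e : ∀ {t} → t < G → ι (suc (2 * (t mod G))) ≡ 1ℚ ⊕ (ι t ⊕ ι t)
  e {t} t<G = trans (cong (λ k → ι (suc (2 * k))) (mod-< t<G)) (ι-odd t)
  lem : ∀ n → n ⊛ (# 4 ⊛ (n ⊛ n) ⊖ 1ℚ ⊖ # 6 ⊛ (n ⊛ n) ⊕ # 3 ⊛ (n ⊛ n)) ≡ n ⊛ (n ⊛ n ⊖ 1ℚ)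
  lem = solve-∀ ring

iterate-period : ∀ {A : Set} (f : ℕ → A) m → (∀ k → f (k + m) ≡ f k) → ∀ j k → f (k + j * m) ≡ f k
iterate-period f m per zero k = cong f (+-identityʳ k)
iterate-period f m per (suc j) k = trans (cong f (lem k m (j * m))) (trans (per (k + j * m)) (iterate-period f m per j k))
  where
  lem : ∀ k m a → k + (m + a) ≡ k + a + m
  lem = solve-ℕ

gcd-period : ∀ {A : Set} (f : ℕ → A) m n → (∀ k → f (k + m) ≡ f k) → (∀ k → f (k + n) ≡ f k) → ∀ k → f (k + gcd m n) ≡ f k
gcd-period f m n per-m per-n k with GCD.Bézout.identity (GCD.gcd-GCD m n)
... | GCD.Bézout.+- x y eq = trans (sym (iterate-period f n per-n y (k + gcd m n)))
  (trans (cong f (trans (+-assoc k (gcd m n) (y * n)) (cong (k +_) eq))) (iterate-period f m per-m x k))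
... | GCD.Bézout.-+ x y eq = trans (sym (iterate-period f m per-m x (k + gcd m n)))
  (trans (cong f (trans (+-assoc k (gcd m n) (x * m)) (cong (k +_) eq))) (iterate-period f n per-n y k))

-- Averaging ψ M′ over a progression of difference M yields a function with periods M and M′, hence gcd M M′, which the distribution relation identifies.
ψ-average : ∀ M N M′ N′ t → 0 < M → 0 < M′ → M * N ≡ M′ * N′ →
  ∑ N (λ q → ψ M′ (t + M * q)) ≡ ι N ⊛ ψ (gcd M M′) t
ψ-average M N M′ N′ t 0<M 0<M′ MN≡M′N′ = cancel-*-≡ m′ 0<m′ (begin
  ι m′ ⊛ φ t ≡⟨ ∑-const m′ (φ t) ⟨
  ∑ m′ (λ j → φ t) ≡⟨ ∑-cong m′ (λ j _ → sym (trans (cong (λ a → φ (t + a)) (*-comm G j)) (iterate-period φ G φ-G j t))) ⟩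
  ∑ m′ (λ j → φ (t + G * j)) ≡⟨ ∑-swap m′ N (λ j q → ψ M′ (t + G * j + M * q)) ⟩
  ∑ N (λ q → ∑ m′ (λ j → ψ M′ (t + G * j + M * q)))
    ≡⟨ ∑-cong N (λ q _ → ∑-cong m′ (λ j _ → cong₂ ψ eM′ (lem₁ t (G * j) (M * q)))) ⟩
  ∑ N (λ q → ∑ m′ (λ j → ψ (G * m′) (t + M * q + G * j))) ≡⟨ ∑-cong N (λ q _ → ψ-distribution G m′ (t + M * q) 0<G) ⟩
  ∑ N (λ q → ι m′ ⊛ ψ G (t + M * q))
    ≡⟨ ∑-cong N (λ q _ → cong (ι m′ ⊛_) (trans (cong (λ a → ψ G (t + a)) (trans (cong (_* q) eM) (*-assoc G m q))) (ψ-+* G t (m * q)))) ⟩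
  ∑ N (λ q → ι m′ ⊛ ψ G t) ≡⟨ ∑-const N (ι m′ ⊛ ψ G t) ⟩
  ι N ⊛ (ι m′ ⊛ ψ G t) ≡⟨ lem₂ (ι N) (ι m′) (ψ G t) ⟩
  ι m′ ⊛ (ι N ⊛ ψ G t) ∎)
  where
  open ≡-Reasoning
  G = gcd M M′
  φ : ℕ → ℚ
  φ t = ∑ N (λ q → ψ M′ (t + M * q))
  G∣M = GCD.gcd[m,n]∣m M M′
  G∣M′ = GCD.gcd[m,n]∣n M M′
  m = Div.quotient G∣M
  m′ = Div.quotient G∣M′
  eM : M ≡ G * m
  eM = trans (Div._∣_.equality G∣M) (*-comm m G)
  eM′ : M′ ≡ G * m′
  eM′ = trans (Div._∣_.equality G∣M′) (*-comm m′ G)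
  0<m′ : 0 < m′
  0<m′ with m′ | eM′
  ... | zero | e = contradiction 0<M′ (subst (λ k → ¬ 0 < k) (sym (trans e (*-zeroʳ G))) (λ ()))
  ... | suc _ | _ = s≤s z≤n
  0<G : 0 < G
  0<G with G | eM
  ... | zero | refl = 0<M
  ... | suc _ | _ = s≤s z≤n
  lem₁ : ∀ t a b → t + a + b ≡ t + b + a
  lem₁ = solve-ℕ
  lem₂ : ∀ n m x → n ⊛ (m ⊛ x) ≡ m ⊛ (n ⊛ x)
  lem₂ = solve-∀ ring
  φ-M : ∀ t → φ (t + M) ≡ φ t
  φ-M t = trans (∑-cong N (λ q _ → cong (ψ M′) (lem₃ t M q))) (∑-shift N (λ q → ψ M′ (t + M * q)) end)
    where
    lem₃ : ∀ t M q → t + M + M * q ≡ t + M * suc q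
    lem₃ = solve-ℕ
    end : ψ M′ (t + M * N) ≡ ψ M′ (t + M * 0)
    end = trans (cong (λ a → ψ M′ (t + a)) MN≡M′N′) (trans (ψ-+* M′ t N′) (cong (ψ M′) (sym (trans (cong (t +_) (*-zeroʳ M)) (+-identityʳ t)))))
  φ-M′ : ∀ t → φ (t + M′) ≡ φ t
  φ-M′ t = ∑-cong N (λ q _ → trans (cong (ψ M′) (lem₁ t M′ (M * q))) (ψ-periodic M′ (t + M * q)))
  φ-G : ∀ t → φ (t + G) ≡ φ t
  φ-G = gcd-period φ M M′ φ-M φ-M′

-- Averaging over the residue classes modulo M replaces ψ M′ by ψ G, G being the gcd; averaging over
-- the classes modulo G then replaces ψ M by ψ G as well. Only the mean square of ψ G is left.
ψ-correlation : ∀ M N M′ N′ → 0 < M → 0 < M′ → M * N ≡ M′ * N′ →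
  # 3 ⊛ ∑ (M * N) (λ k → ψ M k ⊛ ψ M′ k) ≡ ι (M * N) ⊛ (ι (gcd M M′) ⊛ ι (gcd M M′) ⊖ 1ℚ)
ψ-correlation M N M′ N′ 0<M 0<M′ MN≡M′N′ = begin
  # 3 ⊛ ∑ (M * N) (λ k → ψ M k ⊛ ψ M′ k) ≡⟨ cong (# 3 ⊛_) step₁ ⟩
  # 3 ⊛ (ι N ⊛ ∑ M (λ r → ψ M r ⊛ ψ G r)) ≡⟨ cong (λ a → # 3 ⊛ (ι N ⊛ a)) step₂ ⟩
  # 3 ⊛ (ι N ⊛ (ι m ⊛ ∑ G (λ t → ψ G t ⊛ ψ G t))) ≡⟨ lem₁ (# 3) (ι N) (ι m) _ ⟩
  (ι N ⊛ ι m) ⊛ (# 3 ⊛ ∑ G (λ t → ψ G t ⊛ ψ G t)) ≡⟨ cong ((ι N ⊛ ι m) ⊛_) (∑-ψ² G 0<G) ⟩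
  (ι N ⊛ ι m) ⊛ (ι G ⊛ (ι G ⊛ ι G ⊖ 1ℚ)) ≡⟨ lem₂ (ι N) (ι m) (ι G) ⟩
  ((ι G ⊛ ι m) ⊛ ι N) ⊛ (ι G ⊛ ι G ⊖ 1ℚ)
    ≡⟨ cong (_⊛ (ι G ⊛ ι G ⊖ 1ℚ)) (trans (cong (_⊛ ι N) (trans (sym (ι-* G m)) (cong ι (sym eM)))) (sym (ι-* M N))) ⟩
  ι (M * N) ⊛ (ι G ⊛ ι G ⊖ 1ℚ) ∎
  where
  open ≡-Reasoning
  G = gcd M M′
  m = Div.quotient (GCD.gcd[m,n]∣m M M′)
  eM : M ≡ G * m
  eM = trans (Div._∣_.equality (GCD.gcd[m,n]∣m M M′)) (*-comm m G)
  0<G : 0 < G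
  0<G with G | eM
  ... | zero | refl = 0<M
  ... | suc _ | _ = s≤s z≤n
  lem₁ : ∀ a b c d → a ⊛ (b ⊛ (c ⊛ d)) ≡ (b ⊛ c) ⊛ (a ⊛ d)
  lem₁ = solve-∀ ring
  lem₂ : ∀ n m g → (n ⊛ m) ⊛ (g ⊛ (g ⊛ g ⊖ 1ℚ)) ≡ ((g ⊛ m) ⊛ n) ⊛ (g ⊛ g ⊖ 1ℚ)
  lem₂ = solve-∀ ring
  step₁ : ∑ (M * N) (λ k → ψ M k ⊛ ψ M′ k) ≡ ι N ⊛ ∑ M (λ r → ψ M r ⊛ ψ G r)
  step₁ = begin
    ∑ (M * N) (λ k → ψ M k ⊛ ψ M′ k) ≡⟨ ∑-block M N (λ k → ψ M k ⊛ ψ M′ k) ⟩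
    ∑ N (λ q → ∑ M (λ r → ψ M (r + M * q) ⊛ ψ M′ (r + M * q))) ≡⟨ ∑-swap N M (λ q r → ψ M (r + M * q) ⊛ ψ M′ (r + M * q)) ⟩
    ∑ M (λ r → ∑ N (λ q → ψ M (r + M * q) ⊛ ψ M′ (r + M * q)))
      ≡⟨ ∑-cong M (λ r _ → trans (∑-cong N (λ q _ → cong (_⊛ ψ M′ (r + M * q)) (ψ-+* M r q))) (∑-⊛ N (ψ M r) _)) ⟩
    ∑ M (λ r → ψ M r ⊛ ∑ N (λ q → ψ M′ (r + M * q)))
      ≡⟨ ∑-cong M (λ r _ → trans (cong (ψ M r ⊛_) (ψ-average M N M′ N′ r 0<M 0<M′ MN≡M′N′)) (lem₃ (ψ M r) (ι N) (ψ G r))) ⟩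
    ∑ M (λ r → ι N ⊛ (ψ M r ⊛ ψ G r)) ≡⟨ ∑-⊛ M (ι N) _ ⟩
    ι N ⊛ ∑ M (λ r → ψ M r ⊛ ψ G r) ∎
    where
    lem₃ : ∀ a b c → a ⊛ (b ⊛ c) ≡ b ⊛ (a ⊛ c)
    lem₃ = solve-∀ ring
  step₂ : ∑ M (λ r → ψ M r ⊛ ψ G r) ≡ ι m ⊛ ∑ G (λ t → ψ G t ⊛ ψ G t)
  step₂ = begin
    ∑ M (λ r → ψ M r ⊛ ψ G r) ≡⟨ cong (λ k → ∑ k (λ r → ψ k r ⊛ ψ G r)) eM ⟩
    ∑ (G * m) (λ r → ψ (G * m) r ⊛ ψ G r) ≡⟨ ∑-block G m _ ⟩
    ∑ m (λ j → ∑ G (λ t → ψ (G * m) (t + G * j) ⊛ ψ G (t + G * j))) ≡⟨ ∑-swap m G (λ j t → ψ (G * m) (t + G * j) ⊛ ψ G (t + G * j)) ⟩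
    ∑ G (λ t → ∑ m (λ j → ψ (G * m) (t + G * j) ⊛ ψ G (t + G * j)))
      ≡⟨ ∑-cong G (λ t _ → trans (∑-cong m (λ j _ → trans (cong (ψ (G * m) (t + G * j) ⊛_) (ψ-+* G t j)) (ℚₚ.*-comm (ψ (G * m) (t + G * j)) (ψ G t)))) (∑-⊛ m (ψ G t) _)) ⟩
    ∑ G (λ t → ψ G t ⊛ ∑ m (λ j → ψ (G * m) (t + G * j)))
      ≡⟨ ∑-cong G (λ t _ → trans (cong (ψ G t ⊛_) (ψ-distribution G m t 0<G)) (lem₄ (ψ G t) (ι m))) ⟩
    ∑ G (λ t → ι m ⊛ (ψ G t ⊛ ψ G t)) ≡⟨ ∑-⊛ G (ι m) _ ⟩
    ι m ⊛ ∑ G (λ t → ψ G t ⊛ ψ G t) ∎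
    where
    lem₄ : ∀ a b → a ⊛ (b ⊛ a) ≡ b ⊛ (a ⊛ a)
    lem₄ = solve-∀ ring

-- For c dividing L this is 2L ({c x} - 1/2) at the midpoint x = (2k+1)/(2L), since c x is the k-th
-- midpoint for the modulus L/c.
sawtooth : ℕ → ℕ → ℕ → ℚ
sawtooth L k c = ι c ⊛ ψ (L div c) k

*-div : ∀ {L c} → 0 < c → c ∣ L → c * (L div c) ≡ L
*-div {L} {suc c} _ c∣L = DM.m*[n/m]≡n c∣L

0<div : ∀ {L c} → 0 < c → 0 < L → c ∣ L → 0 < L div c
0<div {L} {c} 0<c 0<L c∣L with L div c | *-div 0<c c∣L
... | zero | e = contradiction 0<L (subst (λ k → ¬ 0 < k) (trans (sym (*-zeroʳ c)) e) (λ ()))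
... | suc _ | _ = s≤s z≤n

-- Converts the gcd of the moduli L/c and L/d, which governs the correlation, into the gcd of the
-- entries c and d, which appears in `K`.
gcd-cofactors : ∀ {c M d N} → c * M ≡ d * N → (c * d) * gcd M N ≡ (c * M) * gcd c d
gcd-cofactors {c} {M} {d} {N} e = begin
  (c * d) * gcd M N ≡⟨ GCD.c*gcd[m,n]≡gcd[cm,cn] (c * d) M N ⟩
  gcd (c * d * M) (c * d * N) ≡⟨ cong₂ gcd (lem₁ c d M) (trans (*-assoc c d N) (trans (cong (c *_) (sym e)) (*-comm c (c * M)))) ⟩
  gcd ((c * M) * d) ((c * M) * c) ≡⟨ GCD.c*gcd[m,n]≡gcd[cm,cn] (c * M) d c ⟨
  (c * M) * gcd d c ≡⟨ cong ((c * M) *_) (GCD.gcd-comm d c) ⟩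
  (c * M) * gcd c d ∎
  where
  open ≡-Reasoning
  lem₁ : ∀ c d M → c * d * M ≡ (c * M) * d
  lem₁ = solve-ℕ

sawtooth-correlation : ∀ {L c d} → 0 < L → 0 < c → 0 < d → c ∣ L → d ∣ L →
  # 3 ⊛ ∑ L (λ k → sawtooth L k c ⊛ sawtooth L k d) ≡ ι L ⊛ ((ι L ⊛ ι L) ⊛ K c d ⊖ ι c ⊛ ι d)
sawtooth-correlation {L} {c} {d} 0<L 0<c 0<d c∣L d∣L = begin
  # 3 ⊛ ∑ L (λ k → (ι c ⊛ ψ M k) ⊛ (ι d ⊛ ψ N k))
    ≡⟨ cong (# 3 ⊛_) (trans (∑-cong L (λ k _ → lem₁ (ι c) (ψ M k) (ι d) (ψ N k))) (∑-⊛ L (ι c ⊛ ι d) _)) ⟩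
  # 3 ⊛ ((ι c ⊛ ι d) ⊛ ∑ L (λ k → ψ M k ⊛ ψ N k)) ≡⟨ lem₂ (# 3) (ι c ⊛ ι d) _ ⟩
  (ι c ⊛ ι d) ⊛ (# 3 ⊛ ∑ L (λ k → ψ M k ⊛ ψ N k)) ≡⟨ cong ((ι c ⊛ ι d) ⊛_) corr ⟩
  (ι c ⊛ ι d) ⊛ (ι L ⊛ (ι G ⊛ ι G ⊖ 1ℚ)) ≡⟨ lem₃ (ι c) (ι d) (ι L) (ι G) ⟩
  ι L ⊛ ((ι c ⊛ ι d) ⊛ (ι G ⊛ ι G) ⊖ ι c ⊛ ι d) ≡⟨ cong (λ a → ι L ⊛ (a ⊖ ι c ⊛ ι d)) key ⟩
  ι L ⊛ ((ι L ⊛ ι L) ⊛ K c d ⊖ ι c ⊛ ι d) ∎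
  where
  open ≡-Reasoning
  M = L div c
  N = L div d
  G = gcd M N
  g = gcd c d
  cM = *-div 0<c c∣L
  dN = *-div 0<d d∣L
  Mc = trans (*-comm M c) cM
  corr : # 3 ⊛ ∑ L (λ k → ψ M k ⊛ ψ N k) ≡ ι L ⊛ (ι G ⊛ ι G ⊖ 1ℚ)
  corr = subst (λ l → # 3 ⊛ ∑ l (λ k → ψ M k ⊛ ψ N k) ≡ ι l ⊛ (ι G ⊛ ι G ⊖ 1ℚ)) Mc
    (ψ-correlation M c N d (0<div 0<c 0<L c∣L) (0<div 0<d 0<L d∣L) (trans Mc (sym (trans (*-comm N d) dN))))
  lem₁ : ∀ a b c d → (a ⊛ b) ⊛ (c ⊛ d) ≡ (a ⊛ c) ⊛ (b ⊛ d)
  lem₁ = solve-∀ ring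
  lem₂ : ∀ a b c → a ⊛ (b ⊛ c) ≡ b ⊛ (a ⊛ c)
  lem₂ = solve-∀ ring
  lem₃ : ∀ c d L G → (c ⊛ d) ⊛ (L ⊛ (G ⊛ G ⊖ 1ℚ)) ≡ L ⊛ ((c ⊛ d) ⊛ (G ⊛ G) ⊖ c ⊛ d)
  lem₃ = solve-∀ ring
  cofactors : (ι c ⊛ ι d) ⊛ ι G ≡ ι L ⊛ ι g
  cofactors = begin
    (ι c ⊛ ι d) ⊛ ι G ≡⟨ cong (_⊛ ι G) (ι-* c d) ⟨
    ι (c * d) ⊛ ι G ≡⟨ ι-* (c * d) G ⟨
    ι ((c * d) * G) ≡⟨ cong ι (trans (gcd-cofactors {c} {M} {d} {N} (trans cM (sym dN))) (cong (_* g) cM)) ⟩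
    ι (L * g) ≡⟨ ι-* L g ⟩
    ι L ⊛ ι g ∎
  key : (ι c ⊛ ι d) ⊛ (ι G ⊛ ι G) ≡ (ι L ⊛ ι L) ⊛ K c d
  key = begin
    (ι c ⊛ ι d) ⊛ (ι G ⊛ ι G) ≡⟨ trans (sym (ℚₚ.*-identityʳ _)) (cong₂ (λ a b → ((ι c ⊛ ι d) ⊛ (ι G ⊛ ι G)) ⊛ (a ⊛ b)) (sym (ι-inv 0<c)) (sym (ι-inv 0<d))) ⟩
    ((ι c ⊛ ι d) ⊛ (ι G ⊛ ι G)) ⊛ ((ι c ⊛ inv c) ⊛ (ι d ⊛ inv d)) ≡⟨ lem₄ (ι c) (ι d) (ι G) (inv c) (inv d) ⟩
    ((ι c ⊛ ι d) ⊛ ι G) ⊛ ((ι c ⊛ ι d) ⊛ ι G) ⊛ (inv c ⊛ inv d) ≡⟨ cong (λ a → a ⊛ a ⊛ (inv c ⊛ inv d)) cofactors ⟩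
    (ι L ⊛ ι g) ⊛ (ι L ⊛ ι g) ⊛ (inv c ⊛ inv d) ≡⟨ lem₅ (ι L) (ι g) (inv c ⊛ inv d) ⟩
    (ι L ⊛ ι L) ⊛ K c d ∎
    where
    lem₄ : ∀ c d G c′ d′ → ((c ⊛ d) ⊛ (G ⊛ G)) ⊛ ((c ⊛ c′) ⊛ (d ⊛ d′)) ≡ ((c ⊛ d) ⊛ G) ⊛ ((c ⊛ d) ⊛ G) ⊛ (c′ ⊛ d′)
    lem₄ = solve-∀ ring
    lem₅ : ∀ L g x → (L ⊛ g) ⊛ (L ⊛ g) ⊛ x ≡ (L ⊛ L) ⊛ ((g ⊛ g) ⊛ x)
    lem₅ = solve-∀ ring

EntriesDivide : ℕ → List (ℚ × ℕ) → Set
EntriesDivide L = All (λ x → 0 < proj₂ x × proj₂ x ∣ L)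

-- Summing over midpoints instead of integrating costs `ι c ⊛ ι d` for each pair of entries. These
-- errors add up to the square of `lin xs ι`, which is 0 for a balanced list.
mean-square : ∀ {L} xs → 0 < L → EntriesDivide L xs →
  # 3 ⊛ ∑ L (λ k → lin xs (sawtooth L k) ⊛ lin xs (sawtooth L k)) ≡ ι L ⊛ ((ι L ⊛ ι L) ⊛ B xs xs ⊖ lin xs ι ⊛ lin xs ι)
mean-square {L} xs 0<L div = begin
  # 3 ⊛ ∑ L (λ k → lin xs (sawtooth L k) ⊛ lin xs (sawtooth L k))
    ≡⟨ cong (# 3 ⊛_) (trans (∑-cong L (λ k _ → lin-* xs xs (sawtooth L k) (sawtooth L k))) (trans (∑-lin L xs _) (lin-cong xs (λ c → ∑-lin L xs _)))) ⟩
  # 3 ⊛ lin xs (λ c → lin xs (λ d → ∑ L (λ k → sawtooth L k c ⊛ sawtooth L k d)))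
    ≡⟨ trans (sym (lin-⊛ xs (# 3) _)) (lin-cong xs (λ c → sym (lin-⊛ xs (# 3) _))) ⟩
  lin xs (λ c → lin xs (λ d → # 3 ⊛ ∑ L (λ k → sawtooth L k c ⊛ sawtooth L k d)))
    ≡⟨ lin-cong-All (All.map (λ { (0<c , c∣L) → lin-cong-All (All.map (λ { (0<d , d∣L) → sawtooth-correlation 0<L 0<c 0<d c∣L d∣L }) div) }) div) ⟩
  lin xs (λ c → lin xs (λ d → ι L ⊛ ((ι L ⊛ ι L) ⊛ K c d ⊖ ι c ⊛ ι d)))
    ≡⟨ lin-cong xs (λ c → lin-cong xs (λ d → lem₁ (ι L) (K c d) (ι c ⊛ ι d))) ⟩
  lin xs (λ c → lin xs (λ d → (ι L ⊛ (ι L ⊛ ι L)) ⊛ K c d ⊕ (⊝ ι L) ⊛ (ι c ⊛ ι d)))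
    ≡⟨ lin-cong xs (λ c → lin-⊕⊛ xs (ι L ⊛ (ι L ⊛ ι L)) (⊝ ι L) (K c) (λ d → ι c ⊛ ι d)) ⟩
  lin xs (λ c → (ι L ⊛ (ι L ⊛ ι L)) ⊛ lin xs (K c) ⊕ (⊝ ι L) ⊛ lin xs (λ d → ι c ⊛ ι d))
    ≡⟨ lin-⊕⊛ xs (ι L ⊛ (ι L ⊛ ι L)) (⊝ ι L) (λ c → lin xs (K c)) (λ c → lin xs (λ d → ι c ⊛ ι d)) ⟩
  (ι L ⊛ (ι L ⊛ ι L)) ⊛ B xs xs ⊕ (⊝ ι L) ⊛ lin xs (λ c → lin xs (λ d → ι c ⊛ ι d))
    ≡⟨ cong (λ a → (ι L ⊛ (ι L ⊛ ι L)) ⊛ B xs xs ⊕ (⊝ ι L) ⊛ a) (lin-* xs xs ι ι) ⟨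
  (ι L ⊛ (ι L ⊛ ι L)) ⊛ B xs xs ⊕ (⊝ ι L) ⊛ (lin xs ι ⊛ lin xs ι) ≡⟨ lem₁ (ι L) (B xs xs) (lin xs ι ⊛ lin xs ι) ⟨
  ι L ⊛ ((ι L ⊛ ι L) ⊛ B xs xs ⊖ lin xs ι ⊛ lin xs ι) ∎
  where
  open ≡-Reasoning
  lem₁ : ∀ L b y → L ⊛ ((L ⊛ L) ⊛ b ⊖ y) ≡ (L ⊛ (L ⊛ L)) ⊛ b ⊕ (⊝ L) ⊛ y
  lem₁ = solve-∀ ring

Positive : List (ℚ × ℕ) → Set
Positive = All (λ x → 0 < proj₂ x)

common-multiple : ∀ xs → Positive xs → ∃[ L ] 0 < L × EntriesDivide L xs
common-multiple [] [] = 1 , s≤s z≤n , []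
common-multiple ((w , c) ∷ xs) (0<c ∷ pos) with common-multiple xs pos
... | L , 0<L , div = c * L , *-mono-≤ 0<c 0<L , (0<c , Div.m∣m*n L) ∷ All.map (λ { (0<d , d∣L) → 0<d , Div.∣-trans d∣L (Div.n∣m*n c) }) div

-- By `mean-square`, L³ times the form is three times a sum of squares plus L times the square of
-- `lin xs ι`; the three factors L are then cancelled.
B-nonneg : ∀ xs → Positive xs → 0ℚ ≼ B xs xs
B-nonneg xs pos with common-multiple xs pos
... | L , 0<L , div = cancel-*-≤ L 0<L (cancel-*-≤ L 0<L (cancel-*-≤ L 0<L
  (≤-by _ (0≤+ (0≤* (#≥0 3) (∑-nonneg L (λ k → 0≤sq (lin xs (sawtooth L k))))) (0≤* (ι-nonneg L) (0≤sq (lin xs ι))))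
    (trans (lem (ι L) (B xs xs) (lin xs ι)) (cong (λ a → ι L ⊛ (ι L ⊛ (ι L ⊛ 0ℚ)) ⊕ (a ⊕ ι L ⊛ (lin xs ι ⊛ lin xs ι))) (sym (mean-square xs 0<L div)))))))
  where
  lem : ∀ L b y → L ⊛ (L ⊛ (L ⊛ b)) ≡ L ⊛ (L ⊛ (L ⊛ 0ℚ)) ⊕ (L ⊛ ((L ⊛ L) ⊛ b ⊖ y ⊛ y) ⊕ L ⊛ (y ⊛ y))
  lem = solve-∀ ring

scale-positive : ∀ k xs → Positive xs → Positive (scale k xs)
scale-positive k xs = Allₚ.map⁺

B-form-nonneg : ∀ s t xs ys → Positive xs → Positive ys →
  0ℚ ≼ s ⊛ s ⊛ B xs xs ⊕ (s ⊛ t ⊕ s ⊛ t) ⊛ B xs ys ⊕ t ⊛ t ⊛ B ys ys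
B-form-nonneg s t xs ys px py = subst (0ℚ ≼_) (B-++-scale s t xs ys)
  (B-nonneg _ (Allₚ.++⁺ (scale-positive s xs px) (scale-positive t ys py)))

-- Layers with respect to a prime

weight : Bool → ℚ
weight true = 1ℚ
weight false = ⊝ 1ℚ

⟦_⟧ : List (Bool × ℕ) → List (ℚ × ℕ)
⟦_⟧ = map (λ { (s , c) → (weight s , c) })

Q : List (Bool × ℕ) → ℚ
Q xs = B ⟦ xs ⟧ ⟦ xs ⟧

-- Entries may repeat, but no number occurs with both signs: the list (+c, -c) would have Q = 0, and
-- Q ≥ 1 would fail.
record Good (xs : List (Bool × ℕ)) : Set where
  field
    positive : ∀ {s c} → (s , c) ∈ xs → 0 < c
    consistent : ∀ {s t c} → (s , c) ∈ xs → (t , c) ∈ xs → s ≡ t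

open Good

Good⇒Positive : ∀ {xs} → Good xs → Positive ⟦ xs ⟧
Good⇒Positive {xs} good = Allₚ.map⁺ (All.tabulate (λ x∈xs → positive good x∈xs))

Good-⊆ : ∀ {xs ys} → (∀ {s c} → (s , c) ∈ ys → (s , c) ∈ xs) → Good xs → Good ys
Good-⊆ sub good = record
  { positive = λ m → positive good (sub m)
  ; consistent = λ m n → consistent good (sub m) (sub n)
  }

-- The measure for the inductions over primes: it drops when entries are divided by p, where the
-- length may stay the same.
size : List (Bool × ℕ) → ℕ
size [] = 0
size ((s , c) ∷ xs) = c + size xs

0<size : ∀ {xs} → Good xs → 0 < length xs → 0 < size xs
0<size {(s , c) ∷ xs} good _ = <-≤-trans (positive good (here refl)) (m≤m+n c (size xs))

-- The divisible entries are stored as cofactors. `K` is invariant under scaling, so this does not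
-- change the norm of that part, and the cofactors can be split again.
data Split (p : ℕ) : List (Bool × ℕ) → List (Bool × ℕ) → List (Bool × ℕ) → Set where
  [] : Split p [] [] []
  free : ∀ {s c xs h g} → ¬ p ∣ c → Split p xs h g → Split p ((s , c) ∷ xs) ((s , c) ∷ h) g
  divisible : ∀ {s c xs h g} → Split p xs h g → Split p ((s , p * c) ∷ xs) h ((s , c) ∷ g)

split : ∀ p xs → ∃[ h ] ∃[ g ] Split p xs h g
split p [] = [] , [] , []
split p ((s , c) ∷ xs) with split p xs | p ∣? c
... | h , g , sp | no p∤c = (s , c) ∷ h , g , free p∤c sp
... | h , g , sp | yes (divides q refl) = h , (s , q) ∷ g , subst (λ k → Split p ((s , k) ∷ xs) h ((s , q) ∷ g)) (*-comm p q) (divisible sp)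

module _ {p : ℕ} where

  split-lin : ∀ {xs h g} → Split p xs h g → ∀ φ → lin ⟦ xs ⟧ φ ≡ lin ⟦ h ⟧ φ ⊕ lin ⟦ g ⟧ (λ c → φ (p * c))
  split-lin [] φ = refl
  split-lin {xs = (s , c) ∷ xs} {h = _ ∷ h} {g} (free _ sp) φ = trans (cong (weight s ⊛ φ c ⊕_) (split-lin sp φ))
    (sym (ℚₚ.+-assoc (weight s ⊛ φ c) (lin ⟦ h ⟧ φ) (lin ⟦ g ⟧ (λ c → φ (p * c)))))
  split-lin {xs = (s , _) ∷ xs} {h} {g = (_ , c) ∷ g} (divisible sp) φ = trans (cong (weight s ⊛ φ (p * c) ⊕_) (split-lin sp φ))
    (lem (weight s ⊛ φ (p * c)) (lin ⟦ h ⟧ φ) (lin ⟦ g ⟧ (λ c → φ (p * c))))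
    where
    lem : ∀ a b c → a ⊕ (b ⊕ c) ≡ b ⊕ (a ⊕ c)
    lem = solve-∀ ring

  split-free : ∀ {xs h g} → Split p xs h g → All (λ x → ¬ p ∣ proj₂ x) ⟦ h ⟧
  split-free [] = []
  split-free (free p∤c sp) = p∤c ∷ split-free sp
  split-free (divisible sp) = split-free sp

  split-∈ˡ : ∀ {xs h g} → Split p xs h g → ∀ {s c} → (s , c) ∈ h → (s , c) ∈ xs
  split-∈ˡ (free _ sp) (here refl) = here refl
  split-∈ˡ (free _ sp) (there m) = there (split-∈ˡ sp m)
  split-∈ˡ (divisible sp) m = there (split-∈ˡ sp m)

  split-∈ʳ : ∀ {xs h g} → Split p xs h g → ∀ {s c} → (s , c) ∈ g → (s , p * c) ∈ xs
  split-∈ʳ (free _ sp) m = there (split-∈ʳ sp m)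
  split-∈ʳ (divisible sp) (here refl) = here refl
  split-∈ʳ (divisible sp) (there m) = there (split-∈ʳ sp m)

  split-length : ∀ {xs h g} → Split p xs h g → length xs ≡ length h + length g
  split-length [] = refl
  split-length (free _ sp) = cong suc (split-length sp)
  split-length {h = h} {_ ∷ g} (divisible sp) = trans (cong suc (split-length sp)) (sym (+-suc (length h) (length g)))

  split-size : ∀ {xs h g} → Split p xs h g → size xs ≡ size h + p * size g
  split-size [] = sym (*-zeroʳ p)
  split-size {h = (s , c) ∷ h} (free _ sp) = trans (cong (c +_) (split-size sp)) (sym (+-assoc c (size h) _))
  split-size {h = h} {(s , c) ∷ g} (divisible sp) = trans (cong (p * c +_) (split-size sp)) (lem p c (size h) (size g))
    where
    lem : ∀ p c h g → p * c + (h + p * g) ≡ h + p * (c + g)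
    lem = solve-ℕ

  split-Goodˡ : ∀ {xs h g} → Split p xs h g → Good xs → Good h
  split-Goodˡ sp = Good-⊆ (split-∈ˡ sp)

  split-Goodʳ : ∀ {xs h g} → Split p xs h g → Good xs → Good g
  split-Goodʳ sp good = record
    { positive = λ {s} {c} m → 0<factor c (positive good (split-∈ʳ sp m))
    ; consistent = λ m n → consistent good (split-∈ʳ sp m) (split-∈ʳ sp n)
    }
    where
    0<factor : ∀ c → 0 < p * c → 0 < c
    0<factor zero h = contradiction h (subst (λ k → ¬ 0 < k) (sym (*-zeroʳ p)) (λ ()))
    0<factor (suc c) _ = s≤s z≤n

  split-size-≤ : ∀ {xs h g} → Split p xs h g → size h ≤ size xs
  split-size-≤ {h = h} sp = ≤-trans (m≤m+n (size h) _) (≤-reflexive (sym (split-size sp)))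

  split-size-<ʳ : ∀ {xs h g} → 1 < p → Good xs → 0 < length xs → Split p xs h g → size g < size xs
  split-size-<ʳ {xs} {h} {[]} 1<p good nonempty sp = 0<size good nonempty
  split-size-<ʳ {xs} {h} {g@(_ ∷ _)} 1<p good nonempty sp = subst (size g <_) (sym (split-size sp)) (<-≤-trans
    (subst (_< p * size g) (*-identityˡ (size g)) (*-monoˡ-< (size g) {{ℕ.>-nonZero (0<size (split-Goodʳ sp good) (s≤s z≤n))}} 1<p))
    (m≤n+m (p * size g) (size h)))

  split-size-<ˡ : ∀ {xs h g} → 1 < p → Good xs → 0 < length g → Split p xs h g → size h < size xs
  split-size-<ˡ {xs} {h} {g} 1<p good nonempty sp = subst (size h <_) (sym (split-size sp)) (m<m+n (size h)
    (*-mono-≤ (<⇒≤ 1<p) (0<size (split-Goodʳ sp good) nonempty)))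

-- Layer j holds the entries of valuation j, divided by p^j. Layers in between may be empty, but
-- only a nonempty list is split further, so the deepest layer is nonempty.
data Layered (p : ℕ) : List (Bool × ℕ) → Set where
  [] : Layered p []
  layer : ∀ {x xs h g} → Split p (x ∷ xs) h g → Layered p g → Layered p (x ∷ xs)

layered : ∀ {p} → 1 < p → ∀ {xs} → Good xs → Layered p xs
layered {p} 1<p {xs} good = go xs good (<-wellFounded (size xs))
  where
  go : ∀ xs → Good xs → Acc _<_ (size xs) → Layered p xs
  go [] good _ = []
  go xs@(_ ∷ _) good (acc rec) with split p xs
  ... | h , g , sp = layer sp (go g (split-Goodʳ sp good) (rec (split-size-<ʳ 1<p good (s≤s z≤n) sp)))

inv≤1 : ∀ n → inv n ≼ 1ℚ
inv≤1 zero = subst (_≼ 1ℚ) (sym inv0) (#≥0 1)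
inv≤1 (suc n) = cancel-*-≤ (suc n) (s≤s z≤n) (subst₂ _≼_ (trans ι1 (sym (ι-inv {suc n} (s≤s z≤n)))) (sym (ℚₚ.*-identityʳ (ι (suc n)))) (ι-mono-≤ (s≤s z≤n)))

module Layers {p : ℕ} (pp : Prime p) where

  r : ℚ
  r = inv p

  1<p : 1 < p
  1<p = ℕ.nonTrivial⇒n>1 p {{Primality.prime⇒nonTrivial pp}}

  0≤r : 0ℚ ≼ r
  0≤r = inv-nonneg p

  r≤1 : r ≼ 1ℚ
  r≤1 = inv≤1 p

  0≤1-r : 0ℚ ≼ 1ℚ ⊖ r
  0≤1-r = diff≥0 r≤1

  split-Q : ∀ {xs h g} → Split p xs h g → Q xs ≡ Q h ⊕ (r ⊕ r) ⊛ B ⟦ h ⟧ ⟦ g ⟧ ⊕ Q g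
  split-Q {xs} {h} {g} sp = begin
    Q xs ≡⟨ lin-cong ⟦ xs ⟧ (λ c → split-lin sp (K c)) ⟩
    lin ⟦ xs ⟧ (λ c → lin ⟦ h ⟧ (K c) ⊕ lin ⟦ g ⟧ (λ z → K c (p * z)))
      ≡⟨ split-lin sp _ ⟩
    lin ⟦ h ⟧ (λ c → lin ⟦ h ⟧ (K c) ⊕ lin ⟦ g ⟧ (λ z → K c (p * z))) ⊕ lin ⟦ g ⟧ (λ d → lin ⟦ h ⟧ (K (p * d)) ⊕ lin ⟦ g ⟧ (λ z → K (p * d) (p * z)))
      ≡⟨ cong₂ _⊕_ (lin-⊕ ⟦ h ⟧ _ _) (lin-⊕ ⟦ g ⟧ _ _) ⟩
    (Q h ⊕ mixed) ⊕ (lin ⟦ g ⟧ (λ d → lin ⟦ h ⟧ (K (p * d))) ⊕ lin ⟦ g ⟧ (λ d → lin ⟦ g ⟧ (λ z → K (p * d) (p * z))))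
      ≡⟨ cong₂ (λ a b → (Q h ⊕ mixed) ⊕ (a ⊕ b)) mixed′ (lin-cong ⟦ g ⟧ (λ d → lin-cong ⟦ g ⟧ (λ z → K-* d z (<⇒≤ 1<p)))) ⟩
    (Q h ⊕ mixed) ⊕ (mixed ⊕ Q g) ≡⟨ cong (λ m → (Q h ⊕ m) ⊕ (m ⊕ Q g)) mixed≡ ⟩
    (Q h ⊕ r ⊛ B ⟦ h ⟧ ⟦ g ⟧) ⊕ (r ⊛ B ⟦ h ⟧ ⟦ g ⟧ ⊕ Q g) ≡⟨ lem (Q h) r (B ⟦ h ⟧ ⟦ g ⟧) (Q g) ⟩
    Q h ⊕ (r ⊕ r) ⊛ B ⟦ h ⟧ ⟦ g ⟧ ⊕ Q g ∎
    where
    open ≡-Reasoning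
    mixed = lin ⟦ h ⟧ (λ c → lin ⟦ g ⟧ (λ z → K c (p * z)))
    mixed′ : lin ⟦ g ⟧ (λ d → lin ⟦ h ⟧ (K (p * d))) ≡ mixed
    mixed′ = trans (lin-swap ⟦ g ⟧ ⟦ h ⟧ (λ d → K (p * d))) (lin-cong ⟦ h ⟧ (λ c → lin-cong ⟦ g ⟧ (λ z → K-sym (p * z) c)))
    mixed≡ : mixed ≡ r ⊛ B ⟦ h ⟧ ⟦ g ⟧
    mixed≡ = trans (lin-cong-All (All.map (λ p∤c → trans (lin-cong ⟦ g ⟧ (λ z → K-free z pp p∤c)) (lin-⊛ ⟦ g ⟧ r (K _))) (split-free sp)))
      (lin-⊛ ⟦ h ⟧ r (λ c → lin ⟦ g ⟧ (K c)))
    lem : ∀ h r b g → (h ⊕ r ⊛ b) ⊕ (r ⊛ b ⊕ g) ≡ h ⊕ (r ⊕ r) ⊛ b ⊕ g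
    lem = solve-∀ ring

  -- To an entry prime to p the whole list looks like Σ r^j h_j, where h_j is layer j. Writing the
  -- mixed term with this combination turns it into an inner product with a vector whose own norm
  -- `QD` is available, so that positivity of the form can absorb it.
  discounted : ∀ {xs} → Layered p xs → List (ℚ × ℕ)
  discounted [] = []
  discounted (layer {h = h} _ ls) = scale 1ℚ ⟦ h ⟧ ++ scale r (discounted ls)

  discounted-positive : ∀ {xs} → Good xs → (ls : Layered p xs) → Positive (discounted ls)
  discounted-positive good [] = []
  discounted-positive good (layer {h = h} sp ls) = Allₚ.++⁺ (scale-positive 1ℚ ⟦ h ⟧ (Good⇒Positive (split-Goodˡ sp good)))
    (scale-positive r _ (discounted-positive (split-Goodʳ sp good) ls))

  discounted-dual : ∀ {xs} (ls : Layered p xs) {c} → ¬ p ∣ c → lin ⟦ xs ⟧ (K c) ≡ lin (discounted ls) (K c)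
  discounted-dual [] p∤c = refl
  discounted-dual {xs} (layer {h = h} {g} sp ls) {c} p∤c = begin
    lin ⟦ xs ⟧ (K c) ≡⟨ split-lin sp (K c) ⟩
    lin ⟦ h ⟧ (K c) ⊕ lin ⟦ g ⟧ (λ z → K c (p * z))
      ≡⟨ cong₂ _⊕_ (sym (trans (lin-scale 1ℚ ⟦ h ⟧ (K c)) (ℚₚ.*-identityˡ (lin ⟦ h ⟧ (K c))))) (trans (lin-cong ⟦ g ⟧ (λ z → K-free z pp p∤c)) (lin-⊛ ⟦ g ⟧ r (K c))) ⟩
    lin (scale 1ℚ ⟦ h ⟧) (K c) ⊕ r ⊛ lin ⟦ g ⟧ (K c)
      ≡⟨ cong (lin (scale 1ℚ ⟦ h ⟧) (K c) ⊕_) (trans (cong (r ⊛_) (discounted-dual ls p∤c)) (sym (lin-scale r (discounted ls) (K c)))) ⟩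
    lin (scale 1ℚ ⟦ h ⟧) (K c) ⊕ lin (scale r (discounted ls)) (K c) ≡⟨ lin-++ (scale 1ℚ ⟦ h ⟧) _ (K c) ⟨
    lin (discounted (layer sp ls)) (K c) ∎
    where open ≡-Reasoning

  QD : ∀ {xs} → Layered p xs → ℚ
  QD ls = B (discounted ls) (discounted ls)

  mixed : ∀ {xs} → List (Bool × ℕ) → Layered p xs → ℚ
  mixed h ls = B ⟦ h ⟧ (discounted ls)

  layer-Q : ∀ {xs h g} (sp : Split p xs h g) (ls : Layered p g) → Q xs ≡ Q h ⊕ (r ⊕ r) ⊛ mixed h ls ⊕ Q g
  layer-Q {h = h} {g} sp ls = trans (split-Q sp) (cong (λ b → Q h ⊕ (r ⊕ r) ⊛ b ⊕ Q g)
    (lin-cong-All (All.map (λ p∤c → discounted-dual ls p∤c) (split-free sp))))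

  unit-form : ∀ r h b x → 1ℚ ⊛ 1ℚ ⊛ h ⊕ (1ℚ ⊛ r ⊕ 1ℚ ⊛ r) ⊛ b ⊕ x ≡ h ⊕ (r ⊕ r) ⊛ b ⊕ x
  unit-form = solve-∀ ring

  layer-QD : ∀ {x xs h g} (sp : Split p (x ∷ xs) h g) (ls : Layered p g) → QD (layer sp ls) ≡ Q h ⊕ (r ⊕ r) ⊛ mixed h ls ⊕ r ⊛ r ⊛ QD ls
  layer-QD {h = h} sp ls = trans (B-++-scale 1ℚ r ⟦ h ⟧ (discounted ls)) (unit-form r (Q h) (mixed h ls) (r ⊛ r ⊛ QD ls))

  form-nonneg : ∀ t {h xs} → Good h → Good xs → (ls : Layered p xs) → 0ℚ ≼ Q h ⊕ (t ⊕ t) ⊛ mixed h ls ⊕ t ⊛ t ⊛ QD ls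
  form-nonneg t {h} good-h good ls = subst (0ℚ ≼_) (unit-form t (Q h) (mixed h ls) (t ⊛ t ⊛ QD ls))
    (B-form-nonneg 1ℚ t _ _ (Good⇒Positive good-h) (discounted-positive good ls))

  QD-nonneg : ∀ {xs} → Good xs → (ls : Layered p xs) → 0ℚ ≼ QD ls
  QD-nonneg good ls = B-nonneg _ (discounted-positive good ls)

  ∑Q : ∀ {xs} → Layered p xs → ℚ
  ∑Q [] = 0ℚ
  ∑Q (layer {h = h} _ ls) = Q h ⊕ ∑Q ls

  -- The Toeplitz matrix (r^|i-j|) is bounded below by (1-r)/(1+r); the term with QD makes the induction go through.
  ∑Q-bound : ∀ {xs} → Good xs → (ls : Layered p xs) → (1ℚ ⊖ r) ⊛ ∑Q ls ⊕ (r ⊛ (1ℚ ⊕ r)) ⊛ QD ls ≼ (1ℚ ⊕ r) ⊛ Q xs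
  ∑Q-bound good [] = ℚₚ.≤-reflexive (lem r)
    where
    lem : ∀ r → (1ℚ ⊖ r) ⊛ 0ℚ ⊕ (r ⊛ (1ℚ ⊕ r)) ⊛ 0ℚ ≡ (1ℚ ⊕ r) ⊛ 0ℚ
    lem = solve-∀ ring
  ∑Q-bound {xs@(_ ∷ _)} good (layer {h = h} {g} sp ls) = ≤-by-at
    (r ⊛ (1ℚ ⊖ r) ⊛ (Q h ⊕ (1ℚ ⊕ r ⊕ (1ℚ ⊕ r)) ⊛ mixed h ls ⊕ (1ℚ ⊕ r) ⊛ (1ℚ ⊕ r) ⊛ QD ls)
      ⊕ ((1ℚ ⊕ r) ⊛ Q g ⊖ ((1ℚ ⊖ r) ⊛ ∑Q ls ⊕ (r ⊛ (1ℚ ⊕ r)) ⊛ QD ls)))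
    (cong (λ d → (1ℚ ⊖ r) ⊛ (Q h ⊕ ∑Q ls) ⊕ (r ⊛ (1ℚ ⊕ r)) ⊛ d) (layer-QD sp ls))
    (0≤+ (0≤* (0≤* 0≤r 0≤1-r) (form-nonneg (1ℚ ⊕ r) (split-Goodˡ sp good) (split-Goodʳ sp good) ls))
      (diff≥0 (∑Q-bound (split-Goodʳ sp good) ls)))
    (trans (cong ((1ℚ ⊕ r) ⊛_) (layer-Q sp ls))
      (lem r (Q h) (mixed h ls) (Q g) (∑Q ls) (QD ls)))
    where
    lem : ∀ r h b g l d → (1ℚ ⊕ r) ⊛ (h ⊕ (r ⊕ r) ⊛ b ⊕ g) ≡
      (1ℚ ⊖ r) ⊛ (h ⊕ l) ⊕ (r ⊛ (1ℚ ⊕ r)) ⊛ (h ⊕ (r ⊕ r) ⊛ b ⊕ r ⊛ r ⊛ d) ⊕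
      (r ⊛ (1ℚ ⊖ r) ⊛ (h ⊕ (1ℚ ⊕ r ⊕ (1ℚ ⊕ r)) ⊛ b ⊕ (1ℚ ⊕ r) ⊛ (1ℚ ⊕ r) ⊛ d)
        ⊕ ((1ℚ ⊕ r) ⊛ g ⊖ ((1ℚ ⊖ r) ⊛ l ⊕ (r ⊛ (1ℚ ⊕ r)) ⊛ d)))
    lem = solve-∀ ring

  layer-sum-bound : ∀ {xs} → Good xs → (ls : Layered p xs) → (ι p ⊖ 1ℚ) ⊛ ∑Q ls ≼ (ι p ⊕ 1ℚ) ⊛ Q xs
  layer-sum-bound {xs} good ls = ≤-by-at
    (ι p ⊛ ((1ℚ ⊕ r) ⊛ Q xs ⊖ ((1ℚ ⊖ r) ⊛ ∑Q ls ⊕ (r ⊛ (1ℚ ⊕ r)) ⊛ QD ls)) ⊕ ι p ⊛ ((r ⊛ (1ℚ ⊕ r)) ⊛ QD ls))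
    (cong (λ u → (ι p ⊖ u) ⊛ ∑Q ls) (sym pr))
    (0≤+ (0≤* (ι-nonneg p) (diff≥0 (∑Q-bound good ls)))
      (0≤* (ι-nonneg p) (0≤* (0≤* 0≤r (0≤+ (#≥0 1) 0≤r)) (QD-nonneg good ls))))
    (trans (cong (λ u → (ι p ⊕ u) ⊛ Q xs) (sym pr)) (lem (ι p) r (Q xs) (∑Q ls) (QD ls)))
    where
    pr : ι p ⊛ r ≡ 1ℚ
    pr = ι-inv (<⇒≤ 1<p)
    lem : ∀ p r q l d → (p ⊕ p ⊛ r) ⊛ q ≡ (p ⊖ p ⊛ r) ⊛ l ⊕
      (p ⊛ ((1ℚ ⊕ r) ⊛ q ⊖ ((1ℚ ⊖ r) ⊛ l ⊕ (r ⊛ (1ℚ ⊕ r)) ⊛ d)) ⊕ p ⊛ ((r ⊛ (1ℚ ⊕ r)) ⊛ d))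
    lem = solve-∀ ring

  -- The induction hypothesis that `classify` hands to the estimates below.
  AtLeastOne : ℕ → Set
  AtLeastOne n = ∀ {ys} → Good ys → 0 < length ys → size ys ≤ n → 1ℚ ≼ Q ys

  mutual

    -- Comparing `layer-Q` with `layer-QD` gives Q xs - QD = Q g - r² QD g, with `g` the list below
    -- the first layer. Unrolled, Q xs - QD is (1 - r²) times the sum of the `QD` of all proper
    -- tails, and the last tail is the deepest layer, which has norm at least 1. With a single layer
    -- Q equals `QD` and is itself at least 1.
    last-layer-bound : ∀ {xs} → Good xs → 0 < length xs → (ls : Layered p xs) → AtLeastOne (size xs) → r ⊛ QD ls ⊕ (1ℚ ⊖ r) ≼ Q xs
    last-layer-bound {xs@(_ ∷ _)} good nonempty (layer {h = h} {[]} sp []) one = ≤-by ((1ℚ ⊖ r) ⊛ (Q xs ⊖ 1ℚ)) (0≤* 0≤1-r (diff≥0 (one good nonempty ≤-refl)))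
      (trans (lem r (Q xs)) (cong (λ d → r ⊛ d ⊕ (1ℚ ⊖ r) ⊕ (1ℚ ⊖ r) ⊛ (Q xs ⊖ 1ℚ)) Q≡QD))
      where
      lem : ∀ r q → q ≡ r ⊛ q ⊕ (1ℚ ⊖ r) ⊕ (1ℚ ⊖ r) ⊛ (q ⊖ 1ℚ)
      lem = solve-∀ ring
      lem₂ : ∀ r → 0ℚ ≡ r ⊛ r ⊛ 0ℚ
      lem₂ = solve-∀ ring
      Q≡QD : Q xs ≡ QD (layer sp [])
      Q≡QD = trans (layer-Q sp []) (trans (cong (Q h ⊕ (r ⊕ r) ⊛ mixed h [] ⊕_) (lem₂ r)) (sym (layer-QD sp [])))
    last-layer-bound {xs@(_ ∷ _)} good nonempty (layer {g = _ ∷ _} sp ls) one = ≤-by ((1ℚ ⊖ r) ⊛ QD (layer sp ls) ⊕ (Q xs ⊖ (QD (layer sp ls) ⊕ (1ℚ ⊖ r))))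
      (0≤+ (0≤* 0≤1-r (QD-nonneg good (layer sp ls))) (diff≥0 (upper-layers-bound good sp (s≤s z≤n) ls one)))
      (lem r (QD (layer sp ls)) (Q xs))
      where
      lem : ∀ r d q → q ≡ r ⊛ d ⊕ (1ℚ ⊖ r) ⊕ ((1ℚ ⊖ r) ⊛ d ⊕ (q ⊖ (d ⊕ (1ℚ ⊖ r))))
      lem = solve-∀ ring

    upper-layers-bound : ∀ {x xs h g} → Good (x ∷ xs) → (sp : Split p (x ∷ xs) h g) → 0 < length g → (ls : Layered p g) → AtLeastOne (size (x ∷ xs)) →
      QD (layer sp ls) ⊕ (1ℚ ⊖ r) ≼ Q (x ∷ xs)
    upper-layers-bound {x} {xs} {h} {g} good sp nonempty ls one = ≤-by-at
      (r ⊛ (1ℚ ⊖ r) ⊛ QD ls ⊕ (Q g ⊖ (r ⊛ QD ls ⊕ (1ℚ ⊖ r))))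
      (cong (_⊕ (1ℚ ⊖ r)) (layer-QD sp ls))
      (0≤+ (0≤* (0≤* 0≤r 0≤1-r) (QD-nonneg good-g ls)) (diff≥0 (last-layer-bound good-g nonempty ls
        (λ good-ys ne le → one good-ys ne (≤-trans le (<⇒≤ (split-size-<ʳ 1<p good (s≤s z≤n) sp)))))))
      (trans (layer-Q sp ls) (lem r (Q h) (mixed h ls) (Q g) (QD ls)))
      where
      good-g = split-Goodʳ sp good
      lem : ∀ r h b g d → h ⊕ (r ⊕ r) ⊛ b ⊕ g ≡ h ⊕ (r ⊕ r) ⊛ b ⊕ r ⊛ r ⊛ d ⊕ (1ℚ ⊖ r) ⊕ (r ⊛ (1ℚ ⊖ r) ⊛ d ⊕ (g ⊖ (r ⊛ d ⊕ (1ℚ ⊖ r))))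
      lem = solve-∀ ring

  -- Let D be the discounted list of `g`. Positivity of the norm of h + D, taken with coefficient r,
  -- absorbs the mixed term; the r QD that this costs is exactly what `last-layer-bound` supplies
  -- for `g`.
  two-layers-bound : ∀ {xs h g} → Good xs → Split p xs h g → 0 < length g → AtLeastOne (size g) → (1ℚ ⊖ r) ⊛ (Q h ⊕ 1ℚ) ≼ Q xs
  two-layers-bound {xs} {h} {g} good sp nonempty one = ≤-by
    (r ⊛ (Q h ⊕ (1ℚ ⊕ 1ℚ) ⊛ mixed h ls ⊕ 1ℚ ⊛ 1ℚ ⊛ QD ls) ⊕ (Q g ⊖ (r ⊛ QD ls ⊕ (1ℚ ⊖ r))))
    (0≤+ (0≤* 0≤r (form-nonneg 1ℚ (split-Goodˡ sp good) good-g ls)) (diff≥0 (last-layer-bound good-g nonempty ls one)))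
    (trans (layer-Q sp ls) (lem r (Q h) (mixed h ls) (Q g) (QD ls)))
    where
    good-g = split-Goodʳ sp good
    ls = layered 1<p good-g
    lem : ∀ r h b g d → h ⊕ (r ⊕ r) ⊛ b ⊕ g ≡ (1ℚ ⊖ r) ⊛ (h ⊕ 1ℚ) ⊕
      (r ⊛ (h ⊕ (1ℚ ⊕ 1ℚ) ⊛ b ⊕ 1ℚ ⊛ 1ℚ ⊛ d) ⊕ (g ⊖ (r ⊛ d ⊕ (1ℚ ⊖ r))))
    lem = solve-∀ ring

-- Lists of small norm

large-prime-factor? : ∀ b c → 0 < c → (∃[ p ] Prime p × b ≤ p × p ∣ c) ⊎ (∀ q → Prime q → q ∣ c → q < b)
large-prime-factor? b c@(suc _) _ with Any.any? (b ≤?_) factors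
  where open PrimeFactorisation (factorise c)
... | yes any = let (p , p∈ , b≤p) = find any in
    inj₁ (p , All.lookup factorsPrime p∈ , b≤p , subst (p ∣_) (sym isFactorisation) (∈⇒∣product p∈))
  where open PrimeFactorisation (factorise c)
... | no none = inj₂ λ q pp q∣c → ≰⇒> (λ b≤q →
    none (Any.map (λ { refl → b≤q }) (factorisationHasAllPrimeFactors pp (subst (q ∣_) isFactorisation q∣c) factorsPrime)))
  where open PrimeFactorisation (factorise c)

no-prime-factor⇒≡1 : ∀ {c} → 0 < c → (∀ q → Prime q → ¬ q ∣ c) → c ≡ 1
no-prime-factor⇒≡1 {c@(suc _)} _ none with PrimeFactorisation.factors (factorise c) | PrimeFactorisation.isFactorisation (factorise c) | PrimeFactorisation.factorsPrime (factorise c)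
... | [] | eq | _ = eq
... | p ∷ ps | eq | pp ∷ _ = contradiction (subst (p ∣_) (sym eq) (Div.m∣m*n (product ps))) (none p pp)

PrimesBelow : ℕ → List (Bool × ℕ) → Set
PrimesBelow b xs = ∀ {s c q} → (s , c) ∈ xs → Prime q → q ∣ c → q < b

large-prime? : ∀ b xs → Good xs → (∃[ p ] Prime p × b ≤ p × ∃[ s ] ∃[ c ] (s , c) ∈ xs × p ∣ c) ⊎ PrimesBelow b xs
large-prime? b [] good = inj₂ λ ()
large-prime? b ((s , c) ∷ xs) good with large-prime-factor? b c (positive good (here refl)) | large-prime? b xs (Good-⊆ there good)
... | inj₁ (p , pp , b≤p , p∣c) | _ = inj₁ (p , pp , b≤p , s , c , here refl , p∣c)
... | inj₂ _ | inj₁ (p , pp , b≤p , t , d , m , p∣d) = inj₁ (p , pp , b≤p , t , d , there m , p∣d)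
... | inj₂ none | inj₂ nones = inj₂ λ { (here refl) pp q∣c → none _ pp q∣c ; (there m) pp q∣c → nones m pp q∣c }

split-nonempty : ∀ {p xs h g s c} → Split p xs h g → (s , c) ∈ xs → p ∣ c → 0 < length g
split-nonempty (free p∤c sp) (here refl) p∣c = contradiction p∣c p∤c
split-nonempty (free p∤c sp) (there m) p∣c = split-nonempty sp m p∣c
split-nonempty (divisible sp) _ _ = s≤s z≤n

split-Q-[] : ∀ {p xs g} → Prime p → Split p xs [] g → Q xs ≡ Q g
split-Q-[] {p} {g = g} pp sp = trans (Layers.split-Q pp sp) (lem (inv p) (Q g))
  where
  lem : ∀ r q → 0ℚ ⊕ (r ⊕ r) ⊛ 0ℚ ⊕ q ≡ q
  lem = solve-∀ ring

split-[]ʳ : ∀ {p xs h} → Split p xs h [] → xs ≡ h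
split-[]ʳ [] = refl
split-[]ʳ (free _ sp) = cong (_ ∷_) (split-[]ʳ sp)

*-swap : ∀ a b c → a * (b * c) ≡ b * (a * c)
*-swap = solve-ℕ

data Minimal : List (Bool × ℕ) → Set where
  single : ∀ s c → Minimal ((s , c) ∷ [])
  pair : ∀ s c → Minimal ((s , c) ∷ (not s , 2 * c) ∷ [])
  pair′ : ∀ s c → Minimal ((not s , 2 * c) ∷ (s , c) ∷ [])

Minimal-scale : ∀ {p xs g} → Split p xs [] g → Minimal g → Minimal xs
Minimal-scale {p} (divisible []) (single s c) = single s (p * c)
Minimal-scale {p} (divisible (divisible [])) (pair s c) rewrite *-swap p 2 c = pair s (p * c)
Minimal-scale {p} (divisible (divisible [])) (pair′ s c) rewrite *-swap p 2 c = pair′ s (p * c)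

Ones : Bool → List (Bool × ℕ) → Set
Ones s = All (_≡ (s , 1))

ones : ∀ {xs} → Good xs → 0 < length xs → (∀ {s c} → (s , c) ∈ xs → c ≡ 1) → ∃[ s ] Ones s xs
ones {(s , c) ∷ xs} good _ one = s , All.tabulate (λ {x} m → cong₂ _,_ (sign {x} m) (one m))
  where
  sign : ∀ {x} → x ∈ (s , c) ∷ xs → proj₁ x ≡ s
  sign {t , d} m with one m | one (here refl)
  ... | refl | refl = consistent good m (here refl)

ones-lin : ∀ {s xs} → Ones s xs → ∀ φ → lin ⟦ xs ⟧ φ ≡ ι (length xs) ⊛ (weight s ⊛ φ 1)
ones-lin {s} [] φ = sym (trans (cong (_⊛ (weight s ⊛ φ 1)) ι0) (ℚₚ.*-zeroˡ (weight s ⊛ φ 1)))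
ones-lin {s} {_ ∷ xs} (refl ∷ os) φ = trans (cong (weight s ⊛ φ 1 ⊕_) (ones-lin os φ))
  (trans (lem (weight s ⊛ φ 1) (ι (length xs))) (cong (_⊛ (weight s ⊛ φ 1)) (sym (ι-suc (length xs)))))
  where
  lem : ∀ a n → a ⊕ n ⊛ a ≡ (1ℚ ⊕ n) ⊛ a
  lem = solve-∀ ring

ones-B : ∀ {s t xs ys} → Ones s xs → Ones t ys → B ⟦ xs ⟧ ⟦ ys ⟧ ≡ (ι (length xs) ⊛ ι (length ys)) ⊛ (weight s ⊛ weight t)
ones-B {s} {t} {xs} {ys} os os′ = begin
  B ⟦ xs ⟧ ⟦ ys ⟧ ≡⟨ ones-lin os (λ c → lin ⟦ ys ⟧ (K c)) ⟩
  ι (length xs) ⊛ (weight s ⊛ lin ⟦ ys ⟧ (K 1)) ≡⟨ cong (λ a → ι (length xs) ⊛ (weight s ⊛ a)) (ones-lin os′ (K 1)) ⟩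
  ι (length xs) ⊛ (weight s ⊛ (ι (length ys) ⊛ (weight t ⊛ K 1 1)))
    ≡⟨ cong (λ k → ι (length xs) ⊛ (weight s ⊛ (ι (length ys) ⊛ (weight t ⊛ k)))) (K-self {1} (s≤s z≤n)) ⟩
  ι (length xs) ⊛ (weight s ⊛ (ι (length ys) ⊛ (weight t ⊛ 1ℚ))) ≡⟨ lem (ι (length xs)) (ι (length ys)) (weight s) (weight t) ⟩
  (ι (length xs) ⊛ ι (length ys)) ⊛ (weight s ⊛ weight t) ∎
  where
  open ≡-Reasoning
  lem : ∀ m n s t → m ⊛ (s ⊛ (n ⊛ (t ⊛ 1ℚ))) ≡ (m ⊛ n) ⊛ (s ⊛ t)
  lem = solve-∀ ring

weight-sq : ∀ s → weight s ⊛ weight s ≡ 1ℚ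
weight-sq true = refl
weight-sq false = refl

weight-not : ∀ s → weight s ⊛ weight (not s) ≡ ⊝ 1ℚ
weight-not true = refl
weight-not false = refl

ones-Q : ∀ {s xs} → Ones s xs → Q xs ≡ ι (length xs) ⊛ ι (length xs)
ones-Q {s} {xs} os = trans (ones-B os os) (trans (cong ((ι (length xs) ⊛ ι (length xs)) ⊛_) (weight-sq s)) (ℚₚ.*-identityʳ _))

¼ ¾ 5/4ℚ : ℚ
¼ = (ℤ.+ 1) / 4
¾ = (ℤ.+ 3) / 4
5/4ℚ = (ℤ.+ 5) / 4

1≼ι : ∀ {n} → 0 < n → 1ℚ ≼ ι n
1≼ι {n} 0<n = subst (_≼ ι n) ι1 (ι-mono-≤ 0<n)

5/4≼ι : ∀ {n} → 2 ≤ n → 5/4ℚ ≼ ι n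
5/4≼ι 2≤n = ℚₚ.≤-trans (subst (5/4ℚ ≼_) (sym (ι≡# 2)) (ℚₚ.≤ᵇ⇒≤ _)) (ι-mono-≤ 2≤n)

Classified : List (Bool × ℕ) → Set
Classified xs = (Minimal xs × Q xs ≡ 1ℚ) ⊎ (5/4ℚ ≼ Q xs)

Classified⇒1≼Q : ∀ {xs} → Classified xs → 1ℚ ≼ Q xs
Classified⇒1≼Q (inj₁ (_ , e)) = ℚₚ.≤-reflexive (sym e)
Classified⇒1≼Q (inj₂ le) = ℚₚ.≤-trans (ℚₚ.≤ᵇ⇒≤ _) le

Classified-scale : ∀ {p xs g} → Prime p → Split p xs [] g → Classified g → Classified xs
Classified-scale pp sp (inj₁ (min , e)) = inj₁ (Minimal-scale sp min , trans (split-Q-[] pp sp) e)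
Classified-scale pp sp (inj₂ le) = inj₂ (subst (5/4ℚ ≼_) (sym (split-Q-[] pp sp)) le)

-- The bound (1 - r)(Q h + 1) is 4/3 for r = 1/3 and Q h = 1, which explains the spare 1/12. For p =
-- 2 it is only 1, a value attained by ±(c; 2c), so the prime 2 needs an analysis of its own.
classify-odd-split : ∀ {p xs h g} → (pp : Prime p) → 3 ≤ p → Good xs → Split p xs h g → 0 < length g →
  1ℚ ≼ Q h → Layers.AtLeastOne pp (size g) → 5/4ℚ ≼ Q xs
classify-odd-split {p} {xs} {h} pp 3≤p good sp nonempty 1≼Qh one = ≤-by
  ((1ℚ ⊖ r) ⊛ (Q h ⊖ 1ℚ) ⊕ (# 2 ⊛ (⅓ ⊖ r) ⊕ (ℤ.+ 1) / 12) ⊕ (Q xs ⊖ (1ℚ ⊖ r) ⊛ (Q h ⊕ 1ℚ)))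
  (0≤+ (0≤+ (0≤* 0≤1-r (diff≥0 1≼Qh)) (0≤+ (0≤* (#≥0 2) (diff≥0 r≤⅓)) (ℚₚ.nonNegative⁻¹ ((ℤ.+ 1) / 12))))
    (diff≥0 (two-layers-bound good sp nonempty one)))
  (lem r (Q h) (Q xs))
  where
  open Layers pp
  ⅓ = (ℤ.+ 1) / 3
  lem : ∀ r h q → q ≡ 5/4ℚ ⊕ ((1ℚ ⊖ r) ⊛ (h ⊖ 1ℚ) ⊕ (# 2 ⊛ ((ℤ.+ 1) / 3 ⊖ r) ⊕ (ℤ.+ 1) / 12) ⊕ (q ⊖ (1ℚ ⊖ r) ⊛ (h ⊕ 1ℚ)))
  lem = solve-∀ ring
  r≤⅓ : r ≼ ⅓
  r≤⅓ = cancel-*-≤ p (<⇒≤ 1<p) (subst₂ _≼_ (sym (ι-inv (<⇒≤ 1<p))) (ℚₚ.*-comm ⅓ (ι p))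
    (≤-by (⅓ ⊛ (ι p ⊖ # 3)) (0≤* (ℚₚ.nonNegative⁻¹ ⅓) (diff≥0 (subst (_≼ ι p) (ι≡# 3) (ι-mono-≤ 3≤p)))) (lem₂ (ι p))))
    where
    lem₂ : ∀ p → (ℤ.+ 1) / 3 ⊛ p ≡ 1ℚ ⊕ (ℤ.+ 1) / 3 ⊛ (p ⊖ # 3)
    lem₂ = solve-∀ ring

inv2 : inv 2 ≡ ℚ.½
inv2 = cancel-*-≡ 2 (s≤s z≤n) (trans (ι-inv {2} (s≤s z≤n)) (sym (cong (_⊛ ℚ.½) (ι≡# 2))))

two-prime : Prime 2
two-prime = Primality.prime[2]

classify-three-layers : ∀ {xs h g h′ g′} → Good xs → Split 2 xs h g → Split 2 g h′ g′ → 0 < length g′ →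
  1ℚ ≼ Q h → Layers.AtLeastOne two-prime (size g) → 5/4ℚ ≼ Q xs
classify-three-layers {g = []} good sp [] () 1≼Qh one
classify-three-layers {xs} {h} {g@(_ ∷ _)} {h′} {g′} good sp sp′ nonempty 1≼Qh one = ≤-by
  -- At r = 1/2 the mixed term has coefficient 1. With D the discounted list of `g`, a quarter of
  -- the nonnegative norm of h + 2D accounts for it and for QD, so 3/4 Q h + 1/2 ≥ 5/4 remains. The
  -- 1/2 is the 1 - r gained because `g` has at least two layers.
  (¾ ⊛ (Q h ⊖ 1ℚ) ⊕ ¼ ⊛ (Q h ⊕ (# 2 ⊕ # 2) ⊛ mixed h ls ⊕ # 2 ⊛ # 2 ⊛ QD ls) ⊕ (Q g ⊖ (QD ls ⊕ (1ℚ ⊖ ℚ.½))))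
  (0≤+ (0≤+ (0≤* (ℚₚ.nonNegative⁻¹ (¾)) (diff≥0 1≼Qh)) (0≤* (ℚₚ.nonNegative⁻¹ ¼) (form-nonneg (# 2) (split-Goodˡ sp good) good-g ls)))
    (diff≥0 (subst (λ r → QD ls ⊕ (1ℚ ⊖ r) ≼ Q g) inv2 (upper-layers-bound good-g sp′ nonempty ls′ one))))
  (trans (layer-Q sp ls) (trans (cong (λ r → Q h ⊕ (r ⊕ r) ⊛ mixed h ls ⊕ Q g) inv2) (lem (Q h) (mixed h ls) (Q g) (QD ls))))
  where
  open Layers two-prime
  good-g = split-Goodʳ sp good
  ls′ = layered 1<p (split-Goodʳ sp′ good-g)
  ls = layer sp′ ls′
  lem : ∀ h b g d → h ⊕ (ℚ.½ ⊕ ℚ.½) ⊛ b ⊕ g ≡ 5/4ℚ ⊕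
    (¾ ⊛ (h ⊖ 1ℚ) ⊕ ¼ ⊛ (h ⊕ (# 2 ⊕ # 2) ⊛ b ⊕ # 2 ⊛ # 2 ⊛ d) ⊕ (g ⊖ (d ⊕ (1ℚ ⊖ ℚ.½))))
  lem = solve-∀ ring

Ones⇒Q≥1 : ∀ {s xs} → Ones s xs → 0 < length xs → 1ℚ ≼ Q xs
Ones⇒Q≥1 {s} {xs} os nonempty = subst (1ℚ ≼_) (trans (ι-* (length xs) (length xs)) (sym (ones-Q os))) (1≼ι (*-mono-≤ nonempty nonempty))

classify-ones : ∀ {s xs} → Ones s xs → 0 < length xs → Classified xs
classify-ones {s} {(_ , _) ∷ []} os@(refl ∷ []) _ = inj₁ (single s 1 , trans (ones-Q os) (cong (λ a → a ⊛ a) ι1))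
classify-ones {s} {xs@(_ ∷ _ ∷ xs′)} os _ = inj₂ (subst (5/4ℚ ≼_) (trans (ι-* (length xs) (length xs)) (sym (ones-Q os)))
  (5/4≼ι (*-mono-≤ {1} {length xs} {2} {length xs} (s≤s z≤n) (s≤s (s≤s (z≤n {length xs′}))))))

-- Here the list consists of m entries 1 and n entries 2, and its norm is m² ± m n + n². Only m = n
-- = 1 with opposite signs stays below 5/4: otherwise the norm is at least 3, or it is (m - n)² + m
-- n with m n ≥ 2.
classify-two-layers : ∀ {xs h g s t} → Good xs → Split 2 xs h g → Ones s h → Ones t g → 0 < length h → 0 < length g → Classified xs
classify-two-layers {xs} {h} {g} {s} {t} good sp os os′ 0<h 0<g with s Boolₚ.≟ t
... | yes refl = inj₂ (≤-by (m ⊛ m ⊖ 1ℚ ⊕ (n ⊛ n ⊖ 1ℚ) ⊕ m ⊛ n ⊕ ¾)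
      (0≤+ (0≤+ (0≤+ (sq≥1 0<h) (sq≥1 0<g)) (0≤* (ι-nonneg (length h)) (ι-nonneg (length g)))) (ℚₚ.nonNegative⁻¹ (¾)))
      (trans (Qxs (weight-sq s)) (lem m n)))
  where
  m = ι (length h)
  n = ι (length g)
  sq≥1 : ∀ {k} → 0 < k → 0ℚ ≼ ι k ⊛ ι k ⊖ 1ℚ
  sq≥1 {k} 0<k = diff≥0 (subst (1ℚ ≼_) (ι-* k k) (1≼ι (*-mono-≤ 0<k 0<k)))
  lem : ∀ m n → m ⊛ m ⊕ (ℚ.½ ⊕ ℚ.½) ⊛ ((m ⊛ n) ⊛ 1ℚ) ⊕ n ⊛ n ≡ 5/4ℚ ⊕ (m ⊛ m ⊖ 1ℚ ⊕ (n ⊛ n ⊖ 1ℚ) ⊕ m ⊛ n ⊕ ¾)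
  lem = solve-∀ ring
  Qxs : ∀ {w} → weight s ⊛ weight t ≡ w → Q xs ≡ m ⊛ m ⊕ (ℚ.½ ⊕ ℚ.½) ⊛ ((m ⊛ n) ⊛ w) ⊕ n ⊛ n
  Qxs refl = trans (Layers.split-Q two-prime sp) (cong₂ _⊕_ (cong₂ _⊕_ (ones-Q os) (cong₂ (λ r b → (r ⊕ r) ⊛ b) inv2 (ones-B os os′))) (ones-Q os′))
... | no s≢t with Boolₚ.¬-not (λ e → s≢t (sym e))
... | refl = opposite sp os os′ 0<h 0<g
  where
  Qxs : ∀ {xs h g} → Split 2 xs h g → Ones s h → Ones (not s) g →
    Q xs ≡ (ι (length h) ⊖ ι (length g)) ⊛ (ι (length h) ⊖ ι (length g)) ⊕ ι (length h * length g)
  Qxs {xs} {h} {g} sp os os′ = trans (trans (Layers.split-Q two-prime sp) (cong₂ _⊕_ (cong₂ _⊕_ (ones-Q os) (cong₂ (λ r b → (r ⊕ r) ⊛ b) inv2 (trans (ones-B os os′) (cong ((ι (length h) ⊛ ι (length g)) ⊛_) (weight-not s))))) (ones-Q os′)))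
    (trans (lem (ι (length h)) (ι (length g))) (cong ((ι (length h) ⊖ ι (length g)) ⊛ (ι (length h) ⊖ ι (length g)) ⊕_) (sym (ι-* (length h) (length g)))))
    where
    lem : ∀ m n → m ⊛ m ⊕ (ℚ.½ ⊕ ℚ.½) ⊛ ((m ⊛ n) ⊛ (⊝ 1ℚ)) ⊕ n ⊛ n ≡ (m ⊖ n) ⊛ (m ⊖ n) ⊕ m ⊛ n
    lem = solve-∀ ring
  large : ∀ {xs h g} → Split 2 xs h g → Ones s h → Ones (not s) g → 2 ≤ length h * length g → Classified xs
  large {xs} {h} {g} sp os os′ 2≤ = inj₂ (≤-by ((ι (length h) ⊖ ι (length g)) ⊛ (ι (length h) ⊖ ι (length g)) ⊕ (ι (length h * length g) ⊖ 5/4ℚ))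
    (0≤+ (0≤sq (ι (length h) ⊖ ι (length g))) (diff≥0 (5/4≼ι 2≤))) (trans (Qxs sp os os′) (lem ((ι (length h) ⊖ ι (length g)) ⊛ (ι (length h) ⊖ ι (length g))) (ι (length h * length g)))))
    where
    lem : ∀ a b → a ⊕ b ≡ 5/4ℚ ⊕ (a ⊕ (b ⊖ 5/4ℚ))
    lem = solve-∀ ring
  value : ∀ {xs} → Split 2 xs ((s , 1) ∷ []) ((not s , 1) ∷ []) → Q xs ≡ 1ℚ
  value sp = trans (Qxs sp (refl ∷ []) (refl ∷ [])) (cong (λ a → (a ⊖ a) ⊛ (a ⊖ a) ⊕ a) ι1)
  opposite : ∀ {xs h g} → Split 2 xs h g → Ones s h → Ones (not s) g → 0 < length h → 0 < length g → Classified xs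
  opposite sp@(free _ (divisible [])) (refl ∷ []) (refl ∷ []) _ _ = inj₁ (pair s 1 , value sp)
  opposite sp@(divisible (free _ [])) (refl ∷ []) (refl ∷ []) _ _ = inj₁ (pair′ s 1 , value sp)
  opposite {h = _ ∷ _ ∷ h} {_ ∷ g} sp os os′ _ _ = large sp os os′ (*-mono-≤ {2} {2 + length h} {1} {suc (length g)} (s≤s (s≤s z≤n)) (s≤s z≤n))
  opposite {h = _ ∷ h} {_ ∷ _ ∷ g} sp os os′ _ _ = large sp os os′ (*-mono-≤ {1} {suc (length h)} {2} {2 + length g} (s≤s z≤n) (s≤s (s≤s z≤n)))

odd-part-one : ∀ {c} → 0 < c → (∀ {q} → Prime q → q ∣ c → q < 3) → ¬ 2 ∣ c → c ≡ 1
odd-part-one 0<c below 2∤c = no-prime-factor⇒≡1 0<c λ q pp q∣c → two q pp (below pp q∣c) q∣c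
  where
  two : ∀ q → Prime q → q < 3 → ¬ q ∣ _
  two 0 pp _ = contradiction (Primality.prime⇒nonTrivial pp) (λ ())
  two 1 pp _ = contradiction (Primality.prime⇒nonTrivial pp) (λ ())
  two 2 pp _ = 2∤c
  two (suc (suc (suc _))) _ (s≤s (s≤s (s≤s ())))

split-ones : ∀ {xs h g} → Good xs → PrimesBelow 3 xs → Split 2 xs h g → 0 < length h → ∃[ s ] Ones s h
split-ones {xs} {h} good below sp nonempty = ones (split-Goodˡ sp good) nonempty
  (λ m → odd-part-one (positive good (split-∈ˡ sp m)) (below (split-∈ˡ sp m)) (All.lookup (split-free sp) (∈-map⁺ _ m)))
  where open import Data.List.Membership.Propositional.Properties using (∈-map⁺)

PrimesBelow-split : ∀ {b p xs h g} → PrimesBelow b xs → Split p xs h g → PrimesBelow b g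
PrimesBelow-split {p = p} below sp m pp q∣c = below (split-∈ʳ sp m) pp (Div.∣-trans q∣c (Div.n∣m*n p))

classify : ∀ {xs} → Good xs → 0 < length xs → Classified xs
classify {xs} good nonempty = go xs good nonempty (<-wellFounded (size xs))
  where
  go : ∀ xs → Good xs → 0 < length xs → Acc _<_ (size xs) → Classified xs
  go xs good nonempty (acc rec) with large-prime? 3 xs good
  ... | inj₁ (p , pp , 3≤p , s , c , m , p∣c) with split p xs
  ... | [] , g , sp = Classified-scale pp sp (go g (split-Goodʳ sp good) (split-nonempty sp m p∣c) (rec (split-size-<ʳ (Layers.1<p pp) good nonempty sp)))
  ... | h@(_ ∷ _) , g , sp = inj₂ (classify-odd-split pp 3≤p good sp nonempty-g
      (Classified⇒1≼Q (go h (split-Goodˡ sp good) (s≤s z≤n) (rec (split-size-<ˡ (Layers.1<p pp) good nonempty-g sp))))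
      (λ {ys} good-ys ne le → Classified⇒1≼Q (go ys good-ys ne (rec (≤-<-trans le (split-size-<ʳ (Layers.1<p pp) good nonempty sp))))))
    where nonempty-g = split-nonempty sp m p∣c
  -- All entries are powers of two from here on, so every layer at 2 consists of ones.
  go xs good nonempty (acc rec) | inj₂ below with split 2 xs
  ... | h , [] , sp = let
        xs≡h = split-[]ʳ sp
        nonempty-h = subst (λ l → 0 < length l) xs≡h nonempty
        (s , os) = split-ones good below sp nonempty-h
      in subst Classified (sym xs≡h) (classify-ones os nonempty-h)
  ... | [] , g@(_ ∷ _) , sp = Classified-scale two-prime sp (go g (split-Goodʳ sp good) (s≤s z≤n) (rec (split-size-<ʳ (Layers.1<p two-prime) good nonempty sp)))
  ... | h@(_ ∷ _) , g@(_ ∷ _) , sp with split-ones good below sp (s≤s z≤n) | split 2 g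
  ... | s , os | h′ , g′@(_ ∷ _) , sp′ = inj₂ (classify-three-layers good sp sp′ (s≤s z≤n) (Ones⇒Q≥1 os (s≤s z≤n))
      (λ {ys} good-ys ne le → Classified⇒1≼Q (go ys good-ys ne (rec (≤-<-trans le (split-size-<ʳ (Layers.1<p two-prime) good nonempty sp))))))
  ... | s , os | h′ , [] , sp′ with split-[]ʳ sp′
  ... | refl = let (t , os′) = split-ones (split-Goodʳ sp good) (PrimesBelow-split below sp) sp′ (s≤s z≤n) in
      classify-two-layers good sp os os′ (s≤s z≤n) (s≤s z≤n)

-- Long lists have large norm

Smooth : List ℕ → List (Bool × ℕ) → Set
Smooth ps xs = ∀ {s c q} → (s , c) ∈ xs → Prime q → q ∣ c → q ∈ ps

∏+1 ∏-1 : List ℕ → ℚ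
∏+1 [] = 1ℚ
∏+1 (p ∷ ps) = (ι p ⊕ 1ℚ) ⊛ ∏+1 ps
∏-1 [] = 1ℚ
∏-1 (p ∷ ps) = (ι p ⊖ 1ℚ) ⊛ ∏-1 ps

0≼∏+1 : ∀ ps → 0ℚ ≼ ∏+1 ps
0≼∏+1 [] = ℚₚ.nonNegative⁻¹ 1ℚ
0≼∏+1 (p ∷ ps) = 0≤* (0≤+ (ι-nonneg p) (#≥0 1)) (0≼∏+1 ps)

ι-length-split : ∀ {p xs h g} → Split p xs h g → ι (length xs) ≡ ι (length h) ⊕ ι (length g)
ι-length-split {h = h} {g} sp = trans (cong ι (split-length sp)) (ι-+ (length h) (length g))

-- `layer-sum-bound` trades the prime p for the factor (p - 1)/(p + 1) and leaves layers free of p.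
-- After the last prime every entry is 1, all signs agree, and n entries have norm n² ≥ n.
smooth-bound : ∀ ps → All Prime ps → ∀ {xs} → Good xs → Smooth ps xs → ∏-1 ps ⊛ ι (length xs) ≼ ∏+1 ps ⊛ Q xs
smooth-bound [] _ {[]} good smooth = ℚₚ.≤-reflexive (cong (1ℚ ⊛_) ι0)
smooth-bound [] _ {xs@(_ ∷ xs′)} good smooth with ones good (s≤s z≤n) (λ m → no-prime-factor⇒≡1 (positive good m) (λ q pp q∣c → contradiction (smooth m pp q∣c) (λ ())))
... | s , os = *-mono-≤ˡ 1ℚ (#≥0 1)
  (subst (ι (length xs) ≼_) (trans (ι-* (length xs) (length xs)) (sym (ones-Q os))) (ι-mono-≤ (m≤m*n (length xs) (length xs))))
smooth-bound (p ∷ ps) (pp ∷ pps) {xs} good smooth = ≤-by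
  (∏+1 ps ⊛ ((ι p ⊕ 1ℚ) ⊛ Q xs ⊖ (ι p ⊖ 1ℚ) ⊛ ∑Q ls) ⊕ (ι p ⊖ 1ℚ) ⊛ (∏+1 ps ⊛ ∑Q ls ⊖ ∏-1 ps ⊛ ι (length xs)))
  (0≤+ (0≤* (0≼∏+1 ps) (diff≥0 (layer-sum-bound good ls))) (0≤* (diff≥0 (1≼ι (<⇒≤ 1<p))) (diff≥0 (layers good smooth ls))))
  (lem (∏-1 ps) (∏+1 ps) (ι p) (ι (length xs)) (Q xs) (∑Q ls))
  where
  open Layers pp
  ls = layered 1<p good
  lem : ∀ a b p n q l → ((p ⊕ 1ℚ) ⊛ b) ⊛ q ≡ ((p ⊖ 1ℚ) ⊛ a) ⊛ n ⊕ (b ⊛ ((p ⊕ 1ℚ) ⊛ q ⊖ (p ⊖ 1ℚ) ⊛ l) ⊕ (p ⊖ 1ℚ) ⊛ (b ⊛ l ⊖ a ⊛ n))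
  lem = solve-∀ ring
  layers : ∀ {xs} → Good xs → Smooth (p ∷ ps) xs → (ls : Layered p xs) → ∏-1 ps ⊛ ι (length xs) ≼ ∏+1 ps ⊛ ∑Q ls
  layers good smooth [] = ℚₚ.≤-reflexive (trans (cong (∏-1 ps ⊛_) ι0) (trans (ℚₚ.*-zeroʳ (∏-1 ps)) (sym (ℚₚ.*-zeroʳ (∏+1 ps)))))
  layers {xs@(_ ∷ _)} good smooth (layer {h = h} {g} sp ls) = subst₂ _≼_
    (trans (sym (ℚₚ.*-distribˡ-+ (∏-1 ps) (ι (length h)) (ι (length g)))) (cong (∏-1 ps ⊛_) (sym (ι-length-split sp))))
    (sym (ℚₚ.*-distribˡ-+ (∏+1 ps) (Q h) (∑Q ls)))
    (ℚₚ.+-mono-≤ (smooth-bound ps pps (split-Goodˡ sp good) smooth-h)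
      (layers (split-Goodʳ sp good) (λ m pq q∣c → smooth (split-∈ʳ sp m) pq (Div.∣-trans q∣c (Div.n∣m*n p))) ls))
    where
    smooth-h : Smooth ps h
    smooth-h m pq q∣c with smooth (split-∈ˡ sp m) pq q∣c
    ... | here refl = contradiction q∣c (All.lookup (split-free sp) (∈-map⁺ _ m))
    ... | there q∈ps = q∈ps

primes-below-11 : ∀ q → q < 11 → Prime q → q ∈ 7 ∷ 5 ∷ 3 ∷ 2 ∷ []
primes-below-11 0 _ pp = contradiction pp Primality.¬prime[0]
primes-below-11 1 _ pp = contradiction pp Primality.¬prime[1]
primes-below-11 2 _ pp = there (there (there (here refl)))
primes-below-11 3 _ pp = there (there (here refl))
primes-below-11 4 _ pp = contradiction pp (from-no (Primality.prime? 4))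
primes-below-11 5 _ pp = there (here refl)
primes-below-11 6 _ pp = contradiction pp (from-no (Primality.prime? 6))
primes-below-11 7 _ pp = here refl
primes-below-11 8 _ pp = contradiction pp (from-no (Primality.prime? 8))
primes-below-11 9 _ pp = contradiction pp (from-no (Primality.prime? 9))
primes-below-11 10 _ pp = contradiction pp (from-no (Primality.prime? 10))
primes-below-11 (suc (suc (suc (suc (suc (suc (suc (suc (suc (suc (suc _))))))))))) (s≤s (s≤s (s≤s (s≤s (s≤s (s≤s (s≤s (s≤s (s≤s (s≤s (s≤s ())))))))))))

smooth-7-bound : ∀ {xs} → Good xs → PrimesBelow 11 xs → ι (length xs) ≼ # 12 ⊛ Q xs
-- The two products are 6 * 4 * 2 * 1 = 48 and 8 * 6 * 4 * 3 = 576 = 48 * 12.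
smooth-7-bound {xs} good below = cancel-*-≤ 48 (s≤s z≤n) (subst₂ _≼_
  (cong (_⊛ ι (length xs)) down) (trans (cong (_⊛ Q xs) up) (ℚₚ.*-assoc (ι 48) (# 12) (Q xs)))
  (smooth-bound (7 ∷ 5 ∷ 3 ∷ 2 ∷ []) (from-yes (Primality.prime? 7) ∷ from-yes (Primality.prime? 5) ∷ from-yes (Primality.prime? 3) ∷ two-prime ∷ [])
    good (λ m pq q∣c → primes-below-11 _ (below m pq q∣c) pq)))
  where
  down : ∏-1 (7 ∷ 5 ∷ 3 ∷ 2 ∷ []) ≡ ι 48
  down rewrite ι≡# 7 | ι≡# 5 | ι≡# 3 | ι≡# 2 | ι≡# 48 = refl
  up : ∏+1 (7 ∷ 5 ∷ 3 ∷ 2 ∷ []) ≡ ι 48 ⊛ # 12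
  up rewrite ι≡# 7 | ι≡# 5 | ι≡# 3 | ι≡# 2 | ι≡# 48 = refl

-- The quantifier over m encodes the minimum of n and 96. If all primes are below 11, the inequality
-- follows from q ≥ 1 for m ≤ 12 and from 12 q ≥ m for m ≥ 12; the constants 24 and 36 are chosen so
-- that both estimates are sharp at m = 12.
LengthBound : ℕ → ℚ → Set
LengthBound n q = ∀ m → m ≤ n → m ≤ 96 → # 24 ⊕ ι m ≼ # 36 ⊛ q

LengthBound-+ : ∀ {k n} a b → LengthBound k a → LengthBound n b → ∀ m → m ≤ k + n → m ≤ 96 → # 48 ⊕ ι m ≼ # 36 ⊛ (a ⊕ b)
LengthBound-+ {k} {n} a b bound-a bound-b m m≤ m≤96 = subst₂ _≼_
  (trans (lem₁ (ι i) (ι j)) (cong (# 48 ⊕_) (trans (sym (ι-+ i j)) (cong ι i+j≡m))))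
  (sym (ℚₚ.*-distribˡ-+ (# 36) a b))
  (ℚₚ.+-mono-≤ (bound-a i (m⊓n≤n m k) (≤-trans (m⊓n≤m m k) m≤96)) (bound-b j j≤n (≤-trans (m∸n≤m m i) m≤96)))
  where
  i = m ℕ.⊓ k
  j = m ∸ i
  i+j≡m : i + j ≡ m
  i+j≡m = m+[n∸m]≡n (m⊓n≤m m k)
  j≤n : j ≤ n
  j≤n with ≤-total m k
  ... | inj₁ m≤k rewrite m≤n⇒m⊓n≡m m≤k | n∸n≡0 m = z≤n
  ... | inj₂ k≤m rewrite m≥n⇒m⊓n≡n k≤m = subst (m ∸ k ≤_) (m+n∸m≡n k n) (∸-monoˡ-≤ k m≤)
  lem₁ : ∀ i j → # 24 ⊕ i ⊕ (# 24 ⊕ j) ≡ # 48 ⊕ (i ⊕ j)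
  lem₁ = solve-∀ ring

module _ {p : ℕ} (pp : Prime p) where

  open Layers pp

  layers-length-bound : ∀ {xs} → Good xs → 0 < length xs → (ls : Layered p xs) →
    (∀ {ys} → Good ys → 0 < length ys → size ys ≤ size xs → LengthBound (length ys) (Q ys)) → LengthBound (length xs) (∑Q ls)
  layers-length-bound {xs@(_ ∷ _)} good nonempty (layer {h = h} {g} sp ls) bound = cases h g sp ls
    where
    good-g = split-Goodʳ sp good
    cases : ∀ h g (sp : Split p xs h g) (ls : Layered p g) → LengthBound (length xs) (Q h ⊕ ∑Q ls)
    cases h [] sp [] m m≤ m≤96 = subst (λ q → # 24 ⊕ ι m ≼ # 36 ⊛ q) (trans (cong Q (split-[]ʳ sp)) (sym (ℚₚ.+-identityʳ (Q h)))) (bound good nonempty ≤-refl m m≤ m≤96)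
    cases [] g@(_ ∷ _) sp ls m m≤ m≤96 = subst (λ q → # 24 ⊕ ι m ≼ # 36 ⊛ q) (sym (ℚₚ.+-identityˡ (∑Q ls)))
      (layers-length-bound (split-Goodʳ sp good) (s≤s z≤n) ls
        (λ good-ys ne le → bound good-ys ne (≤-trans le (<⇒≤ (split-size-<ʳ 1<p good nonempty sp)))) m (subst (m ≤_) (split-length sp) m≤) m≤96)
    cases h@(_ ∷ _) g@(_ ∷ _) sp ls m m≤ m≤96 = ≤-by (# 24 ⊕ (# 36 ⊛ (Q h ⊕ ∑Q ls) ⊖ (# 48 ⊕ ι m)))
      (0≤+ (#≥0 24) (diff≥0 (LengthBound-+ (Q h) (∑Q ls)
        (bound (split-Goodˡ sp good) (s≤s z≤n) (split-size-≤ sp))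
        (layers-length-bound (split-Goodʳ sp good) (s≤s z≤n) ls
          (λ good-ys ne le → bound good-ys ne (≤-trans le (<⇒≤ (split-size-<ʳ 1<p good nonempty sp)))))
        m (subst (m ≤_) (split-length sp) m≤) m≤96)))
      (lem (# 36 ⊛ (Q h ⊕ ∑Q ls)) (ι m))
      where
      lem : ∀ q m → q ≡ # 24 ⊕ m ⊕ (# 24 ⊕ (q ⊖ (# 48 ⊕ m)))
      lem = solve-∀ ring

  -- Passing to layers costs the factor (p - 1)/(p + 1), but two nonempty parts bring in the
  -- constant 24 twice. This suffices if (p - 1)(48 + m) ≥ (p + 1)(24 + m), that is, if 24 (p - 11)
  -- + 2 (96 - m) ≥ 0: hence the primes from 11 on, and the cap 96.
  large-prime-length-bound : ∀ {xs h g} → 11 ≤ p → Good xs → Split p xs h g → 0 < length h → 0 < length g →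
    (∀ {ys} → Good ys → 0 < length ys → size ys < size xs → LengthBound (length ys) (Q ys)) → LengthBound (length xs) (Q xs)
  large-prime-length-bound {[]} 11≤p good [] () _ bound
  large-prime-length-bound {xs@(_ ∷ _)} {h} {g} 11≤p good sp 0<h 0<g bound m m≤ m≤96 = cancel-*-≤ (suc p) (s≤s z≤n) (subst (λ u → u ⊛ (# 24 ⊕ ι m) ≼ u ⊛ (# 36 ⊛ Q xs)) (sym (ι-suc p))
    (≤-by (# 36 ⊛ ((ι p ⊕ 1ℚ) ⊛ Q xs ⊖ (ι p ⊖ 1ℚ) ⊛ ∑Q ls) ⊕ (ι p ⊖ 1ℚ) ⊛ (# 36 ⊛ ∑Q ls ⊖ (# 48 ⊕ ι m)) ⊕ (# 24 ⊛ (ι p ⊖ # 11) ⊕ # 2 ⊛ (# 96 ⊖ ι m)))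
      (0≤+ (0≤+ (0≤* (#≥0 36) (diff≥0 (layer-sum-bound good ls)))
          (0≤* (diff≥0 (1≼ι (<⇒≤ 1<p))) (diff≥0 two-parts)))
        (0≤+ (0≤* (#≥0 24) (diff≥0 (subst (_≼ ι p) (ι≡# 11) (ι-mono-≤ 11≤p)))) (0≤* (#≥0 2) (diff≥0 (subst (ι m ≼_) (ι≡# 96) (ι-mono-≤ m≤96))))))
      (lem (ι p) (ι m) (Q xs) (∑Q ls))))
    where
    ls′ = layered 1<p (split-Goodʳ sp good)
    ls = layer sp ls′
    two-parts : # 48 ⊕ ι m ≼ # 36 ⊛ ∑Q ls
    two-parts = LengthBound-+ (Q h) (∑Q ls′) (bound (split-Goodˡ sp good) 0<h (split-size-<ˡ 1<p good 0<g sp))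
      (layers-length-bound (split-Goodʳ sp good) 0<g ls′
        (λ good-ys ne le → bound good-ys ne (≤-<-trans le (split-size-<ʳ 1<p good (s≤s z≤n) sp))))
      m (subst (m ≤_) (split-length sp) m≤) m≤96
    lem : ∀ p m q l → (1ℚ ⊕ p) ⊛ (# 36 ⊛ q) ≡ (1ℚ ⊕ p) ⊛ (# 24 ⊕ m) ⊕
      (# 36 ⊛ ((p ⊕ 1ℚ) ⊛ q ⊖ (p ⊖ 1ℚ) ⊛ l) ⊕ (p ⊖ 1ℚ) ⊛ (# 36 ⊛ l ⊖ (# 48 ⊕ m)) ⊕ (# 24 ⊛ (p ⊖ # 11) ⊕ # 2 ⊛ (# 96 ⊖ m)))
    lem = solve-∀ ring

length-bound : ∀ {xs} → Good xs → 0 < length xs → LengthBound (length xs) (Q xs)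
length-bound {xs} good nonempty = go xs good nonempty (<-wellFounded (size xs))
  where
  go : ∀ xs → Good xs → 0 < length xs → Acc _<_ (size xs) → LengthBound (length xs) (Q xs)
  go xs good nonempty (acc rec) with large-prime? 11 xs good
  ... | inj₁ (p , pp , 11≤p , s , c , m , p∣c) with split p xs
  ... | [] , g , sp = subst₂ LengthBound (sym (split-length sp)) (sym (split-Q-[] pp sp))
      (go g (split-Goodʳ sp good) (split-nonempty sp m p∣c) (rec (split-size-<ʳ (Layers.1<p pp) good nonempty sp)))
  ... | h@(_ ∷ _) , g , sp = large-prime-length-bound pp 11≤p good sp (s≤s z≤n) (split-nonempty sp m p∣c)
      (λ {ys} good-ys ne lt → go ys good-ys ne (rec lt))
  go xs good nonempty (acc rec) | inj₂ below = λ m m≤ m≤96 → small m m≤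
    where
    lem₁ : ∀ q m → # 36 ⊛ q ≡ # 24 ⊕ m ⊕ (# 36 ⊛ (q ⊖ 1ℚ) ⊕ (# 12 ⊖ m))
    lem₁ = solve-∀ ring
    lem₂ : ∀ q m → # 36 ⊛ q ≡ # 24 ⊕ m ⊕ (# 3 ⊛ (# 12 ⊛ q ⊖ m) ⊕ # 2 ⊛ (m ⊖ # 12))
    lem₂ = solve-∀ ring
    small : ∀ m → m ≤ length xs → # 24 ⊕ ι m ≼ # 36 ⊛ Q xs
    small m m≤ with ≤-total m 12
    ... | inj₁ m≤12 = ≤-by (# 36 ⊛ (Q xs ⊖ 1ℚ) ⊕ (# 12 ⊖ ι m))
      (0≤+ (0≤* (#≥0 36) (diff≥0 (Classified⇒1≼Q (classify good nonempty)))) (diff≥0 (subst (ι m ≼_) (ι≡# 12) (ι-mono-≤ m≤12))))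
      (lem₁ (Q xs) (ι m))
    ... | inj₂ 12≤m = ≤-by (# 3 ⊛ (# 12 ⊛ Q xs ⊖ ι m) ⊕ # 2 ⊛ (ι m ⊖ # 12))
      (0≤+ (0≤* (#≥0 3) (diff≥0 (ℚₚ.≤-trans (ι-mono-≤ m≤) (smooth-7-bound good below))))
        (0≤* (#≥0 2) (diff≥0 (subst (_≼ ι m) (ι≡# 12) (ι-mono-≤ 12≤m)))))
      (lem₂ (Q xs) (ι m))

length≤84 : ∀ {xs} → Good xs → Q xs ≡ # 3 → length xs ≤ 84
length≤84 {xs} good Q≡3 with length xs ≤? 84
... | yes le = le
... | no ¬le = contradiction
  -- 24 + 85 = 109 exceeds 36 * 3 = 108, and 85 lies below the cap 96.
  (subst₂ _≼_ (cong (# 24 ⊕_) (ι≡# 85)) (cong (# 36 ⊛_) Q≡3) (length-bound good (≤-trans (s≤s z≤n) 85≤) 85 85≤ (from-yes (85 ≤? 96))))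
  (from-no ((# 24 ⊕ # 85) ℚₚ.≤? (# 36 ⊛ # 3)))
  where 85≤ = ≰⇒> ¬le

-- Landau's criterion

div-lower : ∀ x {N} → 0 < N → (x div N) * N ≤ x
div-lower x {N} 0<N = ≤-trans (≤-trans (≤-reflexive (*-comm (x div N) N)) (m≤n+m (N * (x div N)) (x mod N)))
  (≤-reflexive (sym (mod-div x 0<N)))

div-upper : ∀ x {N} → 0 < N → x < suc (x div N) * N
div-upper x {N} 0<N = ≤-<-trans (≤-reflexive (mod-div x 0<N))
  (<-≤-trans (+-monoˡ-< (N * (x div N)) (mod<n x 0<N)) (≤-reflexive (cong (N +_) (*-comm N (x div N)))))

div-unique : ∀ {x f N} → 0 < N → f * N ≤ x → x < suc f * N → x div N ≡ f
div-unique {x} {f} {N} 0<N lower upper = ≤-antisym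
  (ℕ.s≤s⁻¹ (*-cancelʳ-< N (x div N) (suc f) (≤-<-trans (div-lower x 0<N) upper)))
  (ℕ.s≤s⁻¹ (*-cancelʳ-< N f (suc (x div N)) (≤-<-trans lower (div-upper x 0<N))))

ExactPower : ℕ → ℕ → ℕ → Set
ExactPower p e x = ∃[ w ] x ≡ p ℕ.^ e * w × ¬ p ∣ w

module _ {p : ℕ} (pp : Prime p) where

  private
    1<p : 1 < p
    1<p = ℕ.nonTrivial⇒n>1 p {{Primality.prime⇒nonTrivial pp}}

  exact-* : ∀ {e f x y} → ExactPower p e x → ExactPower p f y → ExactPower p (e + f) (x * y)
  exact-* {e} {f} (w , refl , p∤w) (v , refl , p∤v) = w * v ,
    trans (lem (p ℕ.^ e) w (p ℕ.^ f) v) (cong (_* (w * v)) (sym (^-distribˡ-+-* p e f))) ,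
    λ p∣wv → [ p∤w , p∤v ]′ (Primality.euclidsLemma w v pp p∣wv)
    where
    lem : ∀ a w b v → a * w * (b * v) ≡ a * b * (w * v)
    lem = solve-ℕ

  exact-free : ∀ {x} → ¬ p ∣ x → ExactPower p 0 x
  exact-free {x} p∤x = x , sym (+-identityʳ x) , p∤x

  exact-≤ : ∀ {e f x y} → ExactPower p e x → ExactPower p f y → x ∣ y → e ≤ f
  exact-≤ {e} {f} (w , refl , _) (v , refl , p∤v) x∣y with e ≤? f
  ... | yes e≤f = e≤f
  ... | no e≰f = contradiction (Div.∣-trans (Div.m∣m*n (p ℕ.^ (e ∸ suc f)))
      (Div.*-cancelˡ-∣ (p ℕ.^ f) {{m^n≢0 p f {{ℕ.>-nonZero (<⇒≤ 1<p)}}}}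
        (subst (_∣ p ℕ.^ f * v) power (Div.∣-trans (Div.m∣m*n w) x∣y)))) p∤v
    where
    power : p ℕ.^ e ≡ p ℕ.^ f * (p * p ℕ.^ (e ∸ suc f))
    power = trans (cong (p ℕ.^_) (sym (trans (+-suc f (e ∸ suc f)) (m+[n∸m]≡n (≰⇒> e≰f))))) (^-distribˡ-+-* p f (suc (e ∸ suc f)))

  ∤-small : ∀ {r} k → 0 < r → r < p → ¬ p ∣ k * p + r
  ∤-small {suc r} k _ r<p p∣ = Div.>⇒∤ r<p (Div.∣m+n∣m⇒∣n p∣ (Div.n∣m*n k))

  -- Legendre's formula below p²: each of the k multiples of p up to k p + r contributes exactly one
  -- factor p. The recursion descends through the factors and passes from remainder 0 to remainder p
  -- - 1 of the block before.
  exact-! : ∀ k r → k < p → r < p → ExactPower p k ((k * p + r) ℕ.!)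
  exact-! zero zero _ _ = exact-free (λ p∣1 → contradiction (Div.∣1⇒≡1 p∣1) (>⇒≢ 1<p))
  exact-! (suc k) zero k<p _ = subst₂ (ExactPower p) (+-comm k 1 ) (cong ℕ._! eq)
    (subst (λ e → ExactPower p e (suc (k * p + (p ∸ 1)) * (k * p + (p ∸ 1)) ℕ.!)) (+-comm 1 k)
      (exact-* {1} {k} (subst (ExactPower p 1) (sym eq′) p-part) (exact-! k (p ∸ 1) (<⇒≤ k<p) (∸-monoʳ-< {p} {1} {0} (s≤s z≤n) (<⇒≤ 1<p)))))
    where
    p-part : ExactPower p 1 (p * suc k)
    p-part = suc k , cong (_* suc k) (sym (*-identityʳ p)) , Div.>⇒∤ k<p
    suc-pred : suc (p ∸ 1) ≡ p
    suc-pred = m+[n∸m]≡n (<⇒≤ 1<p)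
    eq′ : suc (k * p + (p ∸ 1)) ≡ p * suc k
    eq′ = trans (sym (+-suc (k * p) (p ∸ 1))) (trans (cong (k * p +_) suc-pred) (trans (+-comm (k * p) p) (*-comm (suc k) p)))
    eq : suc (k * p + (p ∸ 1)) ≡ suc k * p + 0
    eq = trans eq′ (trans (*-comm p (suc k)) (sym (+-identityʳ (suc k * p))))
  exact-! k (suc r) k<p r<p = subst (ExactPower p k) (cong ℕ._! (sym (+-suc (k * p) r)))
    (exact-* {0} {k} (exact-free (subst (λ m → ¬ p ∣ m) (+-suc (k * p) r) (∤-small k (s≤s z≤n) r<p))) (exact-! k r k<p (<⇒≤ r<p)))

  exact-!-div : ∀ {m} → m < p * p → ExactPower p (m div p) (m ℕ.!)
  exact-!-div {m} m<pp = subst (ExactPower p (m div p))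
    (cong ℕ._! (sym (trans (mod-div m (<⇒≤ 1<p)) (trans (cong (m mod p +_) (*-comm p (m div p))) (+-comm (m mod p) _)))))
    (exact-! (m div p) (m mod p) (*-cancelʳ-< p (m div p) p (≤-<-trans (div-lower m (<⇒≤ 1<p)) m<pp)) (mod<n m (<⇒≤ 1<p)))

  exact-factProd : ∀ xs t → All (λ c → c * t < p * p) xs → ExactPower p (sum (map (λ c → (c * t) div p) xs)) (factProd xs t)
  exact-factProd [] t [] = exact-free (λ p∣1 → contradiction (Div.∣1⇒≡1 p∣1) (>⇒≢ 1<p))
  exact-factProd (c ∷ xs) t (small ∷ smalls) = exact-* {(c * t) div p} (exact-!-div small) (exact-factProd xs t smalls)

prime-above : ∀ b → ∃[ p ] Prime p × b < p
prime-above b with large-prime-factor? (suc b) (suc (b ℕ.!)) (s≤s z≤n)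
... | inj₁ (p , pp , b<p , _) = p , pp , b<p
... | inj₂ below = contradiction (suc-injective (no-prime-factor⇒≡1 (s≤s z≤n) (λ q pq q∣ →
    contradiction (Div.∣1⇒≡1 (Div.∣m+n∣m⇒∣n (subst (q ∣_) (+-comm 1 (b ℕ.!)) q∣) (q∣! pq (ℕ.s≤s⁻¹ (below q pq q∣))))) (λ { refl → contradiction pq Primality.¬prime[1] }))))
    (m<n⇒n≢0 (1≤n! b))
  where
  q∣! : ∀ {q b} → Prime q → q ≤ b → q ∣ b ℕ.!
  q∣! {zero} pq _ = contradiction pq Primality.¬prime[0]
  q∣! {suc q} pq q≤b = Div.∣-trans (Div.m∣m*n (q ℕ.!)) (Div.m≤n⇒m!∣n! q≤b)

-- With t = ⌊np/N⌋ + 1 the fraction t/p lies just above n/N, so the floors of c t/p and c n/N agree once p is large.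
div-approximation : ∀ c n N p → 0 < N → c * (n + N) < p → (c * suc ((n * p) div N)) div p ≡ (c * n) div N
div-approximation c n N p 0<N large = div-unique (≤-<-trans z≤n large)
  (*-cancelʳ-≤ (f * p) (c * t) N {{ℕ.>-nonZero 0<N}} (begin
    f * p * N ≡⟨ lem₁ f p N ⟩
    f * N * p ≤⟨ *-monoˡ-≤ p (div-lower (c * n) 0<N) ⟩
    c * n * p ≡⟨ *-assoc c n p ⟩
    c * (n * p) ≤⟨ *-monoʳ-≤ c (<⇒≤ (div-upper (n * p) 0<N)) ⟩
    c * (t * N) ≡⟨ *-assoc c t N ⟨
    c * t * N ∎))
  (*-cancelʳ-< N (c * t) (suc f * p) (begin-strict
    c * t * N ≡⟨ lem₂ c ((n * p) div N) N ⟩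
    c * ((n * p) div N * N) + c * N ≤⟨ +-monoˡ-≤ (c * N) (*-monoʳ-≤ c (div-lower (n * p) 0<N)) ⟩
    c * (n * p) + c * N <⟨ +-monoʳ-< (c * (n * p)) (≤-<-trans (*-monoʳ-≤ c (m≤n+m N n)) large) ⟩
    c * (n * p) + p ≡⟨ lem₃ c n p ⟩
    suc (c * n) * p ≤⟨ *-monoˡ-≤ p (div-upper (c * n) 0<N) ⟩
    suc f * N * p ≡⟨ lem₁ (suc f) N p ⟩
    suc f * p * N ∎))
  where
  open ≤-Reasoning
  f = (c * n) div N
  t = suc ((n * p) div N)
  lem₁ : ∀ f p N → f * p * N ≡ f * N * p
  lem₁ = solve-ℕ
  lem₂ : ∀ c a N → c * suc a * N ≡ c * (a * N) + c * N
  lem₂ = solve-ℕ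
  lem₃ : ∀ c n p → c * (n * p) + p ≡ suc (c * n) * p
  lem₃ = solve-ℕ

-- Keeps c t below p², where Legendre's formula for (c t)! has only its first term.
approximation-small : ∀ c n N p → 0 < N → c * (n + N) < p → c * suc ((n * p) div N) < p * p
approximation-small c n N p 0<N large = <-≤-trans (div-upper (c * t) 0<p) (*-monoˡ-≤ p (≤-trans (s≤s (begin
    (c * t) div p ≡⟨ div-approximation c n N p 0<N large ⟩
    (c * n) div N ≤⟨ m≤m*n _ N {{ℕ.>-nonZero 0<N}} ⟩
    (c * n) div N * N ≤⟨ div-lower (c * n) 0<N ⟩
    c * n ≤⟨ *-monoʳ-≤ c (m≤m+n n N) ⟩
    c * (n + N) ∎)) large))
  where
  open ≤-Reasoning
  t = suc ((n * p) div N)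
  0<p = ≤-<-trans z≤n large

entry≤sum : ∀ xs → All (_≤ sum xs) xs
entry≤sum [] = []
entry≤sum (x ∷ xs) = m≤m+n x (sum xs) ∷ All.map (λ le → ≤-trans le (m≤n+m (sum xs) x)) (entry≤sum xs)

sum-cong : ∀ {φ χ : ℕ → ℕ} {xs} → All (λ c → φ c ≡ χ c) xs → sum (map φ xs) ≡ sum (map χ xs)
sum-cong [] = refl
sum-cong (e ∷ es) = cong₂ _+_ e (sum-cong es)

landau : ∀ as bs → (∀ n → 1 ≤ n → factProd bs n ∣ factProd as n) → ∀ n N → 0 < N →
  sum (map (λ b → (b * n) div N) bs) ≤ sum (map (λ a → (a * n) div N) as)
landau as bs integral n N 0<N with prime-above ((sum as + sum bs) * (n + N))
... | p , pp , large = subst₂ _≤_ (sum-cong (agree bs bounds-b)) (sum-cong (agree as bounds-a))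
    (exact-≤ pp (exact-factProd pp bs t (small bs bounds-b)) (exact-factProd pp as t (small as bounds-a)) (integral t (s≤s z≤n)))
  where
  t = suc ((n * p) div N)
  bound : ∀ {xs} → All (_≤ sum as + sum bs) xs → All (λ c → c * (n + N) < p) xs
  bound = All.map (λ le → ≤-<-trans (*-monoˡ-≤ (n + N) le) large)
  bounds-a = bound (All.map (λ le → ≤-trans le (m≤m+n (sum as) (sum bs))) (entry≤sum as))
  bounds-b = bound (All.map (λ le → ≤-trans le (m≤n+m (sum bs) (sum as))) (entry≤sum bs))
  agree : ∀ xs → All (λ c → c * (n + N) < p) xs → All (λ c → (c * t) div p ≡ (c * n) div N) xs
  agree xs = All.map (λ {c} l → div-approximation c n N p 0<N l)
  small : ∀ xs → All (λ c → c * (n + N) < p) xs → All (λ c → c * t < p * p) xs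
  small xs = All.map (λ {c} l → approximation-small c n N p 0<N l)

-- The step function of a signed list

signed : List ℕ → List ℕ → List (Bool × ℕ)
signed as bs = map (true ,_) as ++ map (false ,_) bs

lin-signed : ∀ as bs φ → lin ⟦ signed as bs ⟧ (λ c → ι (φ c)) ≡ ι (sum (map φ as)) ⊖ ι (sum (map φ bs))
lin-signed (a ∷ as) bs φ = trans (cong (1ℚ ⊛ ι (φ a) ⊕_) (lin-signed as bs φ))
  (trans (lem (ι (φ a)) (ι (sum (map φ as))) (ι (sum (map φ bs)))) (cong (_⊖ ι (sum (map φ bs))) (sym (ι-+ (φ a) (sum (map φ as))))))
  where
  lem : ∀ a b c → 1ℚ ⊛ a ⊕ (b ⊖ c) ≡ a ⊕ b ⊖ c
  lem = solve-∀ ring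
lin-signed [] bs φ = trans (go bs) (cong (_⊖ ι (sum (map φ bs))) (sym ι0))
  where
  lem : ∀ b s → ⊝ 1ℚ ⊛ b ⊕ (0ℚ ⊖ s) ≡ 0ℚ ⊖ (b ⊕ s)
  lem = solve-∀ ring
  go : ∀ bs → lin ⟦ map (false ,_) bs ⟧ (λ c → ι (φ c)) ≡ 0ℚ ⊖ ι (sum (map φ bs))
  go [] = cong (0ℚ ⊖_) (sym ι0)
  go (b ∷ bs) = trans (cong (⊝ 1ℚ ⊛ ι (φ b) ⊕_) (go bs)) (trans (lem (ι (φ b)) (ι (sum (map φ bs)))) (cong (0ℚ ⊖_) (sym (ι-+ (φ b) (sum (map φ bs))))))

step : List (Bool × ℕ) → ℕ → ℕ → ℚ
step xs n N = lin ⟦ xs ⟧ (λ c → ι ((c * n) div N))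

record Landau (xs : List (Bool × ℕ)) : Set where
  field
    balanced : lin ⟦ xs ⟧ ι ≡ 0ℚ
    height-one : lin ⟦ xs ⟧ (λ _ → 1ℚ) ≡ ⊝ 1ℚ
    step≥0 : ∀ n N → 0 < N → 0ℚ ≼ step xs n N
    step≤1 : ∀ n N → 0 < N → step xs n N ≼ 1ℚ

div-complement : ∀ {x y f k N} → 0 < N → x + y ≡ k * N → f * N < y → y < suc f * N → suc (x div N + f) ≡ k
div-complement {x} {y} {f} {k} {N} 0<N eq lower upper = ≤-antisym
  (*-cancelʳ-< N (x div N + f) k (begin-strict
    (x div N + f) * N ≡⟨ *-distribʳ-+ N (x div N) f ⟩
    x div N * N + f * N <⟨ +-mono-≤-< (div-lower x 0<N) lower ⟩
    x + y ≡⟨ eq ⟩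
    k * N ∎))
  (ℕ.s≤s⁻¹ (*-cancelʳ-< N k (2 + (x div N + f)) (begin-strict
    k * N ≡⟨ eq ⟨
    x + y <⟨ +-mono-< (div-upper x 0<N) upper ⟩
    suc (x div N) * N + suc f * N ≡⟨ lem (x div N) f N ⟩
    (2 + (x div N + f)) * N ∎)))
  where
  open ≤-Reasoning
  lem : ∀ a f N → suc a * N + suc f * N ≡ (2 + (a + f)) * N
  lem = solve-ℕ

-- Reflecting n/N in n + 1 and moving slightly to the left turns ⌊c n/N⌋ into c (n + 1) - 1 - ⌊c n/N⌋.
reflected : ℕ → ℕ → ℕ → ℕ
reflected M n N = N * M * suc n ∸ suc (n * M)

reflection : ∀ {c} M n N → 0 < N → 0 < c → c < M → suc ((c * reflected M n N) div (N * M) + (c * n) div N) ≡ c * suc n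
reflection {c} M n N 0<N 0<c c<M = div-complement {y = c * suc (n * M)} {N = N * M} (*-mono-≤ 0<N (≤-trans 0<c (<⇒≤ c<M)))
  (begin-equality
    c * reflected M n N + c * suc (n * M) ≡⟨ *-distribˡ-+ c _ _ ⟨
    c * (reflected M n N + suc (n * M)) ≡⟨ cong (c *_) (m∸n+n≡m fits) ⟩
    c * (N * M * suc n) ≡⟨ lem₁ c (N * M) (suc n) ⟩
    c * suc n * (N * M) ∎)
  (begin-strict
    f * (N * M) ≡⟨ *-assoc f N M ⟨
    f * N * M ≤⟨ *-monoˡ-≤ M (div-lower (c * n) 0<N) ⟩
    c * n * M <⟨ m<m+n (c * n * M) 0<c ⟩
    c * n * M + c ≡⟨ lem₂ c n M ⟩
    c * suc (n * M) ∎)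
  (begin-strict
    c * suc (n * M) ≡⟨ lem₂ c n M ⟨
    c * n * M + c <⟨ +-monoʳ-< (c * n * M) c<M ⟩
    c * n * M + M ≡⟨ +-comm (c * n * M) M ⟩
    suc (c * n) * M ≤⟨ *-monoˡ-≤ M (div-upper (c * n) 0<N) ⟩
    suc f * N * M ≡⟨ *-assoc (suc f) N M ⟩
    suc f * (N * M) ∎)
  where
  open ≤-Reasoning
  f = (c * n) div N
  fits : suc (n * M) ≤ N * M * suc n
  fits = begin
    suc (n * M) ≤⟨ +-monoˡ-≤ (n * M) (≤-trans 0<c (<⇒≤ c<M)) ⟩
    M + n * M ≡⟨ *-comm (suc n) M ⟩
    M * suc n ≤⟨ *-monoˡ-≤ (suc n) (m≤n*m M N {{ℕ.>-nonZero 0<N}}) ⟩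
    N * M * suc n ∎
  lem₁ : ∀ c a b → c * (a * b) ≡ c * b * a
  lem₁ = solve-ℕ
  lem₂ : ∀ c n M → c * n * M + c ≡ c * suc (n * M)
  lem₂ = solve-ℕ

entry≤size : ∀ xs → All (λ x → proj₂ x ≤ size xs) xs
entry≤size [] = []
entry≤size ((s , c) ∷ xs) = m≤m+n c (size xs) ∷ All.map (λ le → ≤-trans le (m≤n+m (size xs) c)) (entry≤size xs)

step-reflection : ∀ {xs} → Good xs → lin ⟦ xs ⟧ ι ≡ 0ℚ → ∀ n N → 0 < N →
  step xs (reflected (suc (size xs)) n N) (N * suc (size xs)) ⊕ step xs n N ⊕ lin ⟦ xs ⟧ (λ _ → 1ℚ) ≡ 0ℚ
step-reflection {xs} good balanced n N 0<N = begin
  step xs A N′ ⊕ step xs n N ⊕ lin ⟦ xs ⟧ (λ _ → 1ℚ) ≡⟨ cong (_⊕ lin ⟦ xs ⟧ (λ _ → 1ℚ)) (lin-⊕ ⟦ xs ⟧ _ _) ⟨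
  lin ⟦ xs ⟧ (λ c → ι ((c * A) div N′) ⊕ ι ((c * n) div N)) ⊕ lin ⟦ xs ⟧ (λ _ → 1ℚ) ≡⟨ lin-⊕ ⟦ xs ⟧ _ _ ⟨
  lin ⟦ xs ⟧ (λ c → ι ((c * A) div N′) ⊕ ι ((c * n) div N) ⊕ 1ℚ)
    ≡⟨ lin-cong-All (Allₚ.map⁺ (All.tabulate (λ {x} m → entry (positive good m) (s≤s (All.lookup (entry≤size xs) m))))) ⟩
  lin ⟦ xs ⟧ (λ c → ι (suc n) ⊛ ι c) ≡⟨ lin-⊛ ⟦ xs ⟧ (ι (suc n)) ι ⟩
  ι (suc n) ⊛ lin ⟦ xs ⟧ ι ≡⟨ trans (cong (ι (suc n) ⊛_) balanced) (ℚₚ.*-zeroʳ (ι (suc n))) ⟩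
  0ℚ ∎
  where
  open ≡-Reasoning
  -- M exceeds every entry c, so c n/N + c/(N M) has the same floor as c n/N and is not an integer.
  M = suc (size xs)
  A = reflected M n N
  N′ = N * M
  entry : ∀ {c} → 0 < c → c < M → ι ((c * A) div N′) ⊕ ι ((c * n) div N) ⊕ 1ℚ ≡ ι (suc n) ⊛ ι c
  entry {c} 0<c c<M = begin
    ι ((c * A) div N′) ⊕ ι ((c * n) div N) ⊕ 1ℚ ≡⟨ cong (_⊕ 1ℚ) (ι-+ ((c * A) div N′) ((c * n) div N)) ⟨
    ι ((c * A) div N′ + (c * n) div N) ⊕ 1ℚ ≡⟨ trans (ℚₚ.+-comm (ι ((c * A) div N′ + (c * n) div N)) 1ℚ) (sym (ι-suc ((c * A) div N′ + (c * n) div N))) ⟩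
    ι (suc ((c * A) div N′ + (c * n) div N)) ≡⟨ cong ι (trans (reflection M n N 0<N 0<c c<M) (*-comm c (suc n))) ⟩
    ι (suc n * c) ≡⟨ ι-* (suc n) c ⟩
    ι (suc n) ⊛ ι c ∎

-- The values at a point and at its reflection add up to 1, so the upper bound at the one is the
-- lower bound at the other.
Landau-intro : ∀ {xs} → Good xs → lin ⟦ xs ⟧ ι ≡ 0ℚ → lin ⟦ xs ⟧ (λ _ → 1ℚ) ≡ ⊝ 1ℚ → (∀ n N → 0 < N → 0ℚ ≼ step xs n N) → Landau xs
Landau-intro {xs} good balanced height-one nonneg = record
  { balanced = balanced
  ; height-one = height-one
  ; step≥0 = nonneg
  ; step≤1 = λ n N 0<N → ≤-by (step xs (reflected (suc (size xs)) n N) (N * suc (size xs)))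
      (nonneg (reflected (suc (size xs)) n N) (N * suc (size xs)) (*-mono-≤ 0<N (s≤s z≤n)))
      (rearrange (step xs (reflected (suc (size xs)) n N) (N * suc (size xs))) (step xs n N) (step-reflection good balanced n N 0<N))
  }
  where
  lem : ∀ a b → 1ℚ ≡ b ⊕ a ⊖ (a ⊕ b ⊕ ⊝ 1ℚ)
  lem = solve-∀ ring
  lem₂ : ∀ x → x ⊖ 0ℚ ≡ x
  lem₂ = solve-∀ ring
  rearrange : ∀ a b → a ⊕ b ⊕ lin ⟦ xs ⟧ (λ _ → 1ℚ) ≡ 0ℚ → 1ℚ ≡ b ⊕ a
  rearrange a b e = trans (lem a b) (trans (cong (b ⊕ a ⊖_) (trans (cong (a ⊕ b ⊕_) (sym height-one)) e)) (lem₂ (b ⊕ a)))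

integral-step : ∀ xs (φ : ℕ → ℕ) → ∃[ z ] lin ⟦ xs ⟧ (λ c → ι (φ c)) ≡ fromℤ z
integral-step [] φ = ℤ.0ℤ , refl
integral-step ((s , c) ∷ xs) φ with integral-step xs φ
... | z , e with s
... | true = ℤ.+ φ c ℤ.+ z , trans (cong₂ _⊕_ (trans (ℚₚ.*-identityˡ (ι (φ c))) (ι≡# (φ c))) e) (sym (fromℤ-+ (ℤ.+ φ c) z))
... | false = ℤ.- (ℤ.+ φ c) ℤ.+ z , trans (cong₂ _⊕_ (trans (lem (ι (φ c))) (trans (cong ⊝_ (ι≡# (φ c))) (sym (fromℤ-neg (ℤ.+ φ c))))) e) (sym (fromℤ-+ (ℤ.- (ℤ.+ φ c)) z))
  where
  lem : ∀ x → ⊝ 1ℚ ⊛ x ≡ ⊝ x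
  lem = solve-∀ ring

integer-0-1 : ∀ {z} → 0ℚ ≼ fromℤ z → fromℤ z ≼ 1ℚ → fromℤ z ≡ 0ℚ ⊎ fromℤ z ≡ 1ℚ
integer-0-1 {z} 0≤z z≤1 = go z (fromℤ-cancel-≤ 0≤z) (fromℤ-cancel-≤ z≤1)
  where
  go : ∀ z → ℤ.0ℤ ℤ.≤ z → z ℤ.≤ ℤ.1ℤ → fromℤ z ≡ 0ℚ ⊎ fromℤ z ≡ 1ℚ
  go (ℤ.+ 0) _ _ = inj₁ refl
  go (ℤ.+ 1) _ _ = inj₂ refl
  go (ℤ.+ suc (suc n)) _ (ℤ.+≤+ (s≤s ()))

step-0-1 : ∀ {xs} → Landau xs → ∀ n N → 0 < N → step xs n N ≡ 0ℚ ⊎ step xs n N ≡ 1ℚ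
step-0-1 {xs} l n N 0<N with integral-step xs (λ c → (c * n) div N)
... | z , e = subst (λ q → q ≡ 0ℚ ⊎ q ≡ 1ℚ) (sym e) (integer-0-1 (subst (0ℚ ≼_) e (Landau.step≥0 l n N 0<N)) (subst (_≼ 1ℚ) e (Landau.step≤1 l n N 0<N)))

-- The jumps of ⌊c x⌋ are multiples of 1/c, hence of 1/L, so none lies between k/L and the midpoint
-- (2k+1)/(2L): the floor at the midpoint is already the one at k/L.
sawtooth-step : ∀ {L c} k → 0 < L → 0 < c → c ∣ L → sawtooth L k c ≡ ι (suc (2 * k)) ⊛ ι c ⊕ (⊝ ι L) ⊛ (ι ((c * k) div L) ⊕ ι ((c * k) div L) ⊕ 1ℚ)
sawtooth-step {L} {c} k 0<L 0<c c∣L = begin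
  ι c ⊛ (ι (suc (2 * (k mod M))) ⊖ ι M) ≡⟨ cong (λ a → ι c ⊛ (a ⊖ ι M)) (ι-odd (k mod M)) ⟩
  ι c ⊛ (1ℚ ⊕ (ι (k mod M) ⊕ ι (k mod M)) ⊖ ι M) ≡⟨ lem (ι c) (ι (k mod M)) (ι M) (ι d) ⟩
  (1ℚ ⊕ ((ι (k mod M) ⊕ ι M ⊛ ι d) ⊕ (ι (k mod M) ⊕ ι M ⊛ ι d))) ⊛ ι c ⊕ (⊝ (ι c ⊛ ι M)) ⊛ (ι d ⊕ ι d ⊕ 1ℚ)
    ≡⟨ cong₂ (λ a b → (1ℚ ⊕ (a ⊕ a)) ⊛ ι c ⊕ (⊝ b) ⊛ (ι d ⊕ ι d ⊕ 1ℚ)) whole cM ⟩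
  (1ℚ ⊕ (ι k ⊕ ι k)) ⊛ ι c ⊕ (⊝ ι L) ⊛ (ι d ⊕ ι d ⊕ 1ℚ)
    ≡⟨ cong₂ (λ a b → a ⊛ ι c ⊕ (⊝ ι L) ⊛ (ι b ⊕ ι b ⊕ 1ℚ)) (sym (ι-odd k)) d≡ ⟩
  ι (suc (2 * k)) ⊛ ι c ⊕ (⊝ ι L) ⊛ (ι ((c * k) div L) ⊕ ι ((c * k) div L) ⊕ 1ℚ) ∎
  where
  open ≡-Reasoning
  M = L div c
  d = k div M
  0<M = 0<div 0<c 0<L c∣L
  whole : ι (k mod M) ⊕ ι M ⊛ ι d ≡ ι k
  whole = trans (cong (ι (k mod M) ⊕_) (sym (ι-* M d))) (trans (sym (ι-+ (k mod M) (M * d))) (cong ι (sym (mod-div k 0<M))))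
  cM : ι c ⊛ ι M ≡ ι L
  cM = trans (sym (ι-* c M)) (cong ι (*-div 0<c c∣L))
  d≡ : d ≡ (c * k) div L
  d≡ = trans (sym (div-*ˡ k M 0<c)) (cong ((c * k) div_) (*-div 0<c c∣L))
  lem : ∀ c r M d → c ⊛ (1ℚ ⊕ (r ⊕ r) ⊖ M) ≡ (1ℚ ⊕ ((r ⊕ M ⊛ d) ⊕ (r ⊕ M ⊛ d))) ⊛ c ⊕ (⊝ (c ⊛ M)) ⊛ (d ⊕ d ⊕ 1ℚ)
  lem = solve-∀ ring

-- Balance removes the linear part of the sawtooths, and the signed sum becomes L (1 - 2 f), which
-- is ±L at every midpoint. `mean-square` then reads 3 L³ = L³ Q.
Landau⇒Q≡3 : ∀ {xs} → Good xs → Landau xs → Q xs ≡ # 3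
Landau⇒Q≡3 {xs} good l with common-multiple ⟦ xs ⟧ (Good⇒Positive good)
... | L , 0<L , divide = cancel-*-≡ L 0<L (cancel-*-≡ L 0<L (cancel-*-≡ L 0<L (begin
  ι L ⊛ (ι L ⊛ (ι L ⊛ Q xs)) ≡⟨ lem₁ (ι L) (Q xs) ⟩
  ι L ⊛ ((ι L ⊛ ι L) ⊛ Q xs ⊖ 0ℚ ⊛ 0ℚ) ≡⟨ cong (λ y → ι L ⊛ ((ι L ⊛ ι L) ⊛ Q xs ⊖ y ⊛ y)) balanced ⟨
  ι L ⊛ ((ι L ⊛ ι L) ⊛ Q xs ⊖ lin ⟦ xs ⟧ ι ⊛ lin ⟦ xs ⟧ ι) ≡⟨ mean-square ⟦ xs ⟧ 0<L divide ⟨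
  # 3 ⊛ ∑ L (λ k → lin ⟦ xs ⟧ (sawtooth L k) ⊛ lin ⟦ xs ⟧ (sawtooth L k)) ≡⟨ cong (# 3 ⊛_) (trans (∑-cong L (λ k _ → square k)) (∑-const L (ι L ⊛ ι L))) ⟩
  # 3 ⊛ (ι L ⊛ (ι L ⊛ ι L)) ≡⟨ lem₂ (ι L) ⟩
  ι L ⊛ (ι L ⊛ (ι L ⊛ # 3)) ∎)))
  where
  open ≡-Reasoning
  open Landau l
  lem₁ : ∀ L q → L ⊛ (L ⊛ (L ⊛ q)) ≡ L ⊛ ((L ⊛ L) ⊛ q ⊖ 0ℚ ⊛ 0ℚ)
  lem₁ = solve-∀ ring
  lem₂ : ∀ L → # 3 ⊛ (L ⊛ (L ⊛ L)) ≡ L ⊛ (L ⊛ (L ⊛ # 3))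
  lem₂ = solve-∀ ring
  value : ∀ k → lin ⟦ xs ⟧ (sawtooth L k) ≡ ι (suc (2 * k)) ⊛ 0ℚ ⊕ (⊝ ι L) ⊛ (step xs k L ⊕ step xs k L ⊕ ⊝ 1ℚ)
  value k = begin
    lin ⟦ xs ⟧ (sawtooth L k) ≡⟨ lin-cong-All (All.map (λ { (0<c , c∣L) → sawtooth-step k 0<L 0<c c∣L }) divide) ⟩
    lin ⟦ xs ⟧ (λ c → ι (suc (2 * k)) ⊛ ι c ⊕ (⊝ ι L) ⊛ (ι ((c * k) div L) ⊕ ι ((c * k) div L) ⊕ 1ℚ))
      ≡⟨ lin-⊕⊛ ⟦ xs ⟧ (ι (suc (2 * k))) (⊝ ι L) ι (λ c → ι ((c * k) div L) ⊕ ι ((c * k) div L) ⊕ 1ℚ) ⟩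
    ι (suc (2 * k)) ⊛ lin ⟦ xs ⟧ ι ⊕ (⊝ ι L) ⊛ lin ⟦ xs ⟧ (λ c → ι ((c * k) div L) ⊕ ι ((c * k) div L) ⊕ 1ℚ)
      ≡⟨ cong₂ (λ a b → ι (suc (2 * k)) ⊛ a ⊕ (⊝ ι L) ⊛ b) balanced
         (trans (lin-⊕ ⟦ xs ⟧ _ _) (cong₂ _⊕_ (lin-⊕ ⟦ xs ⟧ _ _) height-one)) ⟩
    ι (suc (2 * k)) ⊛ 0ℚ ⊕ (⊝ ι L) ⊛ (step xs k L ⊕ step xs k L ⊕ ⊝ 1ℚ) ∎
  square : ∀ k → lin ⟦ xs ⟧ (sawtooth L k) ⊛ lin ⟦ xs ⟧ (sawtooth L k) ≡ ι L ⊛ ι L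
  square k with step-0-1 l k L 0<L
  ... | inj₁ e = trans (cong (λ v → v ⊛ v) (trans (value k) (cong (λ f → ι (suc (2 * k)) ⊛ 0ℚ ⊕ (⊝ ι L) ⊛ (f ⊕ f ⊕ ⊝ 1ℚ)) e))) (lem (ι (suc (2 * k))) (ι L))
    where
    lem : ∀ a L → (a ⊛ 0ℚ ⊕ (⊝ L) ⊛ (0ℚ ⊕ 0ℚ ⊕ ⊝ 1ℚ)) ⊛ (a ⊛ 0ℚ ⊕ (⊝ L) ⊛ (0ℚ ⊕ 0ℚ ⊕ ⊝ 1ℚ)) ≡ L ⊛ L
    lem = solve-∀ ring
  ... | inj₂ e = trans (cong (λ v → v ⊛ v) (trans (value k) (cong (λ f → ι (suc (2 * k)) ⊛ 0ℚ ⊕ (⊝ ι L) ⊛ (f ⊕ f ⊕ ⊝ 1ℚ)) e))) (lem (ι (suc (2 * k))) (ι L))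
    where
    lem : ∀ a L → (a ⊛ 0ℚ ⊕ (⊝ L) ⊛ (1ℚ ⊕ 1ℚ ⊕ ⊝ 1ℚ)) ⊛ (a ⊛ 0ℚ ⊕ (⊝ L) ⊛ (1ℚ ⊕ 1ℚ ⊕ ⊝ 1ℚ)) ≡ L ⊛ L
    lem = solve-∀ ring

-- Clusters

lin-↭ : ∀ {xs ys} → xs ↭ ys → ∀ φ → lin ⟦ xs ⟧ φ ≡ lin ⟦ ys ⟧ φ
lin-↭ Perm.refl φ = refl
lin-↭ (prep (s , c) p) φ = cong (weight s ⊛ φ c ⊕_) (lin-↭ p φ)
lin-↭ {_ ∷ _ ∷ xs} {_ ∷ _ ∷ ys} (swap (s , c) (t , d) p) φ = trans (cong (λ a → weight s ⊛ φ c ⊕ (weight t ⊛ φ d ⊕ a)) (lin-↭ p φ)) (lem (weight s ⊛ φ c) (weight t ⊛ φ d) (lin ⟦ ys ⟧ φ))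
  where
  lem : ∀ a b c → a ⊕ (b ⊕ c) ≡ b ⊕ (a ⊕ c)
  lem = solve-∀ ring
lin-↭ (Perm.trans p q) φ = trans (lin-↭ p φ) (lin-↭ q φ)

Q-↭ : ∀ {xs ys} → xs ↭ ys → Q xs ≡ Q ys
Q-↭ {xs} {ys} p = trans (lin-cong ⟦ xs ⟧ (λ c → lin-↭ p (K c))) (lin-↭ p _)

Good-↭ : ∀ {xs ys} → xs ↭ ys → Good xs → Good ys
Good-↭ p = Good-⊆ (Permₚ.∈-resp-↭ (↭-sym p))

lin-⟦++⟧ : ∀ xs ys φ → lin ⟦ xs ++ ys ⟧ φ ≡ lin ⟦ xs ⟧ φ ⊕ lin ⟦ ys ⟧ φ
lin-⟦++⟧ [] ys φ = sym (ℚₚ.+-identityˡ (lin ⟦ ys ⟧ φ))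
lin-⟦++⟧ ((s , c) ∷ xs) ys φ = trans (cong (weight s ⊛ φ c ⊕_) (lin-⟦++⟧ xs ys φ)) (sym (ℚₚ.+-assoc (weight s ⊛ φ c) (lin ⟦ xs ⟧ φ) (lin ⟦ ys ⟧ φ)))

Q-++ : ∀ xs ys → Q (xs ++ ys) ≡ Q xs ⊕ (B ⟦ xs ⟧ ⟦ ys ⟧ ⊕ B ⟦ xs ⟧ ⟦ ys ⟧) ⊕ Q ys
Q-++ xs ys = begin
  Q (xs ++ ys) ≡⟨ lin-⟦++⟧ xs ys _ ⟩
  B ⟦ xs ⟧ ⟦ xs ++ ys ⟧ ⊕ B ⟦ ys ⟧ ⟦ xs ++ ys ⟧ ≡⟨ cong₂ _⊕_ (expand xs) (expand ys) ⟩
  (Q xs ⊕ B ⟦ xs ⟧ ⟦ ys ⟧) ⊕ (B ⟦ ys ⟧ ⟦ xs ⟧ ⊕ Q ys) ≡⟨ cong (λ b → (Q xs ⊕ B ⟦ xs ⟧ ⟦ ys ⟧) ⊕ (b ⊕ Q ys)) (B-sym ⟦ ys ⟧ ⟦ xs ⟧) ⟩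
  (Q xs ⊕ B ⟦ xs ⟧ ⟦ ys ⟧) ⊕ (B ⟦ xs ⟧ ⟦ ys ⟧ ⊕ Q ys) ≡⟨ lem (Q xs) (B ⟦ xs ⟧ ⟦ ys ⟧) (Q ys) ⟩
  Q xs ⊕ (B ⟦ xs ⟧ ⟦ ys ⟧ ⊕ B ⟦ xs ⟧ ⟦ ys ⟧) ⊕ Q ys ∎
  where
  open ≡-Reasoning
  expand : ∀ zs → B ⟦ zs ⟧ ⟦ xs ++ ys ⟧ ≡ B ⟦ zs ⟧ ⟦ xs ⟧ ⊕ B ⟦ zs ⟧ ⟦ ys ⟧
  expand zs = trans (lin-cong ⟦ zs ⟧ (λ c → lin-⟦++⟧ xs ys (K c))) (lin-⊕ ⟦ zs ⟧ _ _)
  lem : ∀ a b c → (a ⊕ b) ⊕ (b ⊕ c) ≡ a ⊕ (b ⊕ b) ⊕ c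
  lem = solve-∀ ring

-- If c/d = u/v in lowest terms, then height c d = u v = 1 / K c d.
height : ℕ → ℕ → ℕ
height c d = (c div gcd c d) * (d div gcd c d)

0<gcd : ∀ {c} d → 0 < c → 0 < gcd c d
0<gcd {c} d 0<c = n≢0⇒n>0 (λ e → <⇒≢ 0<c (sym (GCD.gcd[m,n]≡0⇒m≡0 e)))

height-K : ∀ {c d} → 0 < c → 0 < d → ι (height c d) ⊛ K c d ≡ 1ℚ
height-K {c} {d} 0<c 0<d = begin
  ι (c′ * d′) ⊛ ((ι g ⊛ ι g) ⊛ (inv c ⊛ inv d)) ≡⟨ cong (_⊛ K c d) (ι-* c′ d′) ⟩
  (ι c′ ⊛ ι d′) ⊛ ((ι g ⊛ ι g) ⊛ (inv c ⊛ inv d)) ≡⟨ lem (ι c′) (ι d′) (ι g) (inv c) (inv d) ⟩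
  ((ι g ⊛ ι c′) ⊛ inv c) ⊛ ((ι g ⊛ ι d′) ⊛ inv d) ≡⟨ cong₂ (λ a b → (a ⊛ inv c) ⊛ (b ⊛ inv d)) (factor (GCD.gcd[m,n]∣m c d)) (factor (GCD.gcd[m,n]∣n c d)) ⟩
  (ι c ⊛ inv c) ⊛ (ι d ⊛ inv d) ≡⟨ cong₂ _⊛_ (ι-inv 0<c) (ι-inv 0<d) ⟩
  1ℚ ∎
  where
  open ≡-Reasoning
  g = gcd c d
  c′ = c div g
  d′ = d div g
  factor : ∀ {x} → g ∣ x → ι g ⊛ ι (x div g) ≡ ι x
  factor {x} g∣x = trans (sym (ι-* g (x div g))) (cong ι (*-div (0<gcd d 0<c) g∣x))
  lem : ∀ c d g c⁻ d⁻ → (c ⊛ d) ⊛ ((g ⊛ g) ⊛ (c⁻ ⊛ d⁻)) ≡ ((g ⊛ c) ⊛ c⁻) ⊛ ((g ⊛ d) ⊛ d⁻)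
  lem = solve-∀ ring

Far : ℕ → List (Bool × ℕ) → List (Bool × ℕ) → Set
Far H ys zs = ∀ {s c t d} → (s , c) ∈ ys → (t , d) ∈ zs → H ≤ height c d

lin-bound : ∀ {xs φ b} → All (λ x → (⊝ b ≼ φ (proj₂ x)) × (φ (proj₂ x) ≼ b)) xs →
  (⊝ (ι (length xs) ⊛ b) ≼ lin ⟦ xs ⟧ φ) × (lin ⟦ xs ⟧ φ ≼ ι (length xs) ⊛ b)
lin-bound {[]} {b = b} [] = ℚₚ.≤-reflexive (trans (cong (λ a → ⊝ (a ⊛ b)) ι0) (lem b)) , ℚₚ.≤-reflexive (sym (trans (cong (_⊛ b) ι0) (lem₂ b)))
  where
  lem : ∀ b → ⊝ (0ℚ ⊛ b) ≡ 0ℚ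
  lem = solve-∀ ring
  lem₂ : ∀ b → 0ℚ ⊛ b ≡ 0ℚ
  lem₂ = solve-∀ ring
lin-bound {(s , c) ∷ xs} {φ} {b} ((lo , hi) ∷ bounds) with lin-bound bounds
... | lows , his with head s
  where
  lem : ∀ a → 1ℚ ⊛ a ≡ a
  lem = solve-∀ ring
  lem₁ : ∀ b → ⊝ b ≡ ⊝ 1ℚ ⊛ b
  lem₁ = solve-∀ ring
  lem₂ : ∀ b → ⊝ ⊝ b ≡ b
  lem₂ = solve-∀ ring
  head : ∀ s → (⊝ b ≼ weight s ⊛ φ c) × (weight s ⊛ φ c ≼ b)
  head true = subst (⊝ b ≼_) (sym (lem (φ c))) lo , subst (_≼ b) (sym (lem (φ c))) hi
  head false = subst (⊝ b ≼_) (lem₁ (φ c)) (ℚₚ.neg-antimono-≤ hi) , subst₂ _≼_ (lem₁ (φ c)) (lem₂ b) (ℚₚ.neg-antimono-≤ lo)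
... | lo′ , hi′ = subst (_≼ weight s ⊛ φ c ⊕ lin ⟦ xs ⟧ φ) (trans (lem₃ b (ι (length xs))) (cong (λ n → ⊝ (n ⊛ b)) (sym (ι-suc (length xs))))) (ℚₚ.+-mono-≤ lo′ lows) ,
    subst (weight s ⊛ φ c ⊕ lin ⟦ xs ⟧ φ ≼_) (trans (lem₄ b (ι (length xs))) (cong (_⊛ b) (sym (ι-suc (length xs))))) (ℚₚ.+-mono-≤ hi′ his)
  where
  lem₃ : ∀ b n → ⊝ b ⊕ ⊝ (n ⊛ b) ≡ ⊝ ((1ℚ ⊕ n) ⊛ b)
  lem₃ = solve-∀ ring
  lem₄ : ∀ b n → b ⊕ n ⊛ b ≡ (1ℚ ⊕ n) ⊛ b
  lem₄ = solve-∀ ring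

far-B : ∀ {H ys zs} → Good ys → Good zs → Far H ys zs → ⊝ ι (length ys * length zs) ≼ ι H ⊛ B ⟦ ys ⟧ ⟦ zs ⟧
far-B {H} {ys} {zs} good-ys good-zs far = subst₂ _≼_
  (cong ⊝_ (trans (lem (ι (length ys)) (ι (length zs))) (sym (ι-* (length ys) (length zs)))))
  (trans (lin-cong ⟦ ys ⟧ (λ c → lin-⊛ ⟦ zs ⟧ (ι H) (K c))) (lin-⊛ ⟦ ys ⟧ (ι H) _))
  (proj₁ (lin-bound {ys} (All.tabulate (λ {x} m → lin-bound {zs} {λ d → ι H ⊛ K (proj₂ x) d} (All.tabulate (λ {y} m′ → entry m m′))))))
  where
  lem : ∀ m n → m ⊛ (n ⊛ 1ℚ) ≡ m ⊛ n
  lem = solve-∀ ring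
  entry : ∀ {s c t d} → (s , c) ∈ ys → (t , d) ∈ zs → (⊝ 1ℚ ≼ ι H ⊛ K c d) × (ι H ⊛ K c d ≼ 1ℚ)
  entry {c = c} {d = d} m m′ = ℚₚ.≤-trans (ℚₚ.≤ᵇ⇒≤ _) (0≤* (ι-nonneg H) (K-nonneg c d)) ,
    subst (ι H ⊛ K c d ≼_) (height-K (positive good-ys m) (positive good-zs m′))
      (ℚₚ.*-monoʳ-≤-nonNeg (K c d) {{ℚ.nonNegative (K-nonneg c d)}} (ι-mono-≤ (far m m′)))

far-Q : ∀ {H N ys zs} → Good ys → Good zs → Far H ys zs → length ys ≤ N → length zs ≤ N →
  ι H ⊛ (Q ys ⊕ Q zs) ≼ ι H ⊛ Q (ys ++ zs) ⊕ (ι (N * N) ⊕ ι (N * N))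
far-Q {H} {N} {ys} {zs} good-ys good-zs far ys≤N zs≤N = ≤-by
  (# 2 ⊛ (ι H ⊛ b ⊖ ⊝ ι (length ys * length zs)) ⊕ # 2 ⊛ (ι (N * N) ⊖ ι (length ys * length zs)))
  (0≤+ (0≤* (#≥0 2) (diff≥0 (far-B good-ys good-zs far))) (0≤* (#≥0 2) (diff≥0 (ι-mono-≤ (*-mono-≤ ys≤N zs≤N)))))
  (trans (cong (λ q → ι H ⊛ q ⊕ (ι (N * N) ⊕ ι (N * N))) (Q-++ ys zs)) (lem (ι H) (Q ys) (Q zs) b (ι (N * N)) (ι (length ys * length zs))))
  where
  b = B ⟦ ys ⟧ ⟦ zs ⟧
  lem : ∀ H y z b n l → H ⊛ (y ⊕ (b ⊕ b) ⊕ z) ⊕ (n ⊕ n) ≡ H ⊛ (y ⊕ z) ⊕ (# 2 ⊛ (H ⊛ b ⊖ ⊝ l) ⊕ # 2 ⊛ (n ⊖ l))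
  lem = solve-∀ ring

-- Growing clusters of commensurable entries

record Cluster (U : ℕ) (xs : List (Bool × ℕ)) : Set where
  constructor cluster
  field
    modulus : ℕ
    multiples : ∀ {s c} → (s , c) ∈ xs → ∃[ u ] c ≡ modulus * u × u ≤ U

open Cluster

Cluster-mono : ∀ {U V xs} → U ≤ V → Cluster U xs → Cluster V xs
Cluster-mono U≤V (cluster m mult) = cluster m (λ x∈ → let (u , e , u≤U) = mult x∈ in u , e , ≤-trans u≤U U≤V)

Cluster-single : ∀ x → Cluster 1 (x ∷ [])
Cluster-single (s , c) = cluster c λ { (here refl) → 1 , sym (*-identityʳ c) , ≤-refl }

0<factorˡ : ∀ {a b} → 0 < a * b → 0 < a
0<factorˡ {suc a} _ = s≤s z≤n

0<factorʳ : ∀ {a b} → 0 < a * b → 0 < b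
0<factorʳ {a} {b} h = 0<factorˡ {b} {a} (subst (0 <_) (*-comm a b) h)

-- The new modulus is g′ = gcd m d. Let c = m u and c/d = c′/d′ in lowest terms, with c′ and d′ at
-- most H. As d c′ = m u d′, m divides c′ d as well as c′ m, hence c′ g′; so a = m/g′ divides c′,
-- and old multipliers grow at most by the factor H. For b = d/g′ one gets b c′ = a u d′, whence b ≤
-- u d′ ≤ U H.
Cluster-attach : ∀ {U H ys t d s c} → (cl : Cluster U ys) → (s , c) ∈ ys → 0 < c → 0 < d → height c d ≤ H → Cluster (U * H) ((t , d) ∷ ys)
Cluster-attach {U} {H} {ys} {t} {d} {s} {c} (cluster m mult) c∈ys 0<c 0<d close with mult c∈ys
... | u , refl , u≤U = cluster g′ λ
  { (here refl) → b , sym g′b , b≤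
  ; (there y∈ys) → let (v , e , v≤U) = mult y∈ys in a * v , trans e (trans (cong (_* v) (sym g′a)) (*-assoc g′ a v)) ,
      ≤-trans (≤-reflexive (*-comm a v)) (*-mono-≤ v≤U (≤-trans a≤c′ c′≤H)) }
  where
  open ≤-Reasoning
  0<m : 0 < m
  0<m = 0<factorˡ {m} {u} 0<c
  g = gcd (m * u) d
  g′ = gcd m d
  0<g = 0<gcd d 0<c
  0<g′ = 0<gcd d 0<m
  c′ = (m * u) div g
  d′ = d div g
  a = m div g′
  b = d div g′
  gc′ : g * c′ ≡ m * u
  gc′ = *-div 0<g (GCD.gcd[m,n]∣m (m * u) d)
  gd′ : g * d′ ≡ d
  gd′ = *-div 0<g (GCD.gcd[m,n]∣n (m * u) d)
  g′a : g′ * a ≡ m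
  g′a = *-div 0<g′ (GCD.gcd[m,n]∣m m d)
  g′b : g′ * b ≡ d
  g′b = *-div 0<g′ (GCD.gcd[m,n]∣n m d)
  0<c′ = 0<factorʳ {g} (subst (0 <_) (sym gc′) 0<c)
  0<d′ = 0<factorʳ {g} (subst (0 <_) (sym gd′) 0<d)
  c′≤H : c′ ≤ H
  c′≤H = ≤-trans (m≤m*n c′ d′ {{ℕ.>-nonZero 0<d′}}) close
  d′≤H : d′ ≤ H
  d′≤H = ≤-trans (m≤n*m d′ c′ {{ℕ.>-nonZero 0<c′}}) close
  cross : d * c′ ≡ m * (u * d′)
  cross = begin-equality
    d * c′ ≡⟨ cong (_* c′) gd′ ⟨
    g * d′ * c′ ≡⟨ lem g d′ c′ ⟩
    g * c′ * d′ ≡⟨ cong (_* d′) gc′ ⟩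
    m * u * d′ ≡⟨ *-assoc m u d′ ⟩
    m * (u * d′) ∎
    where
    lem : ∀ g d c → g * d * c ≡ g * c * d
    lem = solve-ℕ
  a∣c′ : a ∣ c′
  a∣c′ = Div.*-cancelˡ-∣ g′ {{ℕ.>-nonZero 0<g′}} (subst₂ _∣_ (sym g′a)
    (trans (sym (GCD.c*gcd[m,n]≡gcd[cm,cn] c′ m d)) (*-comm c′ g′))
    (GCD.gcd-greatest (Div.n∣m*n c′) (subst (m ∣_) (trans (sym cross) (*-comm d c′)) (Div.m∣m*n (u * d′)))))
  a≤c′ : a ≤ c′
  a≤c′ = Div.∣⇒≤ {{ℕ.>-nonZero 0<c′}} a∣c′
  bc′ : b * c′ ≡ a * (u * d′)
  bc′ = *-cancelˡ-≡ (b * c′) (a * (u * d′)) g′ {{ℕ.>-nonZero 0<g′}} (begin-equality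
    g′ * (b * c′) ≡⟨ *-assoc g′ b c′ ⟨
    g′ * b * c′ ≡⟨ cong (_* c′) g′b ⟩
    d * c′ ≡⟨ cross ⟩
    m * (u * d′) ≡⟨ cong (_* (u * d′)) g′a ⟨
    g′ * a * (u * d′) ≡⟨ *-assoc g′ a (u * d′) ⟩
    g′ * (a * (u * d′)) ∎)
  b≤ : b ≤ U * H
  b≤ = ≤-trans (*-cancelʳ-≤ b (u * d′) c′ {{ℕ.>-nonZero 0<c′}} (begin
    b * c′ ≡⟨ bc′ ⟩
    a * (u * d′) ≤⟨ *-monoˡ-≤ (u * d′) a≤c′ ⟩
    c′ * (u * d′) ≡⟨ *-comm c′ (u * d′) ⟩
    u * d′ * c′ ∎)) (*-mono-≤ u≤U d′≤H)

close? : ∀ H ys d → (Σ Bool λ s → ∃[ c ] (s , c) ∈ ys × height c d ≤ H) ⊎ (∀ {s c} → (s , c) ∈ ys → H ≤ height c d)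
close? H [] d = inj₂ λ ()
close? H ((s , c) ∷ ys) d with ≤-total (height c d) H | close? H ys d
... | inj₁ close | _ = inj₁ (s , c , here refl , close)
... | inj₂ _ | inj₁ (t , e , e∈ys , close) = inj₁ (t , e , there e∈ys , close)
... | inj₂ far | inj₂ fars = inj₂ λ { (here refl) → far ; (there m) → fars m }

close-pair? : ∀ H ys zs → (Σ Bool λ t → Σ ℕ λ d → ∃[ zs′ ] zs ↭ (t , d) ∷ zs′ × Σ Bool λ s → ∃[ c ] (s , c) ∈ ys × height c d ≤ H) ⊎ Far H ys zs
close-pair? H ys [] = inj₂ λ _ ()
close-pair? H ys ((t , d) ∷ zs) with close? H ys d | close-pair? H ys zs
... | inj₁ close | _ = inj₁ (t , d , zs , ↭-refl , close)
... | inj₂ _ | inj₁ (t′ , d′ , zs′ , p , close) = inj₁ (t′ , d′ , (t , d) ∷ zs′ , ↭-trans (prep _ p) (swap _ _ ↭-refl) , close)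
... | inj₂ far | inj₂ fars = inj₂ λ { m (here refl) → far m ; m (there m′) → fars m m′ }

record Grown (H U : ℕ) (xs : List (Bool × ℕ)) : Set where
  field
    inside outside : List (Bool × ℕ)
    permutation : xs ↭ inside ++ outside
    clustered : Cluster U inside
    nonempty : 0 < length inside
    far : Far H inside outside

-- Each absorbed entry multiplies the bound on the multipliers by H. At most n entries can be
-- absorbed, so the final bound depends on the length alone, not on the entries.
grow : ∀ {H} n → 0 < H → ∀ {U} ys zs → length zs ≤ n → Good (ys ++ zs) → 0 < length ys → Cluster U ys → Grown H (U * H ℕ.^ n) (ys ++ zs)
grow {H} zero 0<H {U} ys [] _ good nonempty cl = record { inside = ys ; outside = [] ; permutation = ↭-refl ; clustered = Cluster-mono (≤-reflexive (sym (*-identityʳ U))) cl ; nonempty = nonempty ; far = λ _ () }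
grow {H} (suc n) 0<H {U} ys zs zs≤ good nonempty cl with close-pair? H ys zs
... | inj₂ far = record { inside = ys ; outside = zs ; permutation = ↭-refl ; clustered = Cluster-mono (m≤m*n U (H ℕ.^ suc n) {{m^n≢0 H (suc n) {{ℕ.>-nonZero 0<H}}}}) cl ; nonempty = nonempty ; far = far }
... | inj₁ (t , d , zs′ , p , s , c , m , close) = record
  { inside = Grown.inside rec
  ; outside = Grown.outside rec
  ; permutation = ↭-trans p′ (Grown.permutation rec)
  ; clustered = subst (λ V → Cluster V (Grown.inside rec)) (*-assoc U H (H ℕ.^ n)) (Grown.clustered rec)
  ; nonempty = Grown.nonempty rec
  ; far = Grown.far rec
  }
  where
  p′ : ys ++ zs ↭ (t , d) ∷ ys ++ zs′
  p′ = ↭-trans (Permₚ.++⁺ˡ ys p) (Permₚ.shift (t , d) ys zs′)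
  good′ = Good-↭ p′ good
  rec = grow n 0<H ((t , d) ∷ ys) zs′ (ℕ.s≤s⁻¹ (subst (_≤ suc n) (Permₚ.↭-length p) zs≤)) good′ (s≤s z≤n)
    (Cluster-attach cl m (positive good (∈-++⁺ˡ m)) (positive good′ (here refl)) close)

grown : ∀ {H n xs} → 0 < H → Good xs → 0 < length xs → length xs ≤ n → Grown H (H ℕ.^ n) xs
grown {H} {n} {x ∷ xs} 0<H good _ xs≤n = subst (λ U → Grown H U (x ∷ xs)) (*-identityˡ (H ℕ.^ n))
  (grow n 0<H (x ∷ []) xs (<⇒≤ xs≤n) good (s≤s z≤n) (Cluster-single x))

data Decomposition (U : ℕ) (xs : List (Bool × ℕ)) : Set where
  one : Cluster U xs → Decomposition U xs
  two : ∀ {ys zs} → xs ↭ ys ++ zs → 0 < length ys → 0 < length zs → Cluster U ys → Cluster U zs → Decomposition U xs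
  three : ∀ {ys zs ws} → xs ↭ ys ++ zs ++ ws → Minimal ys → Minimal zs → Minimal ws → Decomposition U xs

Good-++ˡ : ∀ {xs ys} → Good (xs ++ ys) → Good xs
Good-++ˡ = Good-⊆ ∈-++⁺ˡ

Good-++ʳ : ∀ xs {ys} → Good (xs ++ ys) → Good ys
Good-++ʳ xs = Good-⊆ (∈-++⁺ʳ xs)

-- Large enough for the cross terms, at most 6 · 84² / threshold in total, to stay below 1/4.
opaque
  threshold : ℕ
  threshold = 200000

  0<threshold : 0 < threshold
  0<threshold = s≤s z≤n

  ι-threshold : ι threshold ≡ # 200000
  ι-threshold = ι≡# 200000

-- The error 42336 collects three separations at 2 * 84² each. Since 200000 * 13/4 = 650000 exceeds
-- 600000 + 42336, a total norm of 3 forbids parts whose norms add up to 13/4.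
Q≡3-contradiction : ∀ {a e} → ι threshold ⊛ a ≼ ι threshold ⊛ # 3 ⊕ e → e ≡ # 42336 → ¬ (# 13 ⊛ (¼) ≼ a)
Q≡3-contradiction {a} le refl 13/4≤a = from-no ((# 200000 ⊛ (# 13 ⊛ (¼))) ℚₚ.≤? (# 200000 ⊛ # 3 ⊕ # 42336))
  (ℚₚ.≤-trans (*-mono-≤ˡ (# 200000) (#≥0 200000) 13/4≤a) (subst (λ t → t ⊛ a ≼ t ⊛ # 3 ⊕ # 42336) ι-threshold le))

append-far : ∀ {N ys zs} → Good ys → Good zs → Far threshold ys zs → length ys ≤ N → length zs ≤ N →
  ∀ {a e} → ι threshold ⊛ a ≼ ι threshold ⊛ Q zs ⊕ e → ι threshold ⊛ (Q ys ⊕ a) ≼ ι threshold ⊛ Q (ys ++ zs) ⊕ (ι (N * N) ⊕ ι (N * N) ⊕ e)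
append-far {N} {ys} {zs} good-ys good-zs far ys≤N zs≤N {a} {e} le = ≤-by
  ((ι threshold ⊛ Q (ys ++ zs) ⊕ (ι (N * N) ⊕ ι (N * N)) ⊖ ι threshold ⊛ (Q ys ⊕ Q zs)) ⊕ (ι threshold ⊛ Q zs ⊕ e ⊖ ι threshold ⊛ a))
  (0≤+ (diff≥0 (far-Q good-ys good-zs far ys≤N zs≤N)) (diff≥0 le))
  (lem (ι threshold) (Q ys) a (Q (ys ++ zs)) (Q zs) (ι (N * N)) e)
  where
  lem : ∀ t y a q z n e → t ⊛ q ⊕ (n ⊕ n ⊕ e) ≡ t ⊛ (y ⊕ a) ⊕ ((t ⊛ q ⊕ (n ⊕ n) ⊖ t ⊛ (y ⊕ z)) ⊕ (t ⊛ z ⊕ e ⊖ t ⊛ a))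
  lem = solve-∀ ring

module _ {xs : List (Bool × ℕ)} (good : Good xs) (Q≡3 : Q xs ≡ # 3) where

  private
    e² : ι (84 * 84) ≡ # 7056
    e² = ι≡# (84 * 84)

    ≤ʳ : ∀ {n} ys {zs : List (Bool × ℕ)} → length (ys ++ zs) ≤ n → length zs ≤ n
    ≤ʳ ys {zs} le = ≤-trans (subst (length zs ≤_) (sym (Listₚ.length-++ ys)) (m≤n+m (length zs) (length ys))) le

    ≤ˡ : ∀ {n} ys {zs : List (Bool × ℕ)} → length (ys ++ zs) ≤ n → length ys ≤ n
    ≤ˡ ys {zs} le = ≤-trans (subst (length ys ≤_) (sym (Listₚ.length-++ ys)) (m≤m+n (length ys) (length zs))) le

    13/4 : ℚ
    13/4 = # 13 ⊛ (¼)

    one≤ : ∀ ys → Good ys → 0 < length ys → 1ℚ ≼ Q ys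
    one≤ ys g ne = Classified⇒1≼Q (classify g ne)

  decompose : 0 < length xs → Decomposition (threshold ℕ.^ 84) xs
  decompose nonempty with length≤84 good Q≡3
  ... | xs≤84 with grown {threshold} 0<threshold good nonempty xs≤84
  ... | record { inside = ys ; outside = [] ; permutation = p ; clustered = cl } =
        one (cluster (modulus cl) (λ m → multiples cl ([ (λ m′ → m′) , (λ ()) ]′ (∈-++⁻ ys (Permₚ.∈-resp-↭ p m)))))
  ... | record { inside = ys ; outside = zs@(_ ∷ _) ; permutation = p ; clustered = cl ; nonempty = ys≢[] ; far = far }
    with Good-↭ p good | subst (_≤ 84) (Permₚ.↭-length p) xs≤84
  ... | good-p | p≤84 with grown {threshold} 0<threshold (Good-++ʳ ys good-p) (s≤s z≤n) (≤ʳ ys p≤84)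
  ... | record { inside = zs₁ ; outside = [] ; permutation = q ; clustered = cl′ } =
        two p ys≢[] (s≤s z≤n) cl (cluster (modulus cl′) (λ m → multiples cl′ ([ (λ m′ → m′) , (λ ()) ]′ (∈-++⁻ zs₁ (Permₚ.∈-resp-↭ q m)))))
  ... | record { inside = zs₁ ; outside = ws@(_ ∷ _) ; permutation = q ; clustered = cl′ ; nonempty = zs₁≢[] ; far = far′ }
    with Good-↭ q (Good-++ʳ ys good-p) | subst (_≤ 84) (Permₚ.↭-length q) (≤ʳ ys p≤84)
  ... | good-q | q≤84 with grown {threshold} 0<threshold (Good-++ʳ zs₁ good-q) (s≤s z≤n) (≤ʳ zs₁ q≤84)
  ... | record { inside = ws₁ ; outside = vs ; permutation = r ; nonempty = ws₁≢[] ; far = far″ } = finish vs r far″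
    where
    good-ys = Good-++ˡ good-p
    good-zs = Good-++ˡ good-q
    good-ws = Good-++ʳ zs₁ good-q
    total : ∀ {a e} → ι threshold ⊛ a ≼ ι threshold ⊛ Q ws ⊕ e →
      ι threshold ⊛ (Q ys ⊕ (Q zs₁ ⊕ a)) ≼ ι threshold ⊛ # 3 ⊕ (ι (84 * 84) ⊕ ι (84 * 84) ⊕ (ι (84 * 84) ⊕ ι (84 * 84) ⊕ e))
    total {a} {e} le = subst (λ q → ι threshold ⊛ (Q ys ⊕ (Q zs₁ ⊕ a)) ≼ ι threshold ⊛ q ⊕ (ι (84 * 84) ⊕ ι (84 * 84) ⊕ (ι (84 * 84) ⊕ ι (84 * 84) ⊕ e))) (trans (sym (Q-↭ p)) Q≡3)
      (append-far good-ys (Good-++ʳ ys good-p) far (≤ˡ ys p≤84) (≤ʳ ys p≤84)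
        (subst (λ q → ι threshold ⊛ (Q zs₁ ⊕ a) ≼ ι threshold ⊛ q ⊕ (ι (84 * 84) ⊕ ι (84 * 84) ⊕ e)) (sym (Q-↭ q))
          (append-far good-zs good-ws far′ (≤ˡ zs₁ q≤84) (≤ʳ zs₁ q≤84) le)))
    errors : ∀ {e} → e ≡ # 14112 → ι (84 * 84) ⊕ ι (84 * 84) ⊕ (ι (84 * 84) ⊕ ι (84 * 84) ⊕ e) ≡ # 42336
    errors refl = cong (λ n → n ⊕ n ⊕ (n ⊕ n ⊕ # 14112)) e²
    -- Three parts involve only two separations; the error 14112 = 2 * 84² of a third one is added
    -- so that the same numerical comparison serves three and four parts.
    slack : ∀ {a} → ι threshold ⊛ a ≼ ι threshold ⊛ Q ws ⊕ 0ℚ → ι threshold ⊛ a ≼ ι threshold ⊛ Q ws ⊕ # 14112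
    slack le = ℚₚ.≤-trans le (ℚₚ.+-monoʳ-≤ (ι threshold ⊛ Q ws) (#≥0 14112))
    three-parts : ι threshold ⊛ Q ws ≼ ι threshold ⊛ Q ws ⊕ # 14112
    three-parts = slack (ℚₚ.≤-reflexive (sym (ℚₚ.+-identityʳ (ι threshold ⊛ Q ws))))
    lem : ∀ a b c → a ⊕ (b ⊕ c) ≡ 13/4 ⊕ ((a ⊖ 5/4ℚ) ⊕ (b ⊖ 1ℚ) ⊕ (c ⊖ 1ℚ))
    lem = solve-∀ ring
    lem₁ : ∀ a b c → a ⊕ (b ⊕ c) ≡ 13/4 ⊕ ((b ⊖ 5/4ℚ) ⊕ (a ⊖ 1ℚ) ⊕ (c ⊖ 1ℚ))
    lem₁ = solve-∀ ring
    lem₂ : ∀ a b c → a ⊕ (b ⊕ c) ≡ 13/4 ⊕ ((c ⊖ 5/4ℚ) ⊕ (a ⊖ 1ℚ) ⊕ (b ⊖ 1ℚ))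
    lem₂ = solve-∀ ring
    impossible : ¬ (13/4 ≼ Q ys ⊕ (Q zs₁ ⊕ Q ws))
    impossible = Q≡3-contradiction (total three-parts) (errors refl)
    classified : Classified ys → Classified zs₁ → Classified ws → xs ↭ ys ++ zs₁ ++ ws → Decomposition (threshold ℕ.^ 84) xs
    classified (inj₁ (m₁ , _)) (inj₁ (m₂ , _)) (inj₁ (m₃ , _)) p = three p m₁ m₂ m₃
    classified (inj₂ le) c₂ c₃ _ = contradiction (≤-by _ (0≤+ (0≤+ (diff≥0 le) (diff≥0 (Classified⇒1≼Q c₂))) (diff≥0 (Classified⇒1≼Q c₃))) (lem (Q ys) (Q zs₁) (Q ws))) impossible
    classified c₁ (inj₂ le) c₃ _ = contradiction (≤-by _ (0≤+ (0≤+ (diff≥0 le) (diff≥0 (Classified⇒1≼Q c₁))) (diff≥0 (Classified⇒1≼Q c₃))) (lem₁ (Q ys) (Q zs₁) (Q ws))) impossible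
    classified c₁ c₂ (inj₂ le) _ = contradiction (≤-by _ (0≤+ (0≤+ (diff≥0 le) (diff≥0 (Classified⇒1≼Q c₁))) (diff≥0 (Classified⇒1≼Q c₂))) (lem₂ (Q ys) (Q zs₁) (Q ws))) impossible
    -- If nothing lies outside the third cluster, the parts sum to at least 3, and any part of norm
    -- 5/4 or more lifts the sum to 13/4. A nonempty fourth part lifts it to 4.
    finish : ∀ vs → ws ↭ ws₁ ++ vs → Far threshold ws₁ vs → Decomposition (threshold ℕ.^ 84) xs
    finish [] r far″ = classified (classify good-ys ys≢[]) (classify good-zs zs₁≢[]) (classify good-ws (s≤s z≤n)) (↭-trans p (Permₚ.++⁺ˡ ys q))
    finish vs@(_ ∷ _) r far″ = contradiction
      (≤-by (Q ys ⊖ 1ℚ ⊕ (Q zs₁ ⊖ 1ℚ) ⊕ (Q ws₁ ⊖ 1ℚ) ⊕ (Q vs ⊖ 1ℚ) ⊕ ¾)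
        (0≤+ (0≤+ (0≤+ (0≤+ (diff≥0 (one≤ ys good-ys ys≢[])) (diff≥0 (one≤ zs₁ good-zs zs₁≢[]))) (diff≥0 (one≤ ws₁ (Good-++ˡ good-r) ws₁≢[]))) (diff≥0 (one≤ vs (Good-++ʳ ws₁ good-r) (s≤s z≤n)))) (ℚₚ.nonNegative⁻¹ (¾)))
        (lem₃ (Q ys) (Q zs₁) (Q ws₁) (Q vs)))
      (Q≡3-contradiction (total {Q ws₁ ⊕ Q vs} four-parts) (errors (cong (λ n → n ⊕ n) e²)))
      where
      good-r = Good-↭ r good-ws
      r≤84 = subst (_≤ 84) (Permₚ.↭-length r) (≤ʳ zs₁ q≤84)
      four-parts : ι threshold ⊛ (Q ws₁ ⊕ Q vs) ≼ ι threshold ⊛ Q ws ⊕ (ι (84 * 84) ⊕ ι (84 * 84))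
      four-parts = subst (λ w → ι threshold ⊛ (Q ws₁ ⊕ Q vs) ≼ ι threshold ⊛ w ⊕ (ι (84 * 84) ⊕ ι (84 * 84))) (sym (Q-↭ r))
        (far-Q (Good-++ˡ good-r) (Good-++ʳ ws₁ good-r) far″ (≤ˡ ws₁ r≤84) (≤ʳ ws₁ r≤84))
      lem₃ : ∀ a b c d → a ⊕ (b ⊕ (c ⊕ d)) ≡ 13/4 ⊕ (a ⊖ 1ℚ ⊕ (b ⊖ 1ℚ) ⊕ (c ⊖ 1ℚ) ⊕ (d ⊖ 1ℚ) ⊕ ¾)
      lem₃ = solve-∀ ring

-- Two clusters

+*-div : ∀ a n k → 0 < n → (a + n * k) div n ≡ a div n + k
+*-div a n k 0<n = div-unique 0<n
  (begin
    (a div n + k) * n ≡⟨ *-distribʳ-+ n (a div n) k ⟩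
    a div n * n + k * n ≤⟨ +-monoˡ-≤ (k * n) (div-lower a 0<n) ⟩
    a + k * n ≡⟨ cong (a +_) (*-comm k n) ⟩
    a + n * k ∎)
  (begin-strict
    a + n * k <⟨ +-monoˡ-< (n * k) (div-upper a 0<n) ⟩
    suc (a div n) * n + n * k ≡⟨ lem (a div n) n k ⟩
    suc (a div n + k) * n ∎)
  where
  open ≤-Reasoning
  lem : ∀ a n k → suc a * n + n * k ≡ suc (a + k) * n
  lem = solve-ℕ

-- Solves n j ≡ s - e modulo m without subtraction: m′ = m - 1 stands for -1, so s + e m′ represents
-- s - e and e + s m′ represents e - s. Which of the two is multiplied by the Bézout coefficient y
-- depends on whether y n is 1 or -1 modulo m.
congruence-solution : ∀ {m n} → 1 < m → Coprime m n → ∀ e s → ∃[ j ] ∃[ q ] e + n * j ≡ s + m * q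
congruence-solution {suc m′} {n} 1<m coprime e s with coprime-Bézout coprime
... | GCD.Bézout.-+ x y eq = (s + e * m′) * y , e + (s + e * m′) * x , (begin
    e + n * ((s + e * m′) * y) ≡⟨ lem₁ e n (s + e * m′) y ⟩
    e + (s + e * m′) * (y * n) ≡⟨ cong (λ a → e + (s + e * m′) * a) eq ⟨
    e + (s + e * m′) * suc (x * suc m′) ≡⟨ lem₂ e s m′ x ⟩
    s + suc m′ * (e + (s + e * m′) * x) ∎)
  where
  open ≡-Reasoning
  lem₁ : ∀ e n k y → e + n * (k * y) ≡ e + k * (y * n)
  lem₁ = solve-ℕ
  lem₂ : ∀ e s m x → e + (s + e * m) * suc (x * suc m) ≡ s + suc m * (e + (s + e * m) * x)
  lem₂ = solve-ℕ
... | GCD.Bézout.+- x y eq = k * y , k * x ∸ s , +-cancelʳ-≡ k _ _ (begin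
    e + n * (k * y) + k ≡⟨ lem₁ e n k y ⟩
    e + k * suc (y * n) ≡⟨ cong (λ a → e + k * a) eq ⟩
    e + k * (x * suc m′) ≡⟨ cong (λ a → e + a) (trans (sym (*-assoc k x (suc m′))) (cong (_* suc m′) (sym (m+[n∸m]≡n s≤kx)))) ⟩
    e + (s + (k * x ∸ s)) * suc m′ ≡⟨ lem₂ e s (k * x ∸ s) m′ ⟩
    s + suc m′ * (k * x ∸ s) + k ∎)
  where
  open ≡-Reasoning
  k = e + s * m′
  s≤kx : s ≤ k * x
  s≤kx = ≤-trans (≤-trans (≤-trans (m≤m*n s m′ {{ℕ.>-nonZero (ℕ.s≤s⁻¹ 1<m)}}) (m≤n+m (s * m′) e)) (≤-reflexive (sym (*-identityʳ k))))
    (*-monoʳ-≤ k (0<factorˡ {x} (subst (0 <_) eq (s≤s z≤n))))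
  lem₁ : ∀ e n k y → e + n * (k * y) + k ≡ e + k * suc (y * n)
  lem₁ = solve-ℕ
  lem₂ : ∀ e s a m → e + (s + a) * suc m ≡ s + suc m * a + (e + s * m)
  lem₂ = solve-ℕ

-- For o = 1 this is the numerator of the first multiple of 1/m strictly above 1/v₀.
offset : ℕ → ℕ → ℕ → ℕ
offset m v₀ zero = 0
offset m v₀ (suc _) = suc (m div v₀)

-- Up to the factor v, the floor is taken at y = (ρ/u₀ + s)/m, s the offset, which exceeds o/v₀ by
-- less than 2/m ≤ 1/v₀². For v ≤ v₀ the next jump of ⌊v y⌋ after 0 or 1/v₀ is at least 1/v₀² away,
-- so no jump intervenes.
residue-floor : ∀ {m u₀ v₀ ρ v} o → o ≤ 1 → ρ < u₀ → 0 < v₀ → v ≤ v₀ → 2 * v₀ * v₀ ≤ m →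
  (v * (ρ + offset m v₀ o * u₀)) div (u₀ * m) ≡ (v * o) div v₀
residue-floor {m} {u₀} {v₀} {ρ} {v} o o≤1 ρ<u₀ 0<v₀ v≤v₀ large = go o o≤1
  where
  open ≤-Reasoning
  v₀≤v₀² : v₀ ≤ v₀ * v₀
  v₀≤v₀² = m≤m*n v₀ v₀ {{ℕ.>-nonZero 0<v₀}}
  2v₀≤m : 2 * v₀ ≤ m
  2v₀≤m = ≤-trans (≤-trans (*-monoʳ-≤ 2 v₀≤v₀²) (≤-reflexive (sym (*-assoc 2 v₀ v₀)))) large
  v₀≤m : v₀ ≤ m
  v₀≤m = ≤-trans (m≤m+n v₀ (v₀ + 0)) 2v₀≤m
  0<m : 0 < m
  0<m = ≤-trans 0<v₀ v₀≤m
  0<u₀ : 0 < u₀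
  0<u₀ = ≤-<-trans z≤n ρ<u₀
  0<N : 0 < u₀ * m
  0<N = *-mono-≤ 0<u₀ 0<m
  q = m div v₀
  2v₀≤q : 2 * v₀ ≤ q
  2v₀≤q = ℕ.s≤s⁻¹ (*-cancelʳ-< v₀ (2 * v₀) (suc q) (≤-<-trans large (div-upper m 0<v₀)))
  v₀[q+2]≤ : v₀ * (2 + q) ≤ m + 2 * v₀
  v₀[q+2]≤ = begin
    v₀ * (2 + q) ≡⟨ lem v₀ q ⟩
    q * v₀ + 2 * v₀ ≤⟨ +-monoˡ-≤ (2 * v₀) (div-lower m 0<v₀) ⟩
    m + 2 * v₀ ∎
    where
    lem : ∀ v q → v * (2 + q) ≡ q * v + 2 * v
    lem = solve-ℕ
  below : ρ + suc q * u₀ < (2 + q) * u₀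
  below = +-monoˡ-< (suc q * u₀) ρ<u₀
  lem₀ : ∀ v a u → v * (a * u) ≡ u * (v * a)
  lem₀ = solve-ℕ
  go : ∀ o → o ≤ 1 → (v * (ρ + offset m v₀ o * u₀)) div (u₀ * m) ≡ (v * o) div v₀
  go zero _ = trans (div-unique {f = 0} 0<N z≤n (begin-strict
      v * (ρ + 0) ≡⟨ cong (v *_) (+-identityʳ ρ) ⟩
      v * ρ ≤⟨ *-monoˡ-≤ ρ (≤-trans v≤v₀ v₀≤m) ⟩
      m * ρ <⟨ *-monoʳ-< m {{ℕ.>-nonZero 0<m}} ρ<u₀ ⟩
      m * u₀ ≡⟨ trans (*-comm m u₀) (sym (*-identityˡ (u₀ * m))) ⟩
      1 * (u₀ * m) ∎))
    (sym (trans (cong (_div v₀) (*-zeroʳ v)) (div-unique {f = 0} 0<v₀ z≤n (subst (0 <_) (sym (*-identityˡ v₀)) 0<v₀))))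
  go (suc zero) _ with m≤n⇒m<n∨m≡n v≤v₀
  ... | inj₁ v<v₀ = trans (div-unique {f = 0} 0<N z≤n (begin-strict
      v * (ρ + suc q * u₀) ≤⟨ *-monoʳ-≤ v (<⇒≤ below) ⟩
      v * ((2 + q) * u₀) ≡⟨ lem₀ v (2 + q) u₀ ⟩
      u₀ * (v * (2 + q)) <⟨ *-monoʳ-< u₀ {{ℕ.>-nonZero 0<u₀}} v[q+2]<m ⟩
      u₀ * m ≡⟨ *-identityˡ (u₀ * m) ⟨
      1 * (u₀ * m) ∎))
    (sym (trans (cong (_div v₀) (*-identityʳ v)) (div-unique {f = 0} 0<v₀ z≤n (subst (v <_) (sym (*-identityˡ v₀)) v<v₀))))
    where
    v[q+2]<m : v * (2 + q) < m
    v[q+2]<m = +-cancelˡ-< (2 + q) _ _ (begin-strict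
      suc v * (2 + q) ≤⟨ *-monoˡ-≤ (2 + q) v<v₀ ⟩
      v₀ * (2 + q) ≤⟨ v₀[q+2]≤ ⟩
      m + 2 * v₀ ≡⟨ +-comm m (2 * v₀) ⟩
      2 * v₀ + m ≤⟨ +-monoˡ-≤ m 2v₀≤q ⟩
      q + m <⟨ +-monoˡ-< m (m≤n⇒m≤1+n (n<1+n q)) ⟩
      2 + q + m ∎)
  ... | inj₂ refl = trans (div-unique {f = 1} 0<N (begin
      1 * (u₀ * m) ≡⟨ *-identityˡ (u₀ * m) ⟩
      u₀ * m ≤⟨ *-monoʳ-≤ u₀ (<⇒≤ (div-upper m 0<v₀)) ⟩
      u₀ * (suc q * v) ≡⟨ lem u₀ q v ⟩
      v * (suc q * u₀) ≤⟨ *-monoʳ-≤ v (m≤n+m (suc q * u₀) ρ) ⟩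
      v * (ρ + suc q * u₀) ∎)
    (begin-strict
      v * (ρ + suc q * u₀) <⟨ *-monoʳ-< v {{ℕ.>-nonZero 0<v₀}} below ⟩
      v * ((2 + q) * u₀) ≡⟨ lem₀ v (2 + q) u₀ ⟩
      u₀ * (v * (2 + q)) ≤⟨ *-monoʳ-≤ u₀ (≤-trans v₀[q+2]≤ (+-monoʳ-≤ m 2v₀≤m)) ⟩
      u₀ * (m + m) ≡⟨ lem₂ u₀ m ⟩
      2 * (u₀ * m) ∎))
    (sym (trans (cong (_div v) (*-identityʳ v)) (div-unique {f = 1} 0<v₀ (≤-reflexive (*-identityˡ v)) (m<m+n v (subst (0 <_) (sym (+-identityʳ v)) 0<v₀)))))
    where
    lem : ∀ u q v → u * (suc q * v) ≡ v * (suc q * u)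
    lem = solve-ℕ
    lem₂ : ∀ u m → u * (m + m) ≡ 2 * (u * m)
    lem₂ = solve-ℕ
  go (suc (suc _)) (s≤s ())

record Largest (xs : List (Bool × ℕ)) : Set where
  field
    sign : Bool
    entry : ℕ
    member : (sign , entry) ∈ xs
    maximal : ∀ {s c} → (s , c) ∈ xs → c ≤ entry

largest : ∀ xs → 0 < length xs → Largest xs
largest ((s , c) ∷ []) _ = record { sign = s ; entry = c ; member = here refl ; maximal = λ { (here refl) → ≤-refl } }
largest ((s , c) ∷ xs@(_ ∷ _)) _ with largest xs (s≤s z≤n)
... | record { sign = t ; entry = d ; member = m ; maximal = max } with ≤-total c d
... | inj₁ c≤d = record { sign = t ; entry = d ; member = there m ; maximal = λ { (here refl) → c≤d ; (there m′) → max m′ } }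
... | inj₂ d≤c = record { sign = s ; entry = c ; member = here refl ; maximal = λ { (here refl) → ≤-refl ; (there m′) → ≤-trans (max m′) d≤c } }

same-sign-lin : ∀ s₀ xs (φ : ℕ → ℕ) → (∀ {s c} → (s , c) ∈ xs → φ c ≡ 0 ⊎ s ≡ s₀) →
  ∃[ k ] lin ⟦ xs ⟧ (λ c → ι (φ c)) ≡ weight s₀ ⊛ ι k × (∀ {s c} → (s , c) ∈ xs → φ c ≤ k)
same-sign-lin s₀ [] φ _ = 0 , sym (trans (cong (weight s₀ ⊛_) ι0) (ℚₚ.*-zeroʳ (weight s₀))) , λ ()
same-sign-lin s₀ ((s , c) ∷ xs) φ h with same-sign-lin s₀ xs φ (λ m → h (there m))
... | k , e , bound = φ c + k , value (h (here refl)) , λ { (here refl) → m≤m+n (φ c) k ; (there m) → ≤-trans (bound m) (m≤n+m k (φ c)) }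
  where
  open ≡-Reasoning
  value : φ c ≡ 0 ⊎ s ≡ s₀ → weight s ⊛ ι (φ c) ⊕ lin ⟦ xs ⟧ (λ c → ι (φ c)) ≡ weight s₀ ⊛ ι (φ c + k)
  value (inj₁ φc≡0) = begin
    weight s ⊛ ι (φ c) ⊕ lin ⟦ xs ⟧ (λ c → ι (φ c)) ≡⟨ cong₂ (λ a b → weight s ⊛ a ⊕ b) (trans (cong ι φc≡0) ι0) e ⟩
    weight s ⊛ 0ℚ ⊕ weight s₀ ⊛ ι k ≡⟨ trans (cong (_⊕ weight s₀ ⊛ ι k) (ℚₚ.*-zeroʳ (weight s))) (ℚₚ.+-identityˡ (weight s₀ ⊛ ι k)) ⟩
    weight s₀ ⊛ ι k ≡⟨ cong (λ a → weight s₀ ⊛ ι (a + k)) φc≡0 ⟨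
    weight s₀ ⊛ ι (φ c + k) ∎
  value (inj₂ refl) = trans (cong (weight s ⊛ ι (φ c) ⊕_) e) (trans (sym (ℚₚ.*-distribˡ-+ (weight s) (ι (φ c)) (ι k))) (cong (weight s ⊛_) (sym (ι-+ (φ c) k))))

-- At x = 1/c, for c the largest entry, only the entries equal to c contribute.
largest-step : ∀ {xs} → Good xs → (l : Largest xs) → ∃[ k ] step xs 1 (Largest.entry l) ≡ weight (Largest.sign l) ⊛ ι k × 1 ≤ k
largest-step {xs} good l = let (k , e , bound) = same-sign-lin sign xs (λ c → (c * 1) div entry) vanishing in k , e , subst (_≤ k) top (bound member)
  where
  open Largest l
  0<entry = positive good member
  vanishing : ∀ {s c} → (s , c) ∈ xs → (c * 1) div entry ≡ 0 ⊎ s ≡ sign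
  vanishing {s} {c} m with m≤n⇒m<n∨m≡n (maximal m)
  ... | inj₁ c<entry = inj₁ (div-unique {f = 0} 0<entry z≤n (subst₂ _<_ (sym (*-identityʳ c)) (sym (*-identityˡ entry)) c<entry))
  ... | inj₂ refl = inj₂ (consistent good m member)
  top : (entry * 1) div entry ≡ 1
  top = div-unique {f = 1} 0<entry (≤-reflexive (*-comm 1 entry)) (subst₂ _<_ (sym (*-identityʳ entry)) refl (m<m+n entry (subst (0 <_) (sym (+-identityʳ entry)) 0<entry)))

step-at-0 : ∀ xs {N} → 0 < N → step xs 0 N ≡ 0ℚ
step-at-0 xs {N} 0<N = trans (lin-cong ⟦ xs ⟧ (λ c → trans (cong ι (trans (cong (_div N) (*-zeroʳ c)) (div-unique {f = 0} 0<N z≤n (subst (0 <_) (sym (*-identityˡ N)) 0<N)))) ι0)) (lin-0 ⟦ xs ⟧)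

lin-cong-∈ : ∀ {xs φ χ} → (∀ {s c} → (s , c) ∈ xs → φ c ≡ χ c) → lin ⟦ xs ⟧ φ ≡ lin ⟦ xs ⟧ χ
lin-cong-∈ {φ = φ} {χ} h = lin-cong-All {φ = φ} {χ = χ} (Allₚ.map⁺ (All.tabulate (λ m → h m)))

-- It is enough that one of the two moduli is large. The summand 84 * U exceeds the possible
-- imbalance of `zs` measured in multipliers; the summand 2 * U * U gives 2 v₀² ≤ m, which
-- `residue-floor` requires.
module TwoClusters {U : ℕ} {xs ys zs : List (Bool × ℕ)} (good : Good xs) (landau-xs : Landau xs) (short : length xs ≤ 84)
  (p : xs ↭ ys ++ zs) (0<ys : 0 < length ys) (0<zs : 0 < length zs) (cl : Cluster U ys) (cl′ : Cluster U zs)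
  (coprime : Coprime (modulus cl) (modulus cl′)) (large : 84 * U + 2 * U * U < modulus cl) where

  private
    m = modulus cl
    n = modulus cl′
    good-p = Good-↭ p good
    good-ys = Good-++ˡ {ys} good-p
    good-zs = Good-++ʳ ys good-p
    ly = largest ys 0<ys
    lz = largest zs 0<zs
    c₀ = Largest.entry ly
    d₀ = Largest.entry lz
    u₀ = proj₁ (multiples cl (Largest.member ly))
    v₀ = proj₁ (multiples cl′ (Largest.member lz))
    c₀≡ : c₀ ≡ m * u₀
    c₀≡ = proj₁ (proj₂ (multiples cl (Largest.member ly)))
    d₀≡ : d₀ ≡ n * v₀
    d₀≡ = proj₁ (proj₂ (multiples cl′ (Largest.member lz)))
    0<mu₀ : 0 < m * u₀
    0<mu₀ = subst (0 <_) c₀≡ (positive good-ys (Largest.member ly))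
    0<nv₀ : 0 < n * v₀
    0<nv₀ = subst (0 <_) d₀≡ (positive good-zs (Largest.member lz))
    0<m = 0<factorˡ {m} 0<mu₀
    0<n = 0<factorˡ {n} 0<nv₀
    0<u₀ = 0<factorʳ {m} 0<mu₀
    0<v₀ = 0<factorʳ {n} 0<nv₀
    v₀≤U : v₀ ≤ U
    v₀≤U = proj₂ (proj₂ (multiples cl′ (Largest.member lz)))
    1<m : 1 < m
    1<m = ≤-<-trans (≤-trans (≤-trans 0<v₀ v₀≤U) (≤-trans (m≤m+n U (83 * U)) (m≤m+n (84 * U) (2 * U * U)))) large
    2v₀²≤m : 2 * v₀ * v₀ ≤ m
    2v₀²≤m = ≤-trans (*-mono-≤ (*-monoʳ-≤ 2 v₀≤U) v₀≤U) (≤-trans (m≤n+m (2 * U * U) (84 * U)) (<⇒≤ large))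

    sy = lin ⟦ ys ⟧ (λ c → ι (c div m))
    sz = lin ⟦ zs ⟧ (λ c → ι (c div n))

    div-multiple : ∀ k u → 0 < k → (k * u) div k ≡ u
    div-multiple k u 0<k = trans (+*-div 0 k u 0<k) (cong (_+ u) (div-unique {f = 0} 0<k z≤n (subst (0 <_) (sym (*-identityˡ k)) 0<k)))

    ι-multiple : ∀ {k c} → 0 < k → (∃[ u ] c ≡ k * u × u ≤ U) → ι c ≡ ι k ⊛ ι (c div k)
    ι-multiple {k} 0<k (u , refl , _) = trans (ι-* k u) (cong (λ a → ι k ⊛ ι a) (sym (div-multiple k u 0<k)))

    relation : ι m ⊛ sy ⊕ ι n ⊛ sz ≡ 0ℚ
    relation = begin
      ι m ⊛ sy ⊕ ι n ⊛ sz ≡⟨ cong₂ _⊕_ (lin-⊛ ⟦ ys ⟧ (ι m) _) (lin-⊛ ⟦ zs ⟧ (ι n) _) ⟨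
      lin ⟦ ys ⟧ (λ c → ι m ⊛ ι (c div m)) ⊕ lin ⟦ zs ⟧ (λ c → ι n ⊛ ι (c div n))
        ≡⟨ cong₂ _⊕_ (lin-cong-∈ (λ x∈ → ι-multiple 0<m (multiples cl x∈))) (lin-cong-∈ (λ x∈ → ι-multiple 0<n (multiples cl′ x∈))) ⟨
      lin ⟦ ys ⟧ ι ⊕ lin ⟦ zs ⟧ ι ≡⟨ lin-⟦++⟧ ys zs ι ⟨
      lin ⟦ ys ++ zs ⟧ ι ≡⟨ lin-↭ p ι ⟨
      lin ⟦ xs ⟧ ι ≡⟨ Landau.balanced landau-xs ⟩
      0ℚ ∎
      where open ≡-Reasoning

    zs≤84 : length zs ≤ 84
    zs≤84 = ≤-trans (subst (length zs ≤_) (sym (trans (Permₚ.↭-length p) (Listₚ.length-++ ys))) (m≤n+m (length zs) (length ys))) short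

    -- By `relation` and coprimality, m divides the integer `sz`, whose absolute value is at most 84
    -- * U and thus below m.
    sz≡0 : sz ≡ 0ℚ
    sz≡0 with integral-step ys (λ c → c div m) | integral-step zs (λ c → c div n)
    ... | y , ey | z , ez = trans ez (vanish z m∣z z-small)
      where
      eq : ℤ.+ m ℤ.* y ℤ.+ ℤ.+ n ℤ.* z ≡ ℤ.0ℤ
      eq = fromℤ-injective (trans (fromℤ-+ (ℤ.+ m ℤ.* y) (ℤ.+ n ℤ.* z)) (trans (cong₂ _⊕_ (trans (fromℤ-* (ℤ.+ m) y) (cong₂ _⊛_ (sym (ι≡# m)) (sym ey))) (trans (fromℤ-* (ℤ.+ n) z) (cong₂ _⊛_ (sym (ι≡# n)) (sym ez)))) relation))
      nz≡ : ℤ.+ n ℤ.* z ≡ ℤ.+ m ℤ.* ℤ.- y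
      nz≡ = trans (sym (ℤₚ.+-identityˡ _)) (trans (cong (ℤ._+ ℤ.+ n ℤ.* z) (sym (ℤₚ.+-inverseˡ (ℤ.+ m ℤ.* y))))
        (trans (ℤₚ.+-assoc (ℤ.- (ℤ.+ m ℤ.* y)) (ℤ.+ m ℤ.* y) (ℤ.+ n ℤ.* z)) (trans (cong (λ a → ℤ.- (ℤ.+ m ℤ.* y) ℤ.+ a) eq) (trans (ℤₚ.+-identityʳ _) (ℤₚ.neg-distribʳ-* (ℤ.+ m) y)))))
      m∣z : m ∣ ℤ.∣ z ∣
      m∣z = coprime-divisor coprime (subst (m ∣_) (trans (sym (ℤₚ.abs-* (ℤ.+ m) (ℤ.- y))) (trans (cong ℤ.∣_∣ (sym nz≡)) (ℤₚ.abs-* (ℤ.+ n) z))) (Div.m∣m*n ℤ.∣ ℤ.- y ∣))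
      bounds : (⊝ (ι (length zs) ⊛ ι U) ≼ sz) × (sz ≼ ι (length zs) ⊛ ι U)
      bounds = lin-bound {zs} {λ c → ι (c div n)} (All.tabulate (λ {x} x∈ → entry (multiples cl′ x∈)))
        where
        entry : ∀ {c} → (∃[ u ] c ≡ n * u × u ≤ U) → (⊝ ι U ≼ ι (c div n)) × (ι (c div n) ≼ ι U)
        entry (u , refl , u≤U) rewrite div-multiple n u 0<n = ℚₚ.≤-trans (ℚₚ.neg-antimono-≤ (ι-nonneg U)) (ι-nonneg u) , ι-mono-≤ u≤U
      z-small : ℤ.∣ z ∣ < m
      z-small = ≤-<-trans (≤-trans (abs-bound z (subst₂ _≼_ (cong ⊝_ (trans (sym (ι-* (length zs) U)) (ι≡# _))) ez (proj₁ bounds)) (subst₂ _≼_ ez (trans (sym (ι-* (length zs) U)) (ι≡# _)) (proj₂ bounds))) (≤-trans (*-monoˡ-≤ U zs≤84) (m≤m+n (84 * U) (2 * U * U)))) large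
        where
        abs-bound : ∀ {b} z → ⊝ # b ≼ fromℤ z → fromℤ z ≼ # b → ℤ.∣ z ∣ ≤ b
        abs-bound (ℤ.+ a) _ hi = ℤₚ.drop‿+≤+ (fromℤ-cancel-≤ hi)
        abs-bound {b} ℤ.-[1+ a ] lo _ = ℤₚ.drop‿+≤+ (ℤₚ.neg-cancel-≤ {ℤ.+ b} {ℤ.+ suc a} (fromℤ-cancel-≤ (subst (_≼ fromℤ ℤ.-[1+ a ]) (sym (fromℤ-neg (ℤ.+ b))) lo)))
      vanish : ∀ z → m ∣ ℤ.∣ z ∣ → ℤ.∣ z ∣ < m → fromℤ z ≡ 0ℚ
      vanish (ℤ.+ zero) _ _ = refl
      vanish (ℤ.+ suc a) d small = contradiction d (Div.>⇒∤ small)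
      vanish ℤ.-[1+ a ] d small = contradiction d (Div.>⇒∤ small)

    sy≡0 : sy ≡ 0ℚ
    sy≡0 = cancel-*-≡ m 0<m (trans (trans (lem (ι m ⊛ sy) (ι n)) (trans (cong (λ a → ι m ⊛ sy ⊕ ι n ⊛ a) (sym sz≡0)) relation)) (sym (ℚₚ.*-zeroʳ (ι m))))
      where
      lem : ∀ a n → a ≡ a ⊕ n ⊛ 0ℚ
      lem = solve-∀ ring

  -- Since m and n are coprime, j can be chosen to place n x modulo 1 in any prescribed interval of length 1/m, independently of m x.
  evaluation : ∀ o o′ → o ≤ 1 → o′ ≤ 1 → ∃[ A ] step xs A (u₀ * m) ≡ step ys o c₀ ⊕ step zs o′ d₀
  evaluation o o′ o≤1 o′≤1 = A , (begin
      step xs A (u₀ * m) ≡⟨ lin-↭ p _ ⟩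
      step (ys ++ zs) A (u₀ * m) ≡⟨ lin-⟦++⟧ ys zs _ ⟩
      step ys A (u₀ * m) ⊕ step zs A (u₀ * m) ≡⟨ cong₂ _⊕_ on-ys on-zs ⟩
      step ys o c₀ ⊕ step zs o′ d₀ ∎)
    where
    open ≡-Reasoning
    s = offset m v₀ o′
    ρ = (n * o) mod u₀
    e = (n * o) div u₀
    solution = congruence-solution 1<m coprime e s
    j = proj₁ solution
    q = proj₁ (proj₂ solution)
    -- With x = A/(u₀ m) one has m x = o/u₀ + j, so `ys` sees the point o/c₀ whatever j is, and j is
    -- free to steer n x. The integer translations j and q contribute only multiples of `sy` and
    -- `sz`, which vanish.
    A = o + u₀ * j
    nA : n * A ≡ (ρ + s * u₀) + (u₀ * m) * q
    nA = begin
      n * (o + u₀ * j) ≡⟨ lem₁ n o u₀ j ⟩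
      n * o + u₀ * (n * j) ≡⟨ cong (_+ u₀ * (n * j)) (mod-div (n * o) 0<u₀) ⟩
      ρ + u₀ * e + u₀ * (n * j) ≡⟨ lem₂ ρ u₀ e (n * j) ⟩
      ρ + u₀ * (e + n * j) ≡⟨ cong (λ a → ρ + u₀ * a) (proj₂ (proj₂ solution)) ⟩
      ρ + u₀ * (s + m * q) ≡⟨ lem₃ ρ u₀ s m q ⟩
      (ρ + s * u₀) + (u₀ * m) * q ∎
      where
      lem₁ : ∀ n o u j → n * (o + u * j) ≡ n * o + u * (n * j)
      lem₁ = solve-ℕ
      lem₂ : ∀ r u e a → r + u * e + u * a ≡ r + u * (e + a)
      lem₂ = solve-ℕ
      lem₃ : ∀ r u s m q → r + u * (s + m * q) ≡ (r + s * u) + (u * m) * q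
      lem₃ = solve-ℕ
    entry-ys : ∀ {c} → (∃[ u ] c ≡ m * u × u ≤ U) → (c * A) div (u₀ * m) ≡ (c * o) div c₀ + j * (c div m)
    entry-ys (u , refl , _) = begin
      (m * u * A) div (u₀ * m) ≡⟨ cong₂ _div_ (lem₁ m u o u₀ j) (*-comm u₀ m) ⟩
      (m * (u * o + u₀ * (j * u))) div (m * u₀) ≡⟨ div-*ˡ (u * o + u₀ * (j * u)) u₀ 0<m ⟩
      (u * o + u₀ * (j * u)) div u₀ ≡⟨ +*-div (u * o) u₀ (j * u) 0<u₀ ⟩
      (u * o) div u₀ + j * u ≡⟨ cong₂ _+_ (trans (sym (div-*ˡ (u * o) u₀ 0<m)) (cong₂ _div_ (sym (*-assoc m u o)) (sym c₀≡))) (cong (j *_) (sym (div-multiple m u 0<m))) ⟩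
      (m * u * o) div c₀ + j * ((m * u) div m) ∎
      where
      lem₁ : ∀ m u o u₀ j → m * u * (o + u₀ * j) ≡ m * (u * o + u₀ * (j * u))
      lem₁ = solve-ℕ
    v≤v₀ : ∀ {v} → n * v ≤ d₀ → v ≤ v₀
    v≤v₀ {v} le = *-cancelˡ-≤ {v} {v₀} n {{ℕ.>-nonZero 0<n}} (subst (n * v ≤_) d₀≡ le)
    entry-zs : ∀ {c} → (∃[ u ] c ≡ n * u × u ≤ U) → c ≤ d₀ → (c * A) div (u₀ * m) ≡ (c * o′) div d₀ + q * (c div n)
    entry-zs (v , refl , _) le = begin
      (n * v * A) div (u₀ * m) ≡⟨ cong (_div (u₀ * m)) (trans (lem₁ n v A) (trans (cong (v *_) nA) (lem₂ v (ρ + s * u₀) (u₀ * m) q))) ⟩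
      (v * (ρ + s * u₀) + (u₀ * m) * (q * v)) div (u₀ * m) ≡⟨ +*-div (v * (ρ + s * u₀)) (u₀ * m) (q * v) (*-mono-≤ 0<u₀ 0<m) ⟩
      (v * (ρ + s * u₀)) div (u₀ * m) + q * v ≡⟨ cong (_+ q * v) (residue-floor o′ o′≤1 (mod<n (n * o) 0<u₀) 0<v₀ (v≤v₀ le) 2v₀²≤m) ⟩
      (v * o′) div v₀ + q * v ≡⟨ cong₂ _+_ (trans (sym (div-*ˡ (v * o′) v₀ 0<n)) (cong₂ _div_ (sym (*-assoc n v o′)) (sym d₀≡))) (cong (q *_) (sym (div-multiple n v 0<n))) ⟩
      (n * v * o′) div d₀ + q * ((n * v) div n) ∎
      where
      lem₁ : ∀ n v A → n * v * A ≡ v * (n * A)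
      lem₁ = solve-ℕ
      lem₂ : ∀ v a N q → v * (a + N * q) ≡ v * a + N * (q * v)
      lem₂ = solve-ℕ
    ι-sum : ∀ a j b → ι (a + j * b) ≡ ι a ⊕ ι j ⊛ ι b
    ι-sum a j b = trans (ι-+ a (j * b)) (cong (ι a ⊕_) (ι-* j b))
    on-ys : step ys A (u₀ * m) ≡ step ys o c₀
    on-ys = begin
      step ys A (u₀ * m) ≡⟨ lin-cong-∈ (λ {_} {c} x∈ → trans (cong ι (entry-ys (multiples cl x∈))) (ι-sum ((c * o) div c₀) j (c div m))) ⟩
      lin ⟦ ys ⟧ (λ c → ι ((c * o) div c₀) ⊕ ι j ⊛ ι (c div m)) ≡⟨ trans (lin-⊕ ⟦ ys ⟧ _ _) (cong (step ys o c₀ ⊕_) (lin-⊛ ⟦ ys ⟧ (ι j) _)) ⟩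
      step ys o c₀ ⊕ ι j ⊛ sy ≡⟨ trans (cong (λ a → step ys o c₀ ⊕ ι j ⊛ a) sy≡0) (lem (step ys o c₀) (ι j)) ⟩
      step ys o c₀ ∎
      where
      lem : ∀ a j → a ⊕ j ⊛ 0ℚ ≡ a
      lem = solve-∀ ring
    on-zs : step zs A (u₀ * m) ≡ step zs o′ d₀
    on-zs = begin
      step zs A (u₀ * m) ≡⟨ lin-cong-∈ (λ {_} {c} x∈ → trans (cong ι (entry-zs (multiples cl′ x∈) (Largest.maximal lz x∈))) (ι-sum ((c * o′) div d₀) q (c div n))) ⟩
      lin ⟦ zs ⟧ (λ c → ι ((c * o′) div d₀) ⊕ ι q ⊛ ι (c div n)) ≡⟨ trans (lin-⊕ ⟦ zs ⟧ _ _) (cong (step zs o′ d₀ ⊕_) (lin-⊛ ⟦ zs ⟧ (ι q) _)) ⟩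
      step zs o′ d₀ ⊕ ι q ⊛ sz ≡⟨ trans (cong (λ a → step zs o′ d₀ ⊕ ι q ⊛ a) sz≡0) (lem (step zs o′ d₀) (ι q)) ⟩
      step zs o′ d₀ ∎
      where
      lem : ∀ a j → a ⊕ j ⊛ 0ℚ ≡ a
      lem = solve-∀ ring

  private
    0<N : 0 < u₀ * m
    0<N = *-mono-≤ 0<u₀ 0<m

    ≥1 : ∀ {v s k} → v ≡ weight s ⊛ ι k → 1 ≤ k → 0ℚ ≼ v → 1ℚ ≼ v
    ≥1 {s = true} {k} refl 1≤k _ = subst (1ℚ ≼_) (sym (ℚₚ.*-identityˡ (ι k))) (1≼ι 1≤k)
    ≥1 {s = false} {k} refl 1≤k 0≼ = contradiction (ℚₚ.≤-trans (subst (_≼ ι k) refl (1≼ι 1≤k)) (≤-by (⊝ 1ℚ ⊛ ι k) 0≼ (lem (ι k)))) (from-no (1ℚ ℚₚ.≤? 0ℚ))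
      where
      lem : ∀ x → 0ℚ ≡ x ⊕ ⊝ 1ℚ ⊛ x
      lem = solve-∀ ring

    -- Taking o′ = 0 silences `zs`. The value on `ys` alone is then nonnegative, so its largest
    -- entry carries the positive sign and contributes at least 1.
    step-ys≥1 : 1ℚ ≼ step ys 1 c₀
    step-ys≥1 = let (k , e , 1≤k) = largest-step good-ys ly
                    (A , eq) = evaluation 1 0 ≤-refl z≤n
                in ≥1 {s = Largest.sign ly} e 1≤k (subst (0ℚ ≼_) (trans eq (trans (cong (step ys 1 c₀ ⊕_) (step-at-0 zs (positive good-zs (Largest.member lz)))) (ℚₚ.+-identityʳ (step ys 1 c₀)))) (Landau.step≥0 landau-xs A (u₀ * m) 0<N))

    step-zs≥1 : 1ℚ ≼ step zs 1 d₀
    step-zs≥1 = let (k , e , 1≤k) = largest-step good-zs lz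
                    (A , eq) = evaluation 0 1 z≤n ≤-refl
                in ≥1 {s = Largest.sign lz} e 1≤k (subst (0ℚ ≼_) (trans eq (trans (cong (_⊕ step zs 1 d₀) (step-at-0 ys (positive good-ys (Largest.member ly)))) (ℚₚ.+-identityˡ (step zs 1 d₀)))) (Landau.step≥0 landau-xs A (u₀ * m) 0<N))

  absurd : ⊥
  absurd = let (A , eq) = evaluation 1 1 ≤-refl ≤-refl in
    from-no (# 2 ℚₚ.≤? 1ℚ) (ℚₚ.≤-trans (ℚₚ.+-mono-≤ step-ys≥1 step-zs≥1) (subst (_≼ 1ℚ) eq (Landau.step≤1 landau-xs A (u₀ * m) 0<N)))

-- The three families

plus minus : List (Bool × ℕ) → List ℕ
plus [] = []
plus ((true , c) ∷ xs) = c ∷ plus xs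
plus ((false , c) ∷ xs) = plus xs
minus [] = []
minus ((true , c) ∷ xs) = minus xs
minus ((false , c) ∷ xs) = c ∷ minus xs

plus-↭ : ∀ {xs ys} → xs ↭ ys → plus xs ↭ plus ys
plus-↭ Perm.refl = ↭-refl
plus-↭ (prep (true , c) p) = prep c (plus-↭ p)
plus-↭ (prep (false , c) p) = plus-↭ p
plus-↭ (swap (true , c) (true , d) p) = swap c d (plus-↭ p)
plus-↭ (swap (true , c) (false , d) p) = prep c (plus-↭ p)
plus-↭ (swap (false , c) (true , d) p) = prep d (plus-↭ p)
plus-↭ (swap (false , c) (false , d) p) = plus-↭ p
plus-↭ (Perm.trans p q) = ↭-trans (plus-↭ p) (plus-↭ q)

minus-↭ : ∀ {xs ys} → xs ↭ ys → minus xs ↭ minus ys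
minus-↭ Perm.refl = ↭-refl
minus-↭ (prep (true , c) p) = minus-↭ p
minus-↭ (prep (false , c) p) = prep c (minus-↭ p)
minus-↭ (swap (true , c) (true , d) p) = minus-↭ p
minus-↭ (swap (true , c) (false , d) p) = prep d (minus-↭ p)
minus-↭ (swap (false , c) (true , d) p) = prep c (minus-↭ p)
minus-↭ (swap (false , c) (false , d) p) = swap c d (minus-↭ p)
minus-↭ (Perm.trans p q) = ↭-trans (minus-↭ p) (minus-↭ q)

plus-signed : ∀ as bs → plus (signed as bs) ≡ as
plus-signed (a ∷ as) bs = cong (a ∷_) (plus-signed as bs)
plus-signed [] [] = refl
plus-signed [] (b ∷ bs) = plus-signed [] bs

minus-signed : ∀ as bs → minus (signed as bs) ≡ bs
minus-signed (a ∷ as) bs = minus-signed as bs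
minus-signed [] [] = refl
minus-signed [] (b ∷ bs) = cong (b ∷_) (minus-signed [] bs)

∈-plus : ∀ {xs c} → (true , c) ∈ xs → c ∈ plus xs
∈-plus {(true , _) ∷ _} (here refl) = here refl
∈-plus {(true , _) ∷ _} (there m) = there (∈-plus m)
∈-plus {(false , _) ∷ _} (there m) = ∈-plus m

∈-minus : ∀ {xs c} → (false , c) ∈ xs → c ∈ minus xs
∈-minus {(false , _) ∷ _} (here refl) = here refl
∈-minus {(false , _) ∷ _} (there m) = there (∈-minus m)
∈-minus {(true , _) ∷ _} (there m) = ∈-minus m

Primitive : List (Bool × ℕ) → Set
Primitive xs = ∀ k → (∀ {s c} → (s , c) ∈ xs → k ∣ c) → k ≡ 1

data Block : Set where
  single pair : Bool → ℕ → Block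

entries : Block → List (Bool × ℕ)
entries (single s c) = (s , c) ∷ []
entries (pair s c) = (s , c) ∷ (not s , 2 * c) ∷ []

minimal-block : ∀ {xs} → Minimal xs → ∃[ b ] xs ↭ entries b
minimal-block (single s c) = single s c , ↭-refl
minimal-block (pair s c) = pair s c , ↭-refl
minimal-block (pair′ s c) = pair s c , swap _ _ ↭-refl

block-height : Block → ℤ
block-height (single true c) = ℤ.1ℤ
block-height (single false c) = ℤ.-1ℤ
block-height (pair s c) = ℤ.0ℤ

block-height-lin : ∀ b → lin ⟦ entries b ⟧ (λ _ → 1ℚ) ≡ fromℤ (block-height b)
block-height-lin (single true c) = refl
block-height-lin (single false c) = refl
block-height-lin (pair true c) = refl
block-height-lin (pair false c) = refl

record Admitted (xs : List (Bool × ℕ)) : Set where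
  field
    good : Good xs
    coprime-entries : Primitive xs
    balanced : lin ⟦ xs ⟧ ι ≡ 0ℚ
    height-one : lin ⟦ xs ⟧ (λ _ → 1ℚ) ≡ ⊝ 1ℚ

Family : List (Bool × ℕ) → Set
Family xs = InFamily (plus xs) (minus xs)

Admitted-↭ : ∀ {xs ys} → xs ↭ ys → Admitted xs → Admitted ys
Admitted-↭ p a = record
  { good = Good-↭ p good
  ; coprime-entries = λ k h → coprime-entries k (λ m → h (Permₚ.∈-resp-↭ p m))
  ; balanced = trans (sym (lin-↭ p ι)) balanced
  ; height-one = trans (sym (lin-↭ p _)) height-one
  }
  where open Admitted a

InFamily-↭ : ∀ {as as′ bs bs′} → as ↭ as′ → bs ↭ bs′ → InFamily as′ bs′ → InFamily as bs
InFamily-↭ p q (a , b , 0<a , 0<b , cop , inj₁ (r , s)) = a , b , 0<a , 0<b , cop , inj₁ (↭-trans p r , ↭-trans q s)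
InFamily-↭ p q (a , b , 0<a , 0<b , cop , inj₂ (inj₁ (r , s))) = a , b , 0<a , 0<b , cop , inj₂ (inj₁ (↭-trans p r , ↭-trans q s))
InFamily-↭ p q (a , b , 0<a , 0<b , cop , inj₂ (inj₂ (b<a , r , s))) = a , b , 0<a , 0<b , cop , inj₂ (inj₂ (b<a , ↭-trans p r , ↭-trans q s))

Family-↭ : ∀ {xs ys} → xs ↭ ys → Family ys → Family xs
Family-↭ p = InFamily-↭ (plus-↭ p) (minus-↭ p)

ι-injective : ∀ {m n} → ι m ≡ ι n → m ≡ n
ι-injective e = ≤-antisym (ι-cancel-≤ (ℚₚ.≤-reflexive e)) (ι-cancel-≤ (ℚₚ.≤-reflexive (sym e)))

ι-double : ∀ c → ι (2 * c) ≡ ι c ⊕ ι c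
ι-double c = trans (cong (λ k → ι (c + k)) (+-identityʳ c)) (ι-+ c c)

three-singles : ∀ {c d e} → Admitted ((true , c) ∷ (false , d) ∷ (false , e) ∷ []) → Family ((true , c) ∷ (false , d) ∷ (false , e) ∷ [])
three-singles {c} {d} {e} a = d , e , positive good (there (here refl)) , positive good (there (there (here refl))) , coprime ,
  inj₁ (subst (λ k → k ∷ [] ↭ (d + e) ∷ []) (sym c≡) ↭-refl , ↭-refl)
  where
  open Admitted a
  lem : ∀ c d e → c ≡ 1ℚ ⊛ c ⊕ (⊝ 1ℚ ⊛ d ⊕ (⊝ 1ℚ ⊛ e ⊕ 0ℚ)) ⊕ (d ⊕ e)
  lem = solve-∀ ring
  c≡ : c ≡ d + e
  c≡ = ι-injective (trans (lem (ι c) (ι d) (ι e)) (trans (cong (_⊕ (ι d ⊕ ι e)) balanced) (trans (ℚₚ.+-identityˡ (ι d ⊕ ι e)) (sym (ι-+ d e)))))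
  coprime : Coprime d e
  coprime {k} (k∣d , k∣e) = coprime-entries k λ
    { (here refl) → subst (k ∣_) (sym c≡) (Div.∣m∣n⇒∣m+n k∣d k∣e)
    ; (there (here refl)) → k∣d
    ; (there (there (here refl))) → k∣e }

-- A pair with first entry c adds c to the balance if that entry is negative and -c if it is
-- positive. Hence e = c + d gives the second family, e = ±(c - d) the third, and two positive signs
-- would make e + c + d zero.
two-pairs : ∀ {e c d} s t → Admitted (entries (single false e) ++ entries (pair s c) ++ entries (pair t d)) →
  Family (entries (single false e) ++ entries (pair s c) ++ entries (pair t d))
two-pairs {e} {c} {d} false false a = c , d , positive good (there (here refl)) , positive good (there (there (there (here refl)))) , coprime ,
  inj₂ (inj₁ (↭-refl , subst (λ k → k ∷ c ∷ d ∷ [] ↭ c ∷ d ∷ c + d ∷ []) (sym e≡) (Permₚ.∷↭∷ʳ (c + d) (c ∷ d ∷ []))))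
  where
  open Admitted a
  lem : ∀ e c d → e ≡ (c ⊕ d) ⊖ (⊝ 1ℚ ⊛ e ⊕ (⊝ 1ℚ ⊛ c ⊕ (1ℚ ⊛ (c ⊕ c) ⊕ (⊝ 1ℚ ⊛ d ⊕ (1ℚ ⊛ (d ⊕ d) ⊕ 0ℚ)))))
  lem = solve-∀ ring
  lem₂ : ∀ x → x ⊖ 0ℚ ≡ x
  lem₂ = solve-∀ ring
  e≡ : e ≡ c + d
  e≡ = ι-injective (trans (lem (ι e) (ι c) (ι d)) (trans (cong ((ι c ⊕ ι d) ⊖_) (trans (cong₂ (λ x y → ⊝ 1ℚ ⊛ ι e ⊕ (⊝ 1ℚ ⊛ ι c ⊕ (1ℚ ⊛ x ⊕ (⊝ 1ℚ ⊛ ι d ⊕ (1ℚ ⊛ y ⊕ 0ℚ))))) (sym (ι-double c)) (sym (ι-double d))) balanced))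
    (trans (lem₂ (ι c ⊕ ι d)) (sym (ι-+ c d)))))
  coprime : Coprime c d
  coprime {k} (k∣c , k∣d) = coprime-entries k λ
    { (here refl) → subst (k ∣_) (sym e≡) (Div.∣m∣n⇒∣m+n k∣c k∣d)
    ; (there (here refl)) → k∣c
    ; (there (there (here refl))) → Div.∣-trans k∣c (Div.n∣m*n 2)
    ; (there (there (there (here refl)))) → k∣d
    ; (there (there (there (there (here refl))))) → Div.∣-trans k∣d (Div.n∣m*n 2) }
two-pairs {e} {c} {d} false true a = c , d , positive good (there (here refl)) , positive good (there (there (there (here refl)))) , coprime ,
  inj₂ (inj₂ (d<c , ↭-refl , subst (λ k → k ∷ c ∷ 2 * d ∷ [] ↭ c ∷ 2 * d ∷ c ∸ d ∷ []) c∸d≡e (Permₚ.∷↭∷ʳ (c ∸ d) (c ∷ 2 * d ∷ []))))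
  where
  open Admitted a
  lem : ∀ e c d → c ≡ (d ⊕ e) ⊕ (⊝ 1ℚ ⊛ e ⊕ (⊝ 1ℚ ⊛ c ⊕ (1ℚ ⊛ (c ⊕ c) ⊕ (1ℚ ⊛ d ⊕ (⊝ 1ℚ ⊛ (d ⊕ d) ⊕ 0ℚ)))))
  lem = solve-∀ ring
  c≡ : c ≡ d + e
  c≡ = ι-injective (trans (lem (ι e) (ι c) (ι d)) (trans (cong ((ι d ⊕ ι e) ⊕_) (trans (cong₂ (λ x y → ⊝ 1ℚ ⊛ ι e ⊕ (⊝ 1ℚ ⊛ ι c ⊕ (1ℚ ⊛ x ⊕ (1ℚ ⊛ ι d ⊕ (⊝ 1ℚ ⊛ y ⊕ 0ℚ))))) (sym (ι-double c)) (sym (ι-double d))) balanced))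
    (trans (ℚₚ.+-identityʳ (ι d ⊕ ι e)) (sym (ι-+ d e)))))
  c∸d≡e : c ∸ d ≡ e
  c∸d≡e = trans (cong (_∸ d) c≡) (m+n∸m≡n d e)
  d<c : d < c
  d<c = subst (d <_) (sym c≡) (m<m+n d (positive good (here refl)))
  coprime : Coprime c d
  coprime {k} (k∣c , k∣d) = coprime-entries k λ
    { (here refl) → Div.∣m+n∣m⇒∣n (subst (k ∣_) c≡ k∣c) k∣d
    ; (there (here refl)) → k∣c
    ; (there (there (here refl))) → Div.∣-trans k∣c (Div.n∣m*n 2)
    ; (there (there (there (here refl)))) → k∣d
    ; (there (there (there (there (here refl))))) → Div.∣-trans k∣d (Div.n∣m*n 2) }
two-pairs {e} {c} {d} true false a = Family-↭ q (two-pairs false true (Admitted-↭ q a))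
  where
  q : entries (single false e) ++ entries (pair true c) ++ entries (pair false d) ↭ entries (single false e) ++ entries (pair false d) ++ entries (pair true c)
  q = prep _ (Permₚ.++-comm (entries (pair true c)) (entries (pair false d)))
two-pairs {e} {c} {d} true true a = contradiction (positive good (here refl)) (λ 0<e → <⇒≢ (≤-trans 0<e (m≤m+n e (c + d))) (sym sum≡0))
  where
  open Admitted a
  lem : ∀ e c d → e ⊕ (c ⊕ d) ≡ 0ℚ ⊖ (⊝ 1ℚ ⊛ e ⊕ (1ℚ ⊛ c ⊕ (⊝ 1ℚ ⊛ (c ⊕ c) ⊕ (1ℚ ⊛ d ⊕ (⊝ 1ℚ ⊛ (d ⊕ d) ⊕ 0ℚ)))))
  lem = solve-∀ ring
  sum≡0 : e + (c + d) ≡ 0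
  sum≡0 = ι-injective (trans (trans (ι-+ e (c + d)) (cong (ι e ⊕_) (ι-+ c d))) (trans (lem (ι e) (ι c) (ι d)) (trans (cong (0ℚ ⊖_) (trans (cong₂ (λ x y → ⊝ 1ℚ ⊛ ι e ⊕ (1ℚ ⊛ ι c ⊕ (⊝ 1ℚ ⊛ x ⊕ (1ℚ ⊛ ι d ⊕ (⊝ 1ℚ ⊛ y ⊕ 0ℚ))))) (sym (ι-double c)) (sym (ι-double d))) balanced)) (sym ι0))))

-- The heights 1, -1, 0 of the blocks must add up to -1. This leaves one positive and two negative
-- singles, or one negative single with two pairs.
three-blocks : ∀ b₁ b₂ b₃ → Admitted (entries b₁ ++ entries b₂ ++ entries b₃) → Family (entries b₁ ++ entries b₂ ++ entries b₃)
three-blocks b₁ b₂ b₃ a = go b₁ b₂ b₃ heights a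
  where
  open ≡-Reasoning
  heights : block-height b₁ ℤ.+ (block-height b₂ ℤ.+ block-height b₃) ≡ ℤ.-1ℤ
  heights = fromℤ-injective (begin
    fromℤ (block-height b₁ ℤ.+ (block-height b₂ ℤ.+ block-height b₃)) ≡⟨ fromℤ-+ (block-height b₁) (block-height b₂ ℤ.+ block-height b₃) ⟩
    fromℤ (block-height b₁) ⊕ fromℤ (block-height b₂ ℤ.+ block-height b₃) ≡⟨ cong (fromℤ (block-height b₁) ⊕_) (fromℤ-+ (block-height b₂) (block-height b₃)) ⟩
    fromℤ (block-height b₁) ⊕ (fromℤ (block-height b₂) ⊕ fromℤ (block-height b₃))
      ≡⟨ cong₂ _⊕_ (block-height-lin b₁) (cong₂ _⊕_ (block-height-lin b₂) (block-height-lin b₃)) ⟨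
    lin ⟦ entries b₁ ⟧ (λ _ → 1ℚ) ⊕ (lin ⟦ entries b₂ ⟧ (λ _ → 1ℚ) ⊕ lin ⟦ entries b₃ ⟧ (λ _ → 1ℚ))
      ≡⟨ trans (lin-⟦++⟧ (entries b₁) _ _) (cong (lin ⟦ entries b₁ ⟧ (λ _ → 1ℚ) ⊕_) (lin-⟦++⟧ (entries b₂) _ _)) ⟨
    lin ⟦ entries b₁ ++ entries b₂ ++ entries b₃ ⟧ (λ _ → 1ℚ) ≡⟨ Admitted.height-one a ⟩
    ⊝ 1ℚ ∎)
  exchange : ∀ b₁ b₂ b₃ → entries b₁ ++ entries b₂ ++ entries b₃ ↭ entries b₂ ++ entries b₁ ++ entries b₃
  exchange b₁ b₂ b₃ = Permₚ.shifts (entries b₁) (entries b₂)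
  rotate : ∀ b₁ b₂ b₃ → entries b₁ ++ entries b₂ ++ entries b₃ ↭ entries b₃ ++ entries b₁ ++ entries b₂
  rotate b₁ b₂ b₃ = ↭-trans (Permₚ.++⁺ˡ (entries b₁) (Permₚ.++-comm (entries b₂) (entries b₃))) (exchange b₁ b₃ b₂)
  go : ∀ b₁ b₂ b₃ → block-height b₁ ℤ.+ (block-height b₂ ℤ.+ block-height b₃) ≡ ℤ.-1ℤ →
    Admitted (entries b₁ ++ entries b₂ ++ entries b₃) → Family (entries b₁ ++ entries b₂ ++ entries b₃)
  go (single true c) (single false d) (single false e) _ a = three-singles a
  go b₁@(single false _) b₂@(single true _) b₃@(single false _) _ a = Family-↭ (exchange b₁ b₂ b₃) (three-singles (Admitted-↭ (exchange b₁ b₂ b₃) a))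
  go b₁@(single false _) b₂@(single false _) b₃@(single true _) _ a = Family-↭ (rotate b₁ b₂ b₃) (three-singles (Admitted-↭ (rotate b₁ b₂ b₃) a))
  go (single false e) (pair s c) (pair t d) _ a = two-pairs s t a
  go b₁@(pair s _) b₂@(single false _) b₃@(pair t _) _ a = Family-↭ (exchange b₁ b₂ b₃) (two-pairs s t (Admitted-↭ (exchange b₁ b₂ b₃) a))
  go b₁@(pair s _) b₂@(pair t _) b₃@(single false _) _ a = Family-↭ (rotate b₁ b₂ b₃) (two-pairs s t (Admitted-↭ (rotate b₁ b₂ b₃) a))
  go (single true _) (single true _) (single true _) ()
  go (single true _) (single true _) (single false _) ()
  go (single true _) (single true _) (pair _ _) ()
  go (single true _) (single false _) (single true _) ()
  go (single true _) (single false _) (pair _ _) ()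
  go (single true _) (pair _ _) (single true _) ()
  go (single true _) (pair _ _) (single false _) ()
  go (single true _) (pair _ _) (pair _ _) ()
  go (single false _) (single true _) (single true _) ()
  go (single false _) (single true _) (pair _ _) ()
  go (single false _) (single false _) (single false _) ()
  go (single false _) (single false _) (pair _ _) ()
  go (single false _) (pair _ _) (single true _) ()
  go (single false _) (pair _ _) (single false _) ()
  go (pair _ _) (single true _) (single true _) ()
  go (pair _ _) (single true _) (single false _) ()
  go (pair _ _) (single true _) (pair _ _) ()
  go (pair _ _) (single false _) (single true _) ()
  go (pair _ _) (single false _) (single false _) ()
  go (pair _ _) (pair _ _) (single true _) ()
  go (pair _ _) (pair _ _) (pair _ _) ()

three-minimal : ∀ {xs ys zs ws} → Admitted xs → xs ↭ ys ++ zs ++ ws → Minimal ys → Minimal zs → Minimal ws → Family xs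
three-minimal a p min₁ min₂ min₃ with minimal-block min₁ | minimal-block min₂ | minimal-block min₃
... | b₁ , p₁ | b₂ , p₂ | b₃ , p₃ = Family-↭ q (three-blocks b₁ b₂ b₃ (Admitted-↭ q a))
  where q = ↭-trans p (Permₚ.++⁺ p₁ (Permₚ.++⁺ p₂ p₃))

-- Bounding the exceptional tuples

entry-bound : ℕ → ℕ
entry-bound U = U + (84 * U + 2 * U * U) * U

moduli-coprime : ∀ {U xs ys zs} → Admitted xs → xs ↭ ys ++ zs → (cl : Cluster U ys) (cl′ : Cluster U zs) → Coprime (modulus cl) (modulus cl′)
moduli-coprime {ys = ys} a p cl cl′ {k} (k∣m , k∣n) = Admitted.coprime-entries a k (λ x∈ →
  [ (λ y∈ → divides-entry k∣m (multiples cl y∈)) , (λ z∈ → divides-entry k∣n (multiples cl′ z∈)) ]′ (∈-++⁻ ys (Permₚ.∈-resp-↭ p x∈)))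
  where
  divides-entry : ∀ {m c U} → k ∣ m → (∃[ u ] c ≡ m * u × u ≤ U) → k ∣ c
  divides-entry k∣m (u , refl , _) = Div.∣-trans k∣m (Div.m∣m*n u)

-- The modulus of a single cluster divides every entry, so it is 1. With two clusters a large
-- modulus on either side is contradictory, the roles being exchanged by commuting the two parts;
-- hence both moduli, and with them all entries, are bounded.
bounded-or-family : ∀ {U xs} → Admitted xs → Landau xs → length xs ≤ 84 → Decomposition U xs →
  (∀ {s c} → (s , c) ∈ xs → c ≤ entry-bound U) ⊎ Family xs
bounded-or-family {U} {xs} a l short (one (cluster m mult)) = inj₁ λ x∈ → let (u , e , u≤U) = mult x∈ in
    ≤-trans (≤-reflexive (trans e (trans (cong (_* u) m≡1) (*-identityˡ u)))) (≤-trans u≤U (m≤m+n U _))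
  where
  m≡1 : m ≡ 1
  m≡1 = Admitted.coprime-entries a m (λ x∈ → let (u , e , _) = mult x∈ in subst (m ∣_) (sym e) (Div.m∣m*n u))
bounded-or-family a l short (three p min₁ min₂ min₃) = inj₂ (three-minimal a p min₁ min₂ min₃)
bounded-or-family {U} {xs} a l short (two {ys} {zs} p 0<ys 0<zs cl cl′)
  with modulus cl ≤? 84 * U + 2 * U * U | modulus cl′ ≤? 84 * U + 2 * U * U
... | no m≰ | _ = contradiction (TwoClusters.absurd (Admitted.good a) l short p 0<ys 0<zs cl cl′ (moduli-coprime a p cl cl′) (≰⇒> m≰)) (λ ())
... | yes _ | no n≰ = contradiction (TwoClusters.absurd (Admitted.good a) l short p′ 0<zs 0<ys cl′ cl (moduli-coprime a p′ cl′ cl) (≰⇒> n≰)) (λ ())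
  where p′ = ↭-trans p (Permₚ.++-comm ys zs)
... | yes m≤ | yes n≤ = inj₁ λ x∈ → [ (λ y∈ → product-bound m≤ (multiples cl y∈)) , (λ z∈ → product-bound n≤ (multiples cl′ z∈)) ]′ (∈-++⁻ ys (Permₚ.∈-resp-↭ p x∈))
  where
  product-bound : ∀ {m c} → m ≤ 84 * U + 2 * U * U → (∃[ u ] c ≡ m * u × u ≤ U) → c ≤ entry-bound U
  product-bound m≤ (u , refl , u≤U) = ≤-trans (*-mono-≤ m≤ u≤U) (m≤n+m _ U)

tuples : ℕ → ℕ → List (List ℕ)
tuples zero W = [] ∷ []
tuples (suc n) W = [] ∷ cartesianProductWith _∷_ (upTo (suc W)) (tuples n W)

∈-tuples : ∀ {n W xs} → length xs ≤ n → All (_≤ W) xs → xs ∈ tuples n W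
∈-tuples {zero} {xs = []} _ _ = here refl
∈-tuples {suc n} {xs = []} _ _ = here refl
∈-tuples {suc n} {xs = x ∷ xs} (s≤s le) (x≤W ∷ xs≤W) = there (∈-cartesianProductWith⁺ _∷_ (∈-upTo⁺ (s≤s x≤W)) (∈-tuples le xs≤W))

box : ℕ → ℕ → List (List ℕ × List ℕ)
box n W = cartesianProduct (tuples n W) (tuples n W)

∈-box : ∀ n W {as bs} → length as ≤ n → length bs ≤ n → All (_≤ W) as → All (_≤ W) bs → (as , bs) ∈ box n W
∈-box n W as≤ bs≤ as-bounded bs-bounded = ∈-cartesianProduct⁺ (∈-tuples {n} {W} as≤ as-bounded) (∈-tuples {n} {W} bs≤ bs-bounded)

opaque
  -- A whole box of tuples, including inadmissible ones and members of the families: only its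
  -- finiteness matters. It is opaque because it is far too large to be enumerated.
  exceptions : List (List ℕ × List ℕ)
  exceptions = box 84 (entry-bound (threshold ℕ.^ 84))

  ∈-exceptions : ∀ {as bs} → length as ≤ 84 → length bs ≤ 84 →
    All (_≤ entry-bound (threshold ℕ.^ 84)) as → All (_≤ entry-bound (threshold ℕ.^ 84)) bs → (as , bs) ∈ exceptions
  ∈-exceptions = ∈-box 84 (entry-bound (threshold ℕ.^ 84))

gcdList-greatest : ∀ {k xs} → All (k ∣_) xs → k ∣ gcdList xs
gcdList-greatest {k} [] = k Div.∣0
gcdList-greatest (k∣x ∷ rest) = GCD.gcd-greatest k∣x (gcdList-greatest rest)

length-signed : ∀ as bs → length (signed as bs) ≡ length as + length bs
length-signed (a ∷ as) bs = cong suc (length-signed as bs)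
length-signed [] [] = refl
length-signed [] (b ∷ bs) = cong suc (length-signed [] bs)

∈-signed⁺ˡ : ∀ {as} bs {a} → a ∈ as → (true , a) ∈ signed as bs
∈-signed⁺ˡ bs m = ∈-++⁺ˡ (∈-map⁺ (true ,_) m)

∈-signed⁺ʳ : ∀ as {bs b} → b ∈ bs → (false , b) ∈ signed as bs
∈-signed⁺ʳ as m = ∈-++⁺ʳ (map (true ,_) as) (∈-map⁺ (false ,_) m)

∈-signed⁻ᵗ : ∀ as bs {c} → (true , c) ∈ signed as bs → c ∈ as
∈-signed⁻ᵗ as bs m = subst (_ ∈_) (plus-signed as bs) (∈-plus m)

∈-signed⁻ᶠ : ∀ as bs {c} → (false , c) ∈ signed as bs → c ∈ bs
∈-signed⁻ᶠ as bs m = subst (_ ∈_) (minus-signed as bs) (∈-minus m)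

module _ {as bs : List ℕ} (admissible : Admissible as bs) where

  private
    0<as : All (0 <_) as
    0<as = proj₁ (proj₂ (proj₂ admissible))
    0<bs : All (0 <_) bs
    0<bs = proj₁ (proj₂ (proj₂ (proj₂ admissible)))
    length-bs : length bs ≡ suc (length as)
    length-bs = proj₁ (proj₂ admissible)
    sum≡ : sum as ≡ sum bs
    sum≡ = proj₁ (proj₂ (proj₂ (proj₂ (proj₂ admissible))))
    disjoint : All (λ x → All (λ y → x ≢ y) bs) as
    disjoint = proj₁ (proj₂ (proj₂ (proj₂ (proj₂ (proj₂ admissible)))))
    gcd≡1 : gcdList (as ++ bs) ≡ 1
    gcd≡1 = proj₁ (proj₂ (proj₂ (proj₂ (proj₂ (proj₂ (proj₂ admissible))))))
    integral : ∀ n → 1 ≤ n → factProd bs n ∣ factProd as n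
    integral = proj₂ (proj₂ (proj₂ (proj₂ (proj₂ (proj₂ (proj₂ admissible))))))

    lem₀ : ∀ x → x ⊖ x ≡ 0ℚ
    lem₀ = solve-∀ ring
    lem₁ : ∀ n → n ⊖ (1ℚ ⊕ n) ≡ ⊝ 1ℚ
    lem₁ = solve-∀ ring

    sum-ones : ∀ (xs : List ℕ) → sum (map (λ _ → 1) xs) ≡ length xs
    sum-ones [] = refl
    sum-ones (x ∷ xs) = cong suc (sum-ones xs)

  signed-good : Good (signed as bs)
  signed-good = record { positive = pos ; consistent = cons }
    where
    pos : ∀ {s c} → (s , c) ∈ signed as bs → 0 < c
    pos {true} m = All.lookup 0<as (∈-signed⁻ᵗ as bs m)
    pos {false} m = All.lookup 0<bs (∈-signed⁻ᶠ as bs m)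
    clash : ∀ {c} → c ∈ as → c ∈ bs → ⊥
    clash m m′ = All.lookup (All.lookup disjoint m) m′ refl
    cons : ∀ {s t c} → (s , c) ∈ signed as bs → (t , c) ∈ signed as bs → s ≡ t
    cons {true} {true} _ _ = refl
    cons {false} {false} _ _ = refl
    cons {true} {false} m m′ = contradiction (clash (∈-signed⁻ᵗ as bs m) (∈-signed⁻ᶠ as bs m′)) (λ ())
    cons {false} {true} m m′ = contradiction (clash (∈-signed⁻ᵗ as bs m′) (∈-signed⁻ᶠ as bs m)) (λ ())

  signed-admitted : Admitted (signed as bs)
  signed-admitted = record
    { good = signed-good
    ; coprime-entries = λ k h → Div.∣1⇒≡1 (subst (k ∣_) gcd≡1 (gcdList-greatest
        (Allₚ.++⁺ (All.tabulate (λ m → h (∈-signed⁺ˡ bs m))) (All.tabulate (λ m → h (∈-signed⁺ʳ as m))))))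
    ; balanced = trans (lin-signed as bs (λ c → c)) (trans (cong₂ (λ x y → ι (sum x) ⊖ ι (sum y)) (Listₚ.map-id as) (Listₚ.map-id bs))
        (trans (cong (λ x → ι x ⊖ ι (sum bs)) sum≡) (lem₀ (ι (sum bs)))))
    ; height-one = trans (lin-cong ⟦ signed as bs ⟧ (λ _ → sym ι1)) (trans (lin-signed as bs (λ _ → 1))
        (trans (cong₂ (λ x y → ι x ⊖ ι y) (sum-ones as) (trans (sum-ones bs) length-bs)) (trans (cong (ι (length as) ⊖_) (ι-suc (length as))) (lem₁ (ι (length as))))))
    }

  signed-landau : Landau (signed as bs)
  signed-landau = Landau-intro signed-good (Admitted.balanced signed-admitted) (Admitted.height-one signed-admitted)
    (λ n N 0<N → subst (0ℚ ≼_) (sym (lin-signed as bs (λ c → (c * n) div N))) (diff≥0 (ι-mono-≤ (landau as bs integral n N 0<N))))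

  signed-short : length (signed as bs) ≤ 84
  signed-short = length≤84 signed-good (Landau⇒Q≡3 signed-good signed-landau)

  signed-nonempty : 0 < length (signed as bs)
  signed-nonempty = subst (0 <_) (sym (length-signed as bs)) (≤-trans (proj₁ admissible) (m≤m+n (length as) (length bs)))

  lengths≤84 : length as ≤ 84 × length bs ≤ 84
  lengths≤84 = ≤-trans (m≤m+n (length as) (length bs)) le , ≤-trans (m≤n+m (length bs) (length as)) le
    where le = subst (_≤ 84) (length-signed as bs) signed-short

  exceptional-or-family : ((as , bs) ∈ exceptions) ⊎ InFamily as bs
  exceptional-or-family = [ (λ bounded → inj₁ (∈-exceptions (proj₁ lengths≤84) (proj₂ lengths≤84)
      (All.tabulate (λ m → bounded (∈-signed⁺ˡ bs m))) (All.tabulate (λ m → bounded (∈-signed⁺ʳ as m))))) ,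
    (λ family → inj₂ (subst₂ InFamily (plus-signed as bs) (minus-signed as bs) family)) ]′
    (bounded-or-family signed-admitted signed-landau signed-short (decompose signed-good (Landau⇒Q≡3 signed-good signed-landau) signed-nonempty))

theorem5p1 : Σ (List (List ℕ × List ℕ)) λ E → (∀ (as bs : List ℕ) → Admissible as bs → ((as , bs) ∈ E) ⊎ InFamily as bs)
theorem5p1 = exceptions , λ as bs → exceptional-or-family
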